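{- For $n \geq 2$ and $i>j$, we have the following two-point correlations: $$c_{i,j}(n)=\begin{cases} \frac{n}{\binom{n+j}{2}}-\frac{n}{\binom{n+i}{2}}, & \text{ if }j < i < n, \\ \frac{n(j+1)}{\binom{n+j}{2}}-\frac{n(j-1)}{\binom{n+j-1}{2}}-\frac{n}{\binom{2n}{2}}, & \text{ if } j < i = n. \end{cases}$$
   Context: Consider the continuous multispecies TASEP on a ring with type $(1,\ldots,1)$ (an $n$-tuple of ones): there are $n$ particles, each carrying a distinct label from $[n]=\{1,\ldots,n\}$. This is the distribution of labelled particles on the continuous ring $[0,1)$ obtained as the limit, as the number of sites $L\to\infty$ (with the numbers of labelled particles fixed, unoccupied sites treated as label $n+1$, ring rescaled to $[0,1)$), of the stationary distribution of the multispecies TASEP on a ring with $L$ sites in which each particle with label $i$ jumps left at rate 1, swapping with the left neighbour when that neighbour has a larger label. Let $c_{i,j}(n)$ denote the probability, in this limiting distribution, that the particles labelled $i$ and $j$ are next to each other with the particle labelled $i$ immediately to the left of the particle labelled $j$. -}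

module Defs where

open import Data.Bool using (Bool; true; false; if_then_else_; _∧_)
open import Data.Nat using (ℕ; zero; suc; _+_; _*_; _∸_; _≤_; _<_; _<ᵇ_; _≡ᵇ_)
open import Data.Nat.Combinatorics using (_C_)
open import Data.List using (List; []; _∷_; _++_; map; concatMap; filterᵇ; length; reverse; upTo; foldr)
open import Data.Bool.ListAction using (and)
open import Data.Maybe using (Maybe; just; nothing)
open import Data.Integer using (+_)
open import Data.Rational using (ℚ; _/_; 0ℚ; 1ℚ; _-_; ∣_∣) renaming (_+_ to _+ℚ_; _*_ to _*ℚ_; _<_ to _<ℚ_; _≤_ to _≤ℚ_)
open import Data.Product using (_×_; ∃-syntax)
open import Relation.Binary.PropositionalEquality using (_≡_)

-- Discrete multispecies TASEP on a ring of L sites, n labelled particles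
-- of type (1,...,1).  A configuration is a list of length L of site
-- contents: labels 1..n for particles, n+1 for an empty site (hole).
-- Sites are indexed 0..L-1 from left to right; the left neighbour of
-- site k is k-1 (cyclically, the left neighbour of site 0 is site L-1).

hole : ℕ → ℕ
hole n = suc n

allWords : ℕ → ℕ → List (List ℕ)
allWords m zero    = [] ∷ []
allWords m (suc L) = concatMap (λ x → map (suc x ∷_) (allWords m L)) (upTo m)

countᵇ : ℕ → List ℕ → ℕ
countᵇ k []       = 0
countᵇ k (x ∷ xs) = if k ≡ᵇ x then suc (countᵇ k xs) else countᵇ k xs

isConfig : ℕ → List ℕ → Bool
isConfig n η = and (map (λ k → countᵇ (suc k) η ≡ᵇ 1) (upTo n))

configs : ℕ → ℕ → List (List ℕ)
configs n L = filterᵇ (isConfig n) (allWords (suc n) L)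

linearMoves : List ℕ → List (List ℕ)
linearMoves (a ∷ b ∷ rest) =
  (if b <ᵇ a then (b ∷ a ∷ rest) ∷ [] else []) ++ map (a ∷_) (linearMoves (b ∷ rest))
linearMoves _ = []

lastOr : ℕ → List ℕ → ℕ
lastOr d []       = d
lastOr d (z ∷ zs) = lastOr z zs

setLast : ℕ → List ℕ → List ℕ
setLast v []           = []
setLast v (z ∷ [])     = v ∷ []
setLast v (z ∷ w ∷ zs) = z ∷ setLast v (w ∷ zs)

wrapMove : List ℕ → List (List ℕ)
wrapMove []            = []
wrapMove (x ∷ [])      = []
wrapMove (x ∷ y ∷ rest) =
  if x <ᵇ lastOr y rest then (lastOr y rest ∷ setLast x (y ∷ rest)) ∷ [] else []

-- all transitions out of η, each occurring at rate 1 (listed with multiplicity)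
moves : List ℕ → List (List ℕ)
moves η = linearMoves η ++ wrapMove η

listEqᵇ : List ℕ → List ℕ → Bool
listEqᵇ []       []       = true
listEqᵇ (x ∷ xs) (y ∷ ys) = (x ≡ᵇ y) ∧ listEqᵇ xs ys
listEqᵇ _        _        = false

rateTo : List ℕ → List ℕ → ℕ
rateTo η' η = length (filterᵇ (listEqᵇ η) (moves η'))

ℕtoℚ : ℕ → ℚ
ℕtoℚ k = + k / 1

sumℚ : List ℚ → ℚ
sumℚ = foldr _+ℚ_ 0ℚ

IsStationary : (n L : ℕ) → (List ℕ → ℚ) → Set
IsStationary n L π =
  ((η : List ℕ) → isConfig n η ≡ true → length η ≡ L → 0ℚ ≤ℚ π η)
  × (sumℚ (map π (configs n L)) ≡ 1ℚ)
  × ((η : List ℕ) → isConfig n η ≡ true → length η ≡ L →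
       π η *ℚ ℕtoℚ (length (moves η))
         ≡ sumℚ (map (λ η' → π η' *ℚ ℕtoℚ (rateTo η' η)) (configs n L)))

-- The event "particle i is immediately to the left of particle j":
-- going right (cyclically) from the site of particle i, the first
-- particle met is particle j (holes in between are ignored; in the
-- continuous limit they disappear).

afterCyclic : ℕ → List ℕ → List ℕ → List ℕ
afterCyclic i []       acc = []
afterCyclic i (x ∷ xs) acc = if i ≡ᵇ x then xs ++ reverse acc else afterCyclic i xs (x ∷ acc)

firstParticle : ℕ → List ℕ → Maybe ℕ
firstParticle n []       = nothing
firstParticle n (x ∷ xs) = if x ≡ᵇ hole n then firstParticle n xs else just x

adjacentᵇ : ℕ → ℕ → ℕ → List ℕ → Bool
adjacentᵇ n i j η with firstParticle n (afterCyclic i η [])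
... | just k  = k ≡ᵇ j
... | nothing = false

adjProb : (n L : ℕ) → (List ℕ → ℚ) → ℕ → ℕ → ℚ
adjProb n L π i j = sumℚ (map π (filterᵇ (adjacentᵇ n i j) (configs n L)))

-- c is the two-point correlation c_{i,j}(n) of the continuous multispecies
-- TASEP: the limit, as L → ∞, of the stationary probability that particle i
-- is immediately to the left of particle j (ε-definition of the limit in ℚ;
-- the stationary distribution is unique, so we quantify over all of them).
IsTwoPointCorrelation : (n i j : ℕ) → ℚ → Set
IsTwoPointCorrelation n i j c =
  (ε : ℚ) → 0ℚ <ℚ ε →
  ∃[ L₀ ] ((L : ℕ) → L₀ ≤ L → (π : List ℕ → ℚ) → IsStationary n L π →
           ∣ adjProb n L π i j - c ∣ <ℚ ε)

-- a / d as a rational (d is always nonzero where used; frac a 0 = 0)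
frac : ℕ → ℕ → ℚ
frac a zero    = 0ℚ
frac a (suc d) = + a / suc d

cFormula : (n i j : ℕ) → ℚ
cFormula n i j with i ≡ᵇ n
... | false = frac n ((n + j) C 2) - frac n ((n + i) C 2)
... | true  = (frac (n * (j + 1)) ((n + j) C 2) - frac (n * (j ∸ 1)) ((n + j ∸ 1) C 2))
                - frac n ((2 * n) C 2)

{-# OPTIONS --safe #-}
module Submission where

-- Lump the labels into the classes {1..a}, {a+1..b}, {b+1..n} and the holes. The probability that i is
-- followed by j is obtained by inclusion-exclusion from the expected number of pairs "class 3 followed
-- by class 2" for a ∈ {j-1, j} and b ∈ {i-1, i}.
--
-- The lumped process is stationary under the law of the three-row Ferrari-Martin multiline queue with
-- rows of sizes a, b, n. Sending an arrival word through a queue with uniformly random services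
-- intertwines the generators, because the services 01 and 10 at a bond compensate each other; and a
-- stationary law is unique, since the set where the difference of two such laws is positive is closed
-- under the jumps, all of which lead to the sorted word.
--
-- By rotation invariance only the pairs that start at site 0 have to be counted. There all queues are
-- empty, so reading the columns as words in X, Y, Z (rows 1, 2, 3) turns the event into a condition on
-- words: Y^k X^l Z ... with k ≥ 1, every suffix having at most as many X as Y and at most as many Y as Z.
-- As L → ∞ columns with two letters are negligible, and such words have closed counts.

open import Defs
open import Data.Bool using (Bool; true; false; if_then_else_; _∧_; T; T?)
open import Data.Bool.ListAction using (and)
open import Data.Nat using (ℕ; zero; suc; pred; _+_; _*_; _∸_; _^_; _≤_; _<_; z≤n; s≤s; _<ᵇ_; _≡ᵇ_; _≤?_; _<?_; _⊓_; _⊔_; _!; NonZero)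
import Data.Nat as ℕ
import Data.Nat.Properties as ℕₚ
import Data.Nat.Tactic.RingSolver as ℕ-Ring
open import Data.Nat.Combinatorics using (_C_; nC1≡n; nCk+nC[k+1]≡[n+1]C[k+1])
open import Data.List using (List; []; _∷_; _++_; _∷ʳ_; map; concatMap; filterᵇ; length; reverse; upTo; replicate)
import Data.List.Properties as Listₚ
open import Data.List.Membership.Propositional using (_∈_; find; lose)
import Data.List.Membership.Propositional.Properties as ∈ₚ
open import Data.List.Relation.Unary.Any using (here; there)
open import Data.List.Relation.Unary.All as All using (All; []; _∷_)
import Data.List.Relation.Unary.All.Properties as Allₚ
open import Data.List.Relation.Binary.Permutation.Propositional using (_↭_; ↭-refl; ↭-trans; prep; swap)
import Data.List.Relation.Binary.Permutation.Propositional as ↭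
import Data.List.Relation.Binary.Permutation.Propositional.Properties as ↭ₚ
open import Data.Maybe as Maybe using (Maybe; just; nothing)
import Data.Integer as ℤ
import Data.Integer.Properties as ℤₚ
open import Data.Rational using (ℚ; 0ℚ; 1ℚ; ∣_∣) renaming (_+_ to _+ℚ_; _*_ to _*ℚ_; _-_ to _-ℚ_; -_ to -ℚ_; _<_ to _<ℚ_; _≤_ to _≤ℚ_)
import Data.Rational as ℚ
import Data.Rational.Properties as ℚₚ
import Data.Rational.Solver as ℚ-Solver
import Data.Rational.Unnormalised as ℚᵘ
import Data.Rational.Unnormalised.Properties as ℚᵘₚ
open import Data.Product using (_×_; _,_; proj₁; proj₂; ∃-syntax)
open import Data.Sum using (_⊎_; inj₁; inj₂; [_,_]′)
open import Data.Unit using (tt)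
open import Relation.Nullary using (¬_; yes; no; contradiction)
import Relation.Binary.Definitions as Tri
open import Relation.Binary.PropositionalEquality using (_≡_; _≢_; refl; sym; trans; cong; cong₂; subst; subst₂; module ≡-Reasoning)

-- The compensation of 01 and 10 is not exact at a single bond. Summed over the services, sorting
-- the arrivals and sorting the departures still differ by `g (queue w S)` times a discrete gradient
-- of the vacancy indicator. This gradient sums to zero around the ring. Hence the generator is a
-- sum over rotations of one front bond, and the queue must commute with rotations, which makes it
-- start in a fixed point of a full turn. Laws are kept as weighted lists of words, so a signed
-- difference can be tested directly and no normalisation has to be divided out. The description at
-- site 0 is exact for every L. Only the ratio of two column counts is asymptotic: L - 1 columns and
-- N letters against L columns and N + 1 letters. The limit is a term in b, a term in a and a mixed
-- term. For i < n only the mixed term survives the inclusion-exclusion. For i = n the threshold b =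
-- n leaves class 3 empty, two of the four terms vanish, and the term in a stays. This is the origin
-- of the two cases of the formula.

∑ : {A : Set} → List A → (A → ℚ) → ℚ
∑ xs f = sumℚ (map f xs)

∑-cong-∈ : {A : Set} (xs : List A) {f g : A → ℚ} → (∀ x → x ∈ xs → f x ≡ g x) → ∑ xs f ≡ ∑ xs g
∑-cong-∈ []       h = refl
∑-cong-∈ (x ∷ xs) h = cong₂ _+ℚ_ (h x (here refl)) (∑-cong-∈ xs (λ y y∈ → h y (there y∈)))

∑-cong : {A : Set} (xs : List A) {f g : A → ℚ} → (∀ x → f x ≡ g x) → ∑ xs f ≡ ∑ xs g
∑-cong xs h = ∑-cong-∈ xs (λ x _ → h x)

∑-++ : {A : Set} (xs ys : List A) (f : A → ℚ) → ∑ (xs ++ ys) f ≡ ∑ xs f +ℚ ∑ ys f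
∑-++ []       ys f = sym (ℚₚ.+-identityˡ (∑ ys f))
∑-++ (x ∷ xs) ys f = trans (cong (f x +ℚ_) (∑-++ xs ys f)) (sym (ℚₚ.+-assoc (f x) (∑ xs f) (∑ ys f)))

∑-map : {A B : Set} (h : A → B) (xs : List A) (f : B → ℚ) → ∑ (map h xs) f ≡ ∑ xs (λ x → f (h x))
∑-map h xs f = cong sumℚ (sym (Listₚ.map-∘ xs))

∑-0 : {A : Set} (xs : List A) → ∑ xs (λ _ → 0ℚ) ≡ 0ℚ
∑-0 []       = refl
∑-0 (x ∷ xs) = trans (ℚₚ.+-identityˡ _) (∑-0 xs)

∑-zero : {A : Set} (xs : List A) {f : A → ℚ} → (∀ x → x ∈ xs → f x ≡ 0ℚ) → ∑ xs f ≡ 0ℚ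
∑-zero xs h = trans (∑-cong-∈ xs h) (∑-0 xs)

+ℚ-interchange : ∀ a b c d → (a +ℚ b) +ℚ (c +ℚ d) ≡ (a +ℚ c) +ℚ (b +ℚ d)
+ℚ-interchange = solve 4 (λ a b c d → (a :+ b) :+ (c :+ d) := (a :+ c) :+ (b :+ d)) refl
  where open ℚ-Solver.+-*-Solver

p-q≡0⇒p≡q : ∀ p q → p -ℚ q ≡ 0ℚ → p ≡ q
p-q≡0⇒p≡q p q e = trans (lem p q) (trans (cong (_+ℚ q) e) (ℚₚ.+-identityˡ q))
  where
  lem : ∀ p q → p ≡ (p -ℚ q) +ℚ q
  lem = solve 2 (λ p q → p := (p :- q) :+ q) refl
    where open ℚ-Solver.+-*-Solver

neg-involutive : ∀ p → -ℚ (-ℚ p) ≡ p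
neg-involutive = solve 1 (λ p → :- (:- p) := p) refl
  where open ℚ-Solver.+-*-Solver

∑-+ : {A : Set} (xs : List A) (f g : A → ℚ) → ∑ xs (λ x → f x +ℚ g x) ≡ ∑ xs f +ℚ ∑ xs g
∑-+ []       f g = refl
∑-+ (x ∷ xs) f g = trans (cong ((f x +ℚ g x) +ℚ_) (∑-+ xs f g)) (+ℚ-interchange (f x) (g x) (∑ xs f) (∑ xs g))

∑-*ˡ : {A : Set} (c : ℚ) (xs : List A) (f : A → ℚ) → ∑ xs (λ x → c *ℚ f x) ≡ c *ℚ ∑ xs f
∑-*ˡ c []       f = sym (ℚₚ.*-zeroʳ c)
∑-*ˡ c (x ∷ xs) f = trans (cong (c *ℚ f x +ℚ_) (∑-*ˡ c xs f)) (sym (ℚₚ.*-distribˡ-+ c (f x) (∑ xs f)))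

∑-neg : {A : Set} (xs : List A) (f : A → ℚ) → ∑ xs (λ x → -ℚ f x) ≡ -ℚ ∑ xs f
∑-neg []       f = refl
∑-neg (x ∷ xs) f = trans (cong (-ℚ f x +ℚ_) (∑-neg xs f)) (sym (ℚₚ.neg-distrib-+ (f x) (∑ xs f)))

∑-- : {A : Set} (xs : List A) (f g : A → ℚ) → ∑ xs (λ x → f x -ℚ g x) ≡ ∑ xs f -ℚ ∑ xs g
∑-- xs f g = trans (∑-+ xs f (λ x → -ℚ g x)) (cong (∑ xs f +ℚ_) (∑-neg xs g))

∑-swap : {A B : Set} (xs : List A) (ys : List B) (f : A → B → ℚ) →
         ∑ xs (λ x → ∑ ys (f x)) ≡ ∑ ys (λ y → ∑ xs (λ x → f x y))
∑-swap []       ys f = sym (∑-0 ys)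
∑-swap (x ∷ xs) ys f = trans (cong (∑ ys (f x) +ℚ_) (∑-swap xs ys f)) (sym (∑-+ ys (f x) (λ y → ∑ xs (λ x′ → f x′ y))))

∑-filter : {A : Set} (p : A → Bool) (xs : List A) (f : A → ℚ) →
           ∑ (filterᵇ p xs) f ≡ ∑ xs (λ x → if p x then f x else 0ℚ)
∑-filter p []       f = refl
∑-filter p (x ∷ xs) f with p x
... | true  = cong (f x +ℚ_) (∑-filter p xs f)
... | false = trans (∑-filter p xs f) (sym (ℚₚ.+-identityˡ _))

∑-concatMap : {A B : Set} (h : A → List B) (xs : List A) (f : B → ℚ) →
              ∑ (concatMap h xs) f ≡ ∑ xs (λ x → ∑ (h x) f)
∑-concatMap h []       f = refl
∑-concatMap h (x ∷ xs) f = trans (∑-++ (h x) (concatMap h xs) f) (cong (∑ (h x) f +ℚ_) (∑-concatMap h xs f))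

∑-upTo-suc : ∀ n (f : ℕ → ℚ) → ∑ (upTo (suc n)) f ≡ f 0 +ℚ ∑ (upTo n) (λ k → f (suc k))
∑-upTo-suc n f = cong (f 0 +ℚ_) (trans (cong (λ l → ∑ l f) (sym (Listₚ.map-upTo suc n))) (∑-map suc (upTo n) f))

∑-upTo-pick : ∀ {n k} (f : ℕ → ℚ) → k < n → ∑ (upTo n) (λ x → if x ≡ᵇ k then f x else 0ℚ) ≡ f k
∑-upTo-pick {suc n} {zero} f _ =
  trans (∑-upTo-suc n (λ x → if x ≡ᵇ 0 then f x else 0ℚ)) (trans (cong (f 0 +ℚ_) (∑-0 (upTo n))) (ℚₚ.+-identityʳ (f 0)))
∑-upTo-pick {suc n} {suc k} f (s≤s k<n) =
  trans (∑-upTo-suc n (λ x → if x ≡ᵇ suc k then f x else 0ℚ))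
  (trans (ℚₚ.+-identityˡ (∑ (upTo n) (λ x → if x ≡ᵇ k then f (suc x) else 0ℚ))) (∑-upTo-pick (λ x → f (suc x)) k<n))

-- Rotations and the generator

rotL : {A : Set} → List A → List A
rotL []      = []
rotL (x ∷ w) = w ∷ʳ x

rot : {A : Set} → ℕ → List A → List A
rot zero    w = w
rot (suc k) w = rot k (rotL w)

rot-++ : {A : Set} (u v : List A) → rot (length u) (u ++ v) ≡ v ++ u
rot-++ []      v = sym (Listₚ.++-identityʳ v)
rot-++ (x ∷ u) v = trans (cong (rot (length u)) (Listₚ.++-assoc u v (x ∷ [])))
                   (trans (rot-++ u (v ∷ʳ x)) (Listₚ.++-assoc v (x ∷ []) u))

rot-length : {A : Set} (w : List A) → rot (length w) w ≡ w
rot-length w = trans (cong (rot (length w)) (sym (Listₚ.++-identityʳ w))) (rot-++ w [])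

rot-+ : {A : Set} (j k : ℕ) (w : List A) → rot (j + k) w ≡ rot k (rot j w)
rot-+ zero    k w = refl
rot-+ (suc j) k w = rot-+ j k (rotL w)

length-rotL : {A : Set} (w : List A) → length (rotL w) ≡ length w
length-rotL []      = refl
length-rotL (x ∷ w) = trans (Listₚ.length-++ w) (ℕₚ.+-comm (length w) 1)

length-rot : {A : Set} (k : ℕ) (w : List A) → length (rot k w) ≡ length w
length-rot zero    w = refl
length-rot (suc k) w = trans (length-rot k (rotL w)) (length-rotL w)

map-rotL : {A B : Set} (h : A → B) (w : List A) → map h (rotL w) ≡ rotL (map h w)
map-rotL h []      = refl
map-rotL h (x ∷ w) = Listₚ.map-++ h w (x ∷ [])

map-rot : {A B : Set} (h : A → B) (k : ℕ) (w : List A) → map h (rot k w) ≡ rot k (map h w)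
map-rot h zero    w = refl
map-rot h (suc k) w = trans (map-rot h k (rotL w)) (cong (rot k) (map-rotL h w))

D₀ : (List ℕ → ℚ) → List ℕ → ℚ
D₀ g (x ∷ y ∷ w) = if y <ᵇ x then g (y ∷ x ∷ w) -ℚ g (x ∷ y ∷ w) else 0ℚ
D₀ g _           = 0ℚ

-- The bond between sites r and r + 1 is rotated to the front of the word.
𝓛-term : ℕ → (List ℕ → ℚ) → List ℕ → ℕ → ℚ
𝓛-term L g w r = D₀ (λ v → g (rot (L ∸ r) v)) (rot r w)

𝓛 : ℕ → (List ℕ → ℚ) → List ℕ → ℚ
𝓛 L g w = ∑ (upTo L) (𝓛-term L g w)

D₀-cong : ∀ {g h : List ℕ → ℚ} w → (∀ v → length v ≡ length w → g v ≡ h v) → D₀ g w ≡ D₀ h w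
D₀-cong []          e = refl
D₀-cong (x ∷ [])    e = refl
D₀-cong (x ∷ y ∷ w) e with y <ᵇ x
... | true  = cong₂ _-ℚ_ (e _ refl) (e _ refl)
... | false = refl

𝓛-term-bond : ∀ g u x y z → 𝓛-term (length (u ++ x ∷ y ∷ z)) g (u ++ x ∷ y ∷ z) (length u)
              ≡ (if y <ᵇ x then g (u ++ y ∷ x ∷ z) -ℚ g (u ++ x ∷ y ∷ z) else 0ℚ)
𝓛-term-bond g u x y z
  rewrite Listₚ.length-++ u {x ∷ y ∷ z} | ℕₚ.m+n∸m≡n (length u) (2 + length z)
        | rot-++ u (x ∷ y ∷ z) with y <ᵇ x
... | true  = cong₂ (λ a b → g a -ℚ g b) (rot-++ (y ∷ x ∷ z) u) (rot-++ (x ∷ y ∷ z) u)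
... | false = refl

lastOr-∷ʳ : ∀ d u x → lastOr d (u ∷ʳ x) ≡ x
lastOr-∷ʳ d []      x = refl
lastOr-∷ʳ d (y ∷ u) x = lastOr-∷ʳ y u x

setLast-∷ʳ : ∀ v u x → setLast v (u ∷ʳ x) ≡ u ∷ʳ v
setLast-∷ʳ v []          x = refl
setLast-∷ʳ v (y ∷ [])    x = refl
setLast-∷ʳ v (y ∷ z ∷ u) x = cong (y ∷_) (setLast-∷ʳ v (z ∷ u) x)

∑-if-singleton : {A : Set} (b : Bool) (v : A) (f : A → ℚ) →
                 ∑ (if b then v ∷ [] else []) f ≡ (if b then f v else 0ℚ)
∑-if-singleton true  v f = ℚₚ.+-identityʳ (f v)
∑-if-singleton false v f = refl

-- After L - 1 rotations the last site stands in front of site 0, so the wrap-around jump becomes a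
-- jump at the front bond. One more rotation leads back, hence `rotL` inside the test function.
wrapMove-D₀ : ∀ (g : List ℕ → ℚ) u x →
              ∑ (wrapMove (u ∷ʳ x)) (λ v → g v -ℚ g (u ∷ʳ x)) ≡ D₀ (λ v → g (rotL v)) (x ∷ u)
wrapMove-D₀ g []          x = refl
wrapMove-D₀ g (y ∷ [])    x = ∑-if-singleton (y <ᵇ x) _ (λ v → g v -ℚ g (y ∷ x ∷ []))
wrapMove-D₀ g (y ∷ z ∷ u) x rewrite lastOr-∷ʳ z u x | setLast-∷ʳ y (z ∷ u) x =
  ∑-if-singleton (y <ᵇ x) _ (λ v → g v -ℚ g (y ∷ z ∷ u ∷ʳ x))

-- Induction over the suffix that is still to be scanned: the bonds inside `u` are done, and the
-- wrap-around move is carried along unchanged. When the suffix is a single letter, that move is the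
-- bond r = L - 1.
moves-split : ∀ g w u x v → w ≡ u ++ x ∷ v →
  ∑ (linearMoves (x ∷ v)) (λ v′ → g (u ++ v′) -ℚ g w) +ℚ ∑ (wrapMove w) (λ v′ → g v′ -ℚ g w)
  ≡ ∑ (upTo (suc (length v))) (λ r → 𝓛-term (length w) g w (length u + r))
moves-split g w u x [] refl
  rewrite ℕₚ.+-identityʳ (length u) | rot-++ u (x ∷ []) | Listₚ.length-++ u {x ∷ []}
        | ℕₚ.m+n∸m≡n (length u) 1 =
  trans (ℚₚ.+-identityˡ _) (trans (wrapMove-D₀ g u x) (sym (ℚₚ.+-identityʳ _)))
moves-split g w u x (y ∷ v) w≡ = begin
  ∑ (first ++ map (x ∷_) (linearMoves (y ∷ v))) d +ℚ wrap
    ≡⟨ cong (_+ℚ wrap) (∑-++ first (map (x ∷_) (linearMoves (y ∷ v))) d) ⟩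
  (∑ first d +ℚ ∑ (map (x ∷_) (linearMoves (y ∷ v))) d) +ℚ wrap
    ≡⟨ ℚₚ.+-assoc (∑ first d) _ wrap ⟩
  ∑ first d +ℚ (∑ (map (x ∷_) (linearMoves (y ∷ v))) d +ℚ wrap)
    ≡⟨ cong₂ _+ℚ_ head≡ tail≡ ⟩
  t (length u + 0) +ℚ ∑ (upTo (suc (length v))) (λ r → t (length u + suc r))
    ≡⟨ sym (∑-upTo-suc (suc (length v)) (λ r → t (length u + r))) ⟩
  ∑ (upTo (2 + length v)) (λ r → t (length u + r)) ∎
  where
  open ≡-Reasoning
  t : ℕ → ℚ
  t = 𝓛-term (length w) g w
  d : List ℕ → ℚ
  d v′ = g (u ++ v′) -ℚ g w
  wrap : ℚ
  wrap = ∑ (wrapMove w) (λ v′ → g v′ -ℚ g w)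
  first : List (List ℕ)
  first = if y <ᵇ x then (y ∷ x ∷ v) ∷ [] else []
  head≡ : ∑ first d ≡ t (length u + 0)
  head≡ rewrite ℕₚ.+-identityʳ (length u) | w≡ =
    trans (∑-if-singleton (y <ᵇ x) (y ∷ x ∷ v) (λ v′ → g (u ++ v′) -ℚ g (u ++ x ∷ y ∷ v)))
          (sym (𝓛-term-bond g u x y v))
  tail≡ : ∑ (map (x ∷_) (linearMoves (y ∷ v))) d +ℚ wrap ≡ ∑ (upTo (suc (length v))) (λ r → t (length u + suc r))
  tail≡ = begin
    ∑ (map (x ∷_) (linearMoves (y ∷ v))) d +ℚ wrap
      ≡⟨ cong (_+ℚ wrap) (trans (∑-map (x ∷_) (linearMoves (y ∷ v)) d)
           (∑-cong (linearMoves (y ∷ v)) (λ v′ → cong (λ a → g a -ℚ g w) (sym (Listₚ.++-assoc u (x ∷ []) v′))))) ⟩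
    ∑ (linearMoves (y ∷ v)) (λ v′ → g ((u ∷ʳ x) ++ v′) -ℚ g w) +ℚ wrap
      ≡⟨ moves-split g w (u ∷ʳ x) y v (trans w≡ (sym (Listₚ.++-assoc u (x ∷ []) (y ∷ v)))) ⟩
    ∑ (upTo (suc (length v))) (λ r → t (length (u ∷ʳ x) + r))
      ≡⟨ ∑-cong (upTo (suc (length v))) (λ r → cong t (trans (cong (_+ r) (Listₚ.length-++ u)) (ℕₚ.+-assoc (length u) 1 r))) ⟩
    ∑ (upTo (suc (length v))) (λ r → t (length u + suc r)) ∎

moves-𝓛 : ∀ g w → ∑ (moves w) (λ v → g v -ℚ g w) ≡ 𝓛 (length w) g w
moves-𝓛 g []      = refl
moves-𝓛 g (x ∷ w) = trans (∑-++ (linearMoves (x ∷ w)) (wrapMove (x ∷ w)) _) (moves-split g (x ∷ w) [] x w refl)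

-- Configurations: closure under moves, enumeration

linearMoves-↭ : ∀ w {v} → v ∈ linearMoves w → w ↭ v
linearMoves-↭ (x ∷ y ∷ w) {v} v∈ with ∈ₚ.∈-++⁻ (if y <ᵇ x then (y ∷ x ∷ w) ∷ [] else []) v∈
... | inj₁ p = lem (y <ᵇ x) p
  where
  lem : ∀ b → v ∈ (if b then (y ∷ x ∷ w) ∷ [] else []) → x ∷ y ∷ w ↭ v
  lem true (here refl) = swap x y ↭-refl
... | inj₂ p with ∈ₚ.∈-map⁻ (x ∷_) p
... | v′ , v′∈ , refl = prep x (linearMoves-↭ (y ∷ w) v′∈)

setLast-↭ : ∀ x y w → x ∷ y ∷ w ↭ lastOr y w ∷ setLast x (y ∷ w)
setLast-↭ x y []      = swap x y ↭-refl
setLast-↭ x y (z ∷ w) = ↭-trans (swap x y ↭-refl) (↭-trans (prep y (setLast-↭ x z w)) (swap y (lastOr z w) ↭-refl))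

wrapMove-↭ : ∀ w {v} → v ∈ wrapMove w → w ↭ v
wrapMove-↭ (x ∷ y ∷ w) {v} v∈ = lem (x <ᵇ lastOr y w) v∈
  where
  lem : ∀ b → v ∈ (if b then (lastOr y w ∷ setLast x (y ∷ w)) ∷ [] else []) → x ∷ y ∷ w ↭ v
  lem true (here refl) = setLast-↭ x y w

moves-↭ : ∀ w {v} → v ∈ moves w → w ↭ v
moves-↭ w v∈ with ∈ₚ.∈-++⁻ (linearMoves w) v∈
... | inj₁ p = linearMoves-↭ w p
... | inj₂ p = wrapMove-↭ w p

countᵇ-↭ : ∀ k {w v} → w ↭ v → countᵇ k w ≡ countᵇ k v
countᵇ-↭ k ↭.refl = refl
countᵇ-↭ k (prep x p) = cong (λ c → if k ≡ᵇ x then suc c else c) (countᵇ-↭ k p)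
countᵇ-↭ k {_} {_ ∷ _ ∷ v} (swap x y p) rewrite countᵇ-↭ k p with k ≡ᵇ x | k ≡ᵇ y
... | true  | true  = refl
... | true  | false = refl
... | false | true  = refl
... | false | false = refl
countᵇ-↭ k (↭.trans p q) = trans (countᵇ-↭ k p) (countᵇ-↭ k q)

isConfig-↭ : ∀ n {w v} → w ↭ v → isConfig n w ≡ isConfig n v
isConfig-↭ n p = cong and (Listₚ.map-cong (λ k → cong (_≡ᵇ 1) (countᵇ-↭ (suc k) p)) (upTo n))

Label : ℕ → ℕ → Set
Label m x = 1 ≤ x × x ≤ m

allWords-∈ : ∀ m L {w} → w ∈ allWords m L → length w ≡ L × All (Label m) w
allWords-∈ m zero    (here refl) = refl , []
allWords-∈ m (suc L) w∈ with find (∈ₚ.∈-concatMap⁻ (λ x → map (suc x ∷_) (allWords m L)) {xs = upTo m} w∈)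
... | x , x∈ , w∈′ with ∈ₚ.∈-map⁻ (suc x ∷_) w∈′
... | w′ , w′∈ , refl with allWords-∈ m L w′∈
... | len , all = cong suc len , (s≤s z≤n , ∈ₚ.∈-upTo⁻ x∈) ∷ all

-- `isConfig` constrains only the labels 1 to n. The bound on the labels, which membership in
-- `configs` supplies, turns every other site into a hole.
record Config (n L : ℕ) (w : List ℕ) : Set where
  field
    config  : isConfig n w ≡ true
    len     : length w ≡ L
    labels  : All (Label (suc n)) w

T⇒≡ : ∀ {b} → T b → b ≡ true
T⇒≡ {true} _ = refl

configs-∈ : ∀ n L {w} → w ∈ configs n L → Config n L w
configs-∈ n L w∈ with ∈ₚ.∈-filter⁻ (λ w → T? (isConfig n w)) {xs = allWords (suc n) L} w∈
... | w∈′ , t with allWords-∈ (suc n) L w∈′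
... | l , a = record { config = T⇒≡ t ; len = l ; labels = a }

Config-↭ : ∀ {n L w v} → w ↭ v → Config n L w → Config n L v
Config-↭ {n} p c = record
  { config = trans (sym (isConfig-↭ n p)) (Config.config c)
  ; len    = trans (sym (↭ₚ.↭-length p)) (Config.len c)
  ; labels = ↭ₚ.All-resp-↭ p (Config.labels c) }

if-∧ : ∀ a b (p : ℚ) → (if a ∧ b then p else 0ℚ) ≡ (if a then (if b then p else 0ℚ) else 0ℚ)
if-∧ true  b p = refl
if-∧ false b p = refl

if-swap : ∀ a b (p : ℚ) → (if a then (if b then p else 0ℚ) else 0ℚ) ≡ (if b then (if a then p else 0ℚ) else 0ℚ)
if-swap true  true  p = refl
if-swap true  false p = refl
if-swap false true  p = refl
if-swap false false p = refl

∑-if : {A : Set} (b : Bool) (xs : List A) (f : A → ℚ) →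
       ∑ xs (λ x → if b then f x else 0ℚ) ≡ (if b then ∑ xs f else 0ℚ)
∑-if true  xs f = refl
∑-if false xs f = ∑-0 xs

-- Records that the enumeration contains each word exactly once, in the form needed later: a sum
-- against an indicator collapses to one value.
allWords-pick : ∀ m L {v} (f : List ℕ → ℚ) → length v ≡ L → All (Label m) v →
                ∑ (allWords m L) (λ w → if listEqᵇ w v then f w else 0ℚ) ≡ f v
allWords-pick m .0 f refl [] = ℚₚ.+-identityʳ (f [])
allWords-pick m .(suc _) {suc k ∷ v} f refl ((s≤s z≤n , k<m) ∷ all) = begin
  ∑ (allWords m (suc (length v))) F
    ≡⟨ ∑-concatMap (λ x → map (suc x ∷_) (allWords m (length v))) (upTo m) F ⟩
  ∑ (upTo m) (λ x → ∑ (map (suc x ∷_) (allWords m (length v))) F)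
    ≡⟨ ∑-cong (upTo m) inner ⟩
  ∑ (upTo m) (λ x → if x ≡ᵇ k then f (suc x ∷ v) else 0ℚ)
    ≡⟨ ∑-upTo-pick (λ x → f (suc x ∷ v)) k<m ⟩
  f (suc k ∷ v) ∎
  where
  open ≡-Reasoning
  F : List ℕ → ℚ
  F w = if listEqᵇ w (suc k ∷ v) then f w else 0ℚ
  inner : ∀ x → ∑ (map (suc x ∷_) (allWords m (length v))) F ≡ (if x ≡ᵇ k then f (suc x ∷ v) else 0ℚ)
  inner x = begin
    ∑ (map (suc x ∷_) (allWords m (length v))) F
      ≡⟨ ∑-map (suc x ∷_) (allWords m (length v)) F ⟩
    ∑ (allWords m (length v)) (λ w → if (x ≡ᵇ k) ∧ listEqᵇ w v then f (suc x ∷ w) else 0ℚ)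
      ≡⟨ ∑-cong (allWords m (length v)) (λ w → if-∧ (x ≡ᵇ k) (listEqᵇ w v) (f (suc x ∷ w))) ⟩
    ∑ (allWords m (length v)) (λ w → if x ≡ᵇ k then (if listEqᵇ w v then f (suc x ∷ w) else 0ℚ) else 0ℚ)
      ≡⟨ ∑-if (x ≡ᵇ k) (allWords m (length v)) (λ w → if listEqᵇ w v then f (suc x ∷ w) else 0ℚ) ⟩
    (if x ≡ᵇ k then ∑ (allWords m (length v)) (λ w → if listEqᵇ w v then f (suc x ∷ w) else 0ℚ) else 0ℚ)
      ≡⟨ cong (λ p → if x ≡ᵇ k then p else 0ℚ) (allWords-pick m (length v) (λ w → f (suc x ∷ w)) refl all) ⟩
    (if x ≡ᵇ k then f (suc x ∷ v) else 0ℚ) ∎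

configs-pick : ∀ {n L v} (f : List ℕ → ℚ) → Config n L v →
               ∑ (configs n L) (λ w → if listEqᵇ w v then f w else 0ℚ) ≡ f v
configs-pick {n} {L} {v} f c = begin
  ∑ (configs n L) (λ w → if listEqᵇ w v then f w else 0ℚ)
    ≡⟨ ∑-filter (isConfig n) (allWords (suc n) L) _ ⟩
  ∑ (allWords (suc n) L) (λ w → if isConfig n w then (if listEqᵇ w v then f w else 0ℚ) else 0ℚ)
    ≡⟨ ∑-cong (allWords (suc n) L) (λ w → if-swap (isConfig n w) (listEqᵇ w v) (f w)) ⟩
  ∑ (allWords (suc n) L) (λ w → if listEqᵇ w v then (if isConfig n w then f w else 0ℚ) else 0ℚ)
    ≡⟨ allWords-pick (suc n) L (λ w → if isConfig n w then f w else 0ℚ) (Config.len c) (Config.labels c) ⟩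
  (if isConfig n v then f v else 0ℚ)
    ≡⟨ cong (λ b → if b then f v else 0ℚ) (Config.config c) ⟩
  f v ∎
  where open ≡-Reasoning

-- The embedding of ℕ into ℚ

toℚᵘ-ℕtoℚ : ∀ k → ℚ.toℚᵘ (ℕtoℚ k) ℚᵘ.≃ ℚᵘ.mkℚᵘ (ℤ.+ k) 0
toℚᵘ-ℕtoℚ k = ℚₚ.toℚᵘ-fromℚᵘ (ℚᵘ.mkℚᵘ (ℤ.+ k) 0)

ℕtoℚ-+ : ∀ a b → ℕtoℚ (a + b) ≡ ℕtoℚ a +ℚ ℕtoℚ b
ℕtoℚ-+ a b = ℚₚ.toℚᵘ-injective (ℚᵘₚ.≃-trans (toℚᵘ-ℕtoℚ (a + b)) (ℚᵘₚ.≃-trans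
  (ℚᵘ.*≡* (cong (ℤ._* ℤ.+ 1) (sym (cong₂ ℤ._+_ (ℤₚ.*-identityʳ (ℤ.+ a)) (ℤₚ.*-identityʳ (ℤ.+ b))))))
  (ℚᵘₚ.≃-sym (ℚᵘₚ.≃-trans (ℚₚ.toℚᵘ-homo-+ (ℕtoℚ a) (ℕtoℚ b)) (ℚᵘₚ.+-cong (toℚᵘ-ℕtoℚ a) (toℚᵘ-ℕtoℚ b))))))

ℕtoℚ-* : ∀ a b → ℕtoℚ (a * b) ≡ ℕtoℚ a *ℚ ℕtoℚ b
ℕtoℚ-* a b = ℚₚ.toℚᵘ-injective (ℚᵘₚ.≃-trans (toℚᵘ-ℕtoℚ (a * b)) (ℚᵘₚ.≃-trans
  (ℚᵘ.*≡* (cong (ℤ._* ℤ.+ 1) (ℤₚ.pos-* a b)))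
  (ℚᵘₚ.≃-sym (ℚᵘₚ.≃-trans (ℚₚ.toℚᵘ-homo-* (ℕtoℚ a) (ℕtoℚ b)) (ℚᵘₚ.*-cong (toℚᵘ-ℕtoℚ a) (toℚᵘ-ℕtoℚ b))))))

ℕtoℚ-mono-≤ : ∀ {a b} → a ≤ b → ℕtoℚ a ≤ℚ ℕtoℚ b
ℕtoℚ-mono-≤ {a} {b} p = ℚₚ.toℚᵘ-cancel-≤ (ℚᵘₚ.≤-respˡ-≃ (ℚᵘₚ.≃-sym (toℚᵘ-ℕtoℚ a))
  (ℚᵘₚ.≤-respʳ-≃ (ℚᵘₚ.≃-sym (toℚᵘ-ℕtoℚ b)) (ℚᵘ.*≤* (ℤₚ.*-monoʳ-≤-nonNeg (ℤ.+ 1) (ℤ.+≤+ p)))))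

ℕtoℚ-mono-< : ∀ {a b} → a < b → ℕtoℚ a <ℚ ℕtoℚ b
ℕtoℚ-mono-< {a} {b} p = ℚₚ.toℚᵘ-cancel-< (ℚᵘₚ.<-respˡ-≃ (ℚᵘₚ.≃-sym (toℚᵘ-ℕtoℚ a))
  (ℚᵘₚ.<-respʳ-≃ (ℚᵘₚ.≃-sym (toℚᵘ-ℕtoℚ b)) (ℚᵘ.*<* (ℤₚ.*-monoʳ-<-pos (ℤ.+ 1) (ℤ.+<+ p)))))

ℕtoℚ-suc : ∀ k → ℕtoℚ (suc k) ≡ 1ℚ +ℚ ℕtoℚ k
ℕtoℚ-suc k = ℕtoℚ-+ 1 k

∑-const : {A : Set} (c : ℚ) (xs : List A) → ∑ xs (λ _ → c) ≡ c *ℚ ℕtoℚ (length xs)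
∑-const c []       = sym (ℚₚ.*-zeroʳ c)
∑-const c (x ∷ xs) = begin
  c +ℚ ∑ xs (λ _ → c)                ≡⟨ cong₂ _+ℚ_ (sym (ℚₚ.*-identityʳ c)) (∑-const c xs) ⟩
  c *ℚ 1ℚ +ℚ c *ℚ ℕtoℚ (length xs)   ≡⟨ sym (ℚₚ.*-distribˡ-+ c 1ℚ (ℕtoℚ (length xs))) ⟩
  c *ℚ (1ℚ +ℚ ℕtoℚ (length xs))      ≡⟨ cong (c *ℚ_) (sym (ℕtoℚ-suc (length xs))) ⟩
  c *ℚ ℕtoℚ (suc (length xs))        ∎
  where open ≡-Reasoning

-- Stationarity in terms of test functions

module _ {n L : ℕ} {π : List ℕ → ℚ} (stat : IsStationary n L π) where

  outflow : ∀ (g : List ℕ → ℚ) → ∑ (configs n L) (λ η → π η *ℚ ∑ (moves η) (λ _ → g η))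
            ≡ ∑ (configs n L) (λ η → ∑ (configs n L) (λ η′ → (π η′ *ℚ ℕtoℚ (rateTo η′ η)) *ℚ g η))
  outflow g = ∑-cong-∈ (configs n L) λ η η∈ → let c = configs-∈ n L η∈ in begin
    π η *ℚ ∑ (moves η) (λ _ → g η)                ≡⟨ cong (π η *ℚ_) (∑-const (g η) (moves η)) ⟩
    π η *ℚ (g η *ℚ ℕtoℚ (length (moves η)))       ≡⟨ cong (π η *ℚ_) (ℚₚ.*-comm (g η) _) ⟩
    π η *ℚ (ℕtoℚ (length (moves η)) *ℚ g η)       ≡⟨ sym (ℚₚ.*-assoc (π η) _ (g η)) ⟩
    π η *ℚ ℕtoℚ (length (moves η)) *ℚ g η
      ≡⟨ cong (_*ℚ g η) (proj₂ (proj₂ stat) η (Config.config c) (Config.len c)) ⟩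
    ∑ (configs n L) (λ η′ → π η′ *ℚ ℕtoℚ (rateTo η′ η)) *ℚ g η
      ≡⟨ ℚₚ.*-comm _ (g η) ⟩
    g η *ℚ ∑ (configs n L) (λ η′ → π η′ *ℚ ℕtoℚ (rateTo η′ η))
      ≡⟨ sym (∑-*ˡ (g η) (configs n L) (λ η′ → π η′ *ℚ ℕtoℚ (rateTo η′ η))) ⟩
    ∑ (configs n L) (λ η′ → g η *ℚ (π η′ *ℚ ℕtoℚ (rateTo η′ η)))
      ≡⟨ ∑-cong (configs n L) (λ η′ → ℚₚ.*-comm (g η) _) ⟩
    ∑ (configs n L) (λ η′ → (π η′ *ℚ ℕtoℚ (rateTo η′ η)) *ℚ g η) ∎
    where open ≡-Reasoning

  rate-∑ : ∀ c g η′ η → (c *ℚ ℕtoℚ (rateTo η′ η)) *ℚ g ≡ c *ℚ ∑ (moves η′) (λ v → if listEqᵇ η v then g else 0ℚ)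
  rate-∑ c g η′ η = begin
    (c *ℚ ℕtoℚ (rateTo η′ η)) *ℚ g       ≡⟨ ℚₚ.*-assoc c _ g ⟩
    c *ℚ (ℕtoℚ (rateTo η′ η) *ℚ g)       ≡⟨ cong (c *ℚ_) (ℚₚ.*-comm _ g) ⟩
    c *ℚ (g *ℚ ℕtoℚ (rateTo η′ η))       ≡⟨ cong (c *ℚ_) (sym (∑-const g (filterᵇ (listEqᵇ η) (moves η′)))) ⟩
    c *ℚ ∑ (filterᵇ (listEqᵇ η) (moves η′)) (λ _ → g)
      ≡⟨ cong (c *ℚ_) (∑-filter (listEqᵇ η) (moves η′) (λ _ → g)) ⟩
    c *ℚ ∑ (moves η′) (λ v → if listEqᵇ η v then g else 0ℚ) ∎
    where open ≡-Reasoning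

  inflow : ∀ (g : List ℕ → ℚ) → ∑ (configs n L) (λ η → ∑ (configs n L) (λ η′ → (π η′ *ℚ ℕtoℚ (rateTo η′ η)) *ℚ g η))
            ≡ ∑ (configs n L) (λ η′ → π η′ *ℚ ∑ (moves η′) g)
  inflow g = trans (∑-swap (configs n L) (configs n L) (λ η η′ → (π η′ *ℚ ℕtoℚ (rateTo η′ η)) *ℚ g η))
    (∑-cong-∈ (configs n L) λ η′ η′∈ → begin
      ∑ (configs n L) (λ η → (π η′ *ℚ ℕtoℚ (rateTo η′ η)) *ℚ g η)
        ≡⟨ ∑-cong (configs n L) (λ η → rate-∑ (π η′) (g η) η′ η) ⟩
      ∑ (configs n L) (λ η → π η′ *ℚ ∑ (moves η′) (λ v → if listEqᵇ η v then g η else 0ℚ))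
        ≡⟨ ∑-*ˡ (π η′) (configs n L) (λ η → ∑ (moves η′) (λ v → if listEqᵇ η v then g η else 0ℚ)) ⟩
      π η′ *ℚ ∑ (configs n L) (λ η → ∑ (moves η′) (λ v → if listEqᵇ η v then g η else 0ℚ))
        ≡⟨ cong (π η′ *ℚ_) (∑-swap (configs n L) (moves η′) (λ η v → if listEqᵇ η v then g η else 0ℚ)) ⟩
      π η′ *ℚ ∑ (moves η′) (λ v → ∑ (configs n L) (λ η → if listEqᵇ η v then g η else 0ℚ))
        ≡⟨ cong (π η′ *ℚ_) (∑-cong-∈ (moves η′) (λ v v∈ → configs-pick g (Config-↭ (moves-↭ η′ v∈) (configs-∈ n L η′∈)))) ⟩
      π η′ *ℚ ∑ (moves η′) g ∎)
    where open ≡-Reasoning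

  -- The balance equation at η is multiplied by `g η` and summed. After exchanging the sums, the
  -- inflow collects `g` at the targets of all moves. These targets are again configurations,
  -- because a move permutes the sites.
  stationary-𝓛 : ∀ (g : List ℕ → ℚ) → ∑ (configs n L) (λ η → π η *ℚ 𝓛 L g η) ≡ 0ℚ
  stationary-𝓛 g = begin
    ∑ (configs n L) (λ η → π η *ℚ 𝓛 L g η)
      ≡⟨ ∑-cong-∈ (configs n L) (λ η η∈ → trans
           (cong (λ l → π η *ℚ 𝓛 l g η) (sym (Config.len (configs-∈ n L η∈))))
           (trans (cong (π η *ℚ_) (trans (sym (moves-𝓛 g η)) (∑-- (moves η) g (λ _ → g η))))
             (*-distribˡ-- (π η) (∑ (moves η) g) (∑ (moves η) (λ _ → g η))))) ⟩
    ∑ (configs n L) (λ η → π η *ℚ ∑ (moves η) g -ℚ π η *ℚ ∑ (moves η) (λ _ → g η))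
      ≡⟨ ∑-- (configs n L) (λ η → π η *ℚ ∑ (moves η) g) (λ η → π η *ℚ ∑ (moves η) (λ _ → g η)) ⟩
    A -ℚ B
      ≡⟨ cong (λ z → A -ℚ z) (trans (outflow g) (inflow g)) ⟩
    A -ℚ A
      ≡⟨ ℚₚ.+-inverseʳ A ⟩
    0ℚ ∎
    where
    open ≡-Reasoning
    A B : ℚ
    A = ∑ (configs n L) (λ η → π η *ℚ ∑ (moves η) g)
    B = ∑ (configs n L) (λ η → π η *ℚ ∑ (moves η) (λ _ → g η))
    *-distribˡ-- : ∀ a b c → a *ℚ (b -ℚ c) ≡ a *ℚ b -ℚ a *ℚ c
    *-distribˡ-- = solve 3 (λ a b c → a :* (b :- c) := a :* b :- a :* c) refl
      where open ℚ-Solver.+-*-Solver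

-- Order-preserving relabellings

Monotone : (ℕ → ℕ) → Set
Monotone ρ = ∀ {x y} → x ≤ y → ρ x ≤ ρ y

<ᵇ-true : ∀ {m n} → m < n → (m <ᵇ n) ≡ true
<ᵇ-true m<n = T⇒≡ (ℕₚ.<⇒<ᵇ m<n)

<ᵇ-false : ∀ {m n} → n ≤ m → (m <ᵇ n) ≡ false
<ᵇ-false {m} {n} n≤m with m <ᵇ n in eq
... | false = refl
... | true  = contradiction (ℕₚ.<ᵇ⇒< m n (subst T (sym eq) tt)) (ℕₚ.≤⇒≯ n≤m)

-- If `ρ` merges the two labels of a jump, the jump becomes invisible and contributes g - g = 0.
-- Otherwise monotonicity keeps the strict order, and the same jump takes place after relabelling.
D₀-lump : ∀ (g : List ℕ → ℚ) {ρ} → Monotone ρ → ∀ w → D₀ (λ v → g (map ρ v)) w ≡ D₀ g (map ρ w)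
D₀-lump g mono []          = refl
D₀-lump g mono (x ∷ [])    = refl
D₀-lump g {ρ} mono (x ∷ y ∷ w) with y <? x
... | no y≮x rewrite <ᵇ-false (ℕₚ.≮⇒≥ y≮x) | <ᵇ-false (mono (ℕₚ.≮⇒≥ y≮x)) = refl
... | yes y<x with ℕₚ.m≤n⇒m<n∨m≡n (mono (ℕₚ.<⇒≤ y<x))
... | inj₁ ρy<ρx rewrite <ᵇ-true y<x | <ᵇ-true ρy<ρx = refl
... | inj₂ ρy≡ρx rewrite <ᵇ-true y<x | ρy≡ρx | <ᵇ-false (ℕₚ.≤-refl {ρ x}) =
  ℚₚ.+-inverseʳ (g (ρ x ∷ ρ x ∷ map ρ w))

𝓛-lump : ∀ L (g : List ℕ → ℚ) {ρ} → Monotone ρ → ∀ w → 𝓛 L (λ v → g (map ρ v)) w ≡ 𝓛 L g (map ρ w)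
𝓛-lump L g {ρ} mono w = ∑-cong (upTo L) λ r → begin
  D₀ (λ v → g (map ρ (rot (L ∸ r) v))) (rot r w)
    ≡⟨ D₀-cong (rot r w) (λ v _ → cong g (map-rot ρ (L ∸ r) v)) ⟩
  D₀ (λ v → g (rot (L ∸ r) (map ρ v))) (rot r w)
    ≡⟨ D₀-lump (λ v → g (rot (L ∸ r) v)) mono (rot r w) ⟩
  D₀ (λ v → g (rot (L ∸ r) v)) (map ρ (rot r w))
    ≡⟨ cong (D₀ (λ v → g (rot (L ∸ r) v))) (map-rot ρ r w) ⟩
  D₀ (λ v → g (rot (L ∸ r) v)) (rot r (map ρ w)) ∎
  where open ≡-Reasoning

-- Queues on the ring

data Kind : Set where
  first second none : Kind

kind : ℕ → Kind
kind 0 = first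
kind 1 = first
kind 2 = second
kind (suc (suc (suc _))) = none

-- Waiting customers of class 1 and of class 2.
State : Set
State = ℕ × ℕ

empty : State
empty = 0 , 0

arrive : Kind → State → State
arrive first  (q , r) = suc q , r
arrive second (q , r) = q , suc r
arrive none   s       = s

-- Departures are labelled 1 and 2 by class, 3 for an unused service; 4 marks a site without service.
serve : State → ℕ × State
serve (suc q , r)     = 1 , (q , r)
serve (zero , suc r)  = 2 , (zero , r)
serve (zero , zero)   = 3 , (zero , zero)

step : Kind → Bool → State → ℕ × State
step k true  s = serve (arrive k s)
step k false s = 4 , arrive k s

departures : State → List ℕ → List Bool → List ℕ
departures s (x ∷ w) (b ∷ S) = proj₁ (step (kind x) b s) ∷ departures (proj₂ (step (kind x) b s)) w S
departures s _       _       = []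

final : State → List ℕ → List Bool → State
final s (x ∷ w) (b ∷ S) = final (proj₂ (step (kind x) b s)) w S
final s _       _       = s

-- On the ring the queue starts from the state in which it ends when started empty.
queue : List ℕ → List Bool → List ℕ
queue w S = departures (final empty w S) w S

ind : ℕ → ℕ → ℕ
ind t x = if x <ᵇ suc t then 1 else 0

cntLe : ℕ → List ℕ → ℕ
cntLe t []      = 0
cntLe t (x ∷ w) = ind t x + cntLe t w

cntTrue : List Bool → ℕ
cntTrue []          = 0
cntTrue (true ∷ S)  = suc (cntTrue S)
cntTrue (false ∷ S) = cntTrue S

-- Class 1 alone, and classes 1 and 2 together, form single-class queues.
module SingleClass (a : ℕ → ℕ) where

  next : ℕ → Bool → ℕ → ℕ
  next x true  q = pred (a x + q)
  next x false q = a x + q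

  end : ℕ → List ℕ → List Bool → ℕ
  end q (x ∷ w) (b ∷ S) = end (next x b q) w S
  end q _       _       = q

  arrivals : List ℕ → ℕ
  arrivals []      = 0
  arrivals (x ∷ w) = a x + arrivals w

  next-mono : ∀ x b {q q′} → q ≤ q′ → next x b q ≤ next x b q′
  next-mono x true  le = ℕₚ.pred-mono-≤ (ℕₚ.+-monoʳ-≤ (a x) le)
  next-mono x false le = ℕₚ.+-monoʳ-≤ (a x) le

  end-mono : ∀ w S {q q′} → q ≤ q′ → end q w S ≤ end q′ w S
  end-mono []      S       le = le
  end-mono (x ∷ w) []      le = le
  end-mono (x ∷ w) (b ∷ S) le = end-mono w S (next-mono x b le)

  end-∷ʳ : ∀ q w S x b → length w ≡ length S → end q (w ∷ʳ x) (S ∷ʳ b) ≡ next x b (end q w S)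
  end-∷ʳ q []      []       x b _  = refl
  end-∷ʳ q (y ∷ w) (c ∷ S)  x b le = end-∷ʳ (next y c q) w S x b (ℕₚ.suc-injective le)

  -- Two queues driven by the same arrivals and services keep their order. If the upper one wastes a
  -- service, both are empty at that moment and coincide from then on. If it never does, its final
  -- length follows by counting customers.
  end-dichotomy : ∀ w S {q q′} → length w ≡ length S → q ≤ q′ →
                  end q′ w S ≡ end q w S ⊎ end q′ w S + cntTrue S ≡ q′ + arrivals w
  end-dichotomy [] [] _ _ = inj₂ refl
  end-dichotomy (x ∷ w) (false ∷ S) {q} {q′} l le with end-dichotomy w S (ℕₚ.suc-injective l) (next-mono x false le)
  ... | inj₁ e = inj₁ e
  ... | inj₂ e = inj₂ (trans e (lem (a x) q′ (arrivals w)))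
    where
    lem : ∀ i j k → i + j + k ≡ j + (i + k)
    lem = ℕ-Ring.solve-∀
  end-dichotomy (x ∷ w) (true ∷ S) {q} {q′} l le with a x + q′ in eq
  ... | zero = inj₁ (cong (λ z → end z w S) (sym (cong pred eq′)))
    where
    eq′ : a x + q ≡ 0
    eq′ = ℕₚ.n≤0⇒n≡0 (subst (a x + q ≤_) eq (ℕₚ.+-monoʳ-≤ (a x) le))
  ... | suc m with end-dichotomy w S (ℕₚ.suc-injective l) (subst (next x true q ≤_) (cong pred eq) (next-mono x true le))
  ... | inj₁ e = inj₁ e
  ... | inj₂ e = inj₂ (begin
    end m w S + suc (cntTrue S)   ≡⟨ ℕₚ.+-suc _ _ ⟩
    suc (end m w S + cntTrue S)   ≡⟨ cong suc e ⟩
    suc m + arrivals w            ≡⟨ cong (_+ arrivals w) (sym eq) ⟩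
    a x + q′ + arrivals w         ≡⟨ lem (a x) q′ (arrivals w) ⟩
    q′ + (a x + arrivals w)       ∎)
    where
    open ≡-Reasoning
    lem : ∀ i j k → i + j + k ≡ j + (i + k)
    lem = ℕ-Ring.solve-∀

  -- After the first turn the queue cannot become shorter, by monotonicity. If the second turn does
  -- not merge with the first, it wastes no service, and with at least as many services as arrivals
  -- the queue cannot become longer either.
  end-fixed : ∀ w S → length w ≡ length S → arrivals w ≤ cntTrue S → end (end 0 w S) w S ≡ end 0 w S
  end-fixed w S l le with end-dichotomy w S l (z≤n {end 0 w S})
  ... | inj₁ e = e
  ... | inj₂ e = ℕₚ.≤-antisym
    (ℕₚ.+-cancelʳ-≤ (cntTrue S) _ _ (subst (_≤ end 0 w S + cntTrue S) (sym e) (ℕₚ.+-monoʳ-≤ (end 0 w S) le)))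
    (end-mono w S z≤n)

  -- The start is the least fixed point of a full turn, and rotation transports fixed points.
  end-rotL : ∀ x w b S → length w ≡ length S → arrivals (x ∷ w) ≤ cntTrue (b ∷ S) →
             arrivals (w ∷ʳ x) ≤ cntTrue (S ∷ʳ b) →
             end 0 (w ∷ʳ x) (S ∷ʳ b) ≡ next x b (end 0 (x ∷ w) (b ∷ S))
  end-rotL x w b S l le le′ = ℕₚ.≤-antisym below above
    where
    s₀ = end 0 (x ∷ w) (b ∷ S)
    s₁ = next x b s₀
    f = end 0 (w ∷ʳ x) (S ∷ʳ b)
    f₀ = end f w S
    len-∷ʳ : length (w ∷ʳ x) ≡ length (S ∷ʳ b)
    len-∷ʳ = trans (Listₚ.length-++ w) (trans (cong (_+ 1) l) (sym (Listₚ.length-++ S)))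
    s₀-fixed : end s₁ w S ≡ s₀
    s₀-fixed = end-fixed (x ∷ w) (b ∷ S) (cong suc l) le
    f-fixed : next x b f₀ ≡ f
    f-fixed = trans (sym (end-∷ʳ f w S x b l)) (end-fixed (w ∷ʳ x) (S ∷ʳ b) len-∷ʳ le′)
    below : f ≤ s₁
    below = subst (f ≤_) (trans (end-∷ʳ s₁ w S x b l) (cong (next x b) s₀-fixed)) (end-mono (w ∷ʳ x) (S ∷ʳ b) z≤n)
    above : s₁ ≤ f
    above = subst (s₁ ≤_) f-fixed (next-mono x b
      (subst (s₀ ≤_) (cong (λ z → end z w S) f-fixed) (end-mono (x ∷ w) (b ∷ S) (z≤n {f₀}))))

module C₁ = SingleClass (ind 1)
module C₂ = SingleClass (ind 2)

total : State → ℕ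
total (q , r) = q + r

arrivals-C₁ : ∀ w → C₁.arrivals w ≡ cntLe 1 w
arrivals-C₁ []      = refl
arrivals-C₁ (x ∷ w) = cong (ind 1 x +_) (arrivals-C₁ w)

arrivals-C₂ : ∀ w → C₂.arrivals w ≡ cntLe 2 w
arrivals-C₂ []      = refl
arrivals-C₂ (x ∷ w) = cong (ind 2 x +_) (arrivals-C₂ w)

step-C₁ : ∀ x b s → proj₁ (proj₂ (step (kind x) b s)) ≡ C₁.next x b (proj₁ s)
step-C₁ 0 true  s = refl
step-C₁ 0 false s = refl
step-C₁ 1 true  s = refl
step-C₁ 1 false s = refl
step-C₁ 2 true  (zero , r)  = refl
step-C₁ 2 true  (suc q , r) = refl
step-C₁ 2 false s = refl
step-C₁ (suc (suc (suc x))) true  (zero , zero)  = refl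
step-C₁ (suc (suc (suc x))) true  (zero , suc r) = refl
step-C₁ (suc (suc (suc x))) true  (suc q , r)    = refl
step-C₁ (suc (suc (suc x))) false s = refl

step-C₂ : ∀ x b s → total (proj₂ (step (kind x) b s)) ≡ C₂.next x b (total s)
step-C₂ 0 true  s = refl
step-C₂ 0 false s = refl
step-C₂ 1 true  s = refl
step-C₂ 1 false s = refl
step-C₂ 2 true  (zero , r)  = refl
step-C₂ 2 true  (suc q , r) = ℕₚ.+-suc q r
step-C₂ 2 false (q , r)     = ℕₚ.+-suc q r
step-C₂ (suc (suc (suc x))) true  (zero , zero)  = refl
step-C₂ (suc (suc (suc x))) true  (zero , suc r) = refl
step-C₂ (suc (suc (suc x))) true  (suc q , r)    = refl
step-C₂ (suc (suc (suc x))) false s = refl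

final-C₁ : ∀ s w S → proj₁ (final s w S) ≡ C₁.end (proj₁ s) w S
final-C₁ s []      S       = refl
final-C₁ s (x ∷ w) []      = refl
final-C₁ s (x ∷ w) (b ∷ S) = trans (final-C₁ _ w S) (cong (λ q → C₁.end q w S) (step-C₁ x b s))

final-C₂ : ∀ s w S → total (final s w S) ≡ C₂.end (total s) w S
final-C₂ s []      S       = refl
final-C₂ s (x ∷ w) []      = refl
final-C₂ s (x ∷ w) (b ∷ S) = trans (final-C₂ _ w S) (cong (λ q → C₂.end q w S) (step-C₂ x b s))

-- Class 2 alone is not an autonomous queue, since class 1 has priority over it. Class 1 and the
-- total are autonomous, so states are compared through these two numbers.
state-≡ : ∀ s s′ → proj₁ s ≡ proj₁ s′ → total s ≡ total s′ → s ≡ s′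
state-≡ (q , r) (.q , r′) refl e = cong (q ,_) (ℕₚ.+-cancelˡ-≡ q r r′ e)

ind-1≤2 : ∀ x → ind 1 x ≤ ind 2 x
ind-1≤2 0 = s≤s z≤n
ind-1≤2 1 = s≤s z≤n
ind-1≤2 (suc (suc x)) = z≤n

cntLe-1≤2 : ∀ w → cntLe 1 w ≤ cntLe 2 w
cntLe-1≤2 []      = z≤n
cntLe-1≤2 (x ∷ w) = ℕₚ.+-mono-≤ (ind-1≤2 x) (cntLe-1≤2 w)

cntLe-++ : ∀ t u v → cntLe t (u ++ v) ≡ cntLe t u + cntLe t v
cntLe-++ t []      v = refl
cntLe-++ t (x ∷ u) v = trans (cong (ind t x +_) (cntLe-++ t u v)) (sym (ℕₚ.+-assoc (ind t x) _ _))

cntLe-rotL : ∀ t w → cntLe t (rotL w) ≡ cntLe t w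
cntLe-rotL t []      = refl
cntLe-rotL t (x ∷ w) = trans (cntLe-++ t w (x ∷ [])) (trans (ℕₚ.+-comm (cntLe t w) _) (cong (_+ cntLe t w) (ℕₚ.+-identityʳ (ind t x))))

cntLe-rot : ∀ t k w → cntLe t (rot k w) ≡ cntLe t w
cntLe-rot t zero    w = refl
cntLe-rot t (suc k) w = trans (cntLe-rot t k (rotL w)) (cntLe-rotL t w)

cntTrue-++ : ∀ S S′ → cntTrue (S ++ S′) ≡ cntTrue S + cntTrue S′
cntTrue-++ []          S′ = refl
cntTrue-++ (true ∷ S)  S′ = cong suc (cntTrue-++ S S′)
cntTrue-++ (false ∷ S) S′ = cntTrue-++ S S′

cntTrue-rotL : ∀ S → cntTrue (rotL S) ≡ cntTrue S
cntTrue-rotL []          = refl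
cntTrue-rotL (true ∷ S)  = trans (cntTrue-++ S (true ∷ [])) (ℕₚ.+-comm (cntTrue S) 1)
cntTrue-rotL (false ∷ S) = trans (cntTrue-++ S (false ∷ [])) (ℕₚ.+-identityʳ (cntTrue S))

record Stable (w : List ℕ) (S : List Bool) : Set where
  constructor stable
  field
    lengths : length w ≡ length S
    load    : cntLe 2 w ≤ cntTrue S

Stable-rotL : ∀ {w S} → Stable w S → Stable (rotL w) (rotL S)
Stable-rotL {w} {S} (stable l le) = stable
  (trans (length-rotL w) (trans l (sym (length-rotL S))))
  (subst (_≤ cntTrue (rotL S)) (sym (cntLe-rotL 2 w)) (subst (cntLe 2 w ≤_) (sym (cntTrue-rotL S)) le))

load₁ : ∀ {w S} → Stable w S → C₁.arrivals w ≤ cntTrue S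
load₁ {w} {S} st = subst (_≤ cntTrue S) (sym (arrivals-C₁ w)) (ℕₚ.≤-trans (cntLe-1≤2 w) (Stable.load st))

load₂ : ∀ {w S} → Stable w S → C₂.arrivals w ≤ cntTrue S
load₂ {w} {S} st = subst (_≤ cntTrue S) (sym (arrivals-C₂ w)) (Stable.load st)

final-fixed : ∀ w S → Stable w S → final (final empty w S) w S ≡ final empty w S
final-fixed w S st = state-≡ _ _
  (trans (final-C₁ (final empty w S) w S) (trans (cong (λ q → C₁.end q w S) (final-C₁ empty w S))
    (trans (C₁.end-fixed w S (Stable.lengths st) (load₁ st)) (sym (final-C₁ empty w S)))))
  (trans (final-C₂ (final empty w S) w S) (trans (cong (λ q → C₂.end q w S) (final-C₂ empty w S))
    (trans (C₂.end-fixed w S (Stable.lengths st) (load₂ st)) (sym (final-C₂ empty w S)))))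

final-rotL : ∀ x w b S → Stable (x ∷ w) (b ∷ S) →
             final empty (w ∷ʳ x) (S ∷ʳ b) ≡ proj₂ (step (kind x) b (final empty (x ∷ w) (b ∷ S)))
final-rotL x w b S st = state-≡ _ _
  (trans (final-C₁ empty (w ∷ʳ x) (S ∷ʳ b)) (trans (C₁.end-rotL x w b S l (load₁ st) (load₁ st′))
    (trans (cong (C₁.next x b) (sym (final-C₁ empty (x ∷ w) (b ∷ S)))) (sym (step-C₁ x b _)))))
  (trans (final-C₂ empty (w ∷ʳ x) (S ∷ʳ b)) (trans (C₂.end-rotL x w b S l (load₂ st) (load₂ st′))
    (trans (cong (C₂.next x b) (sym (final-C₂ empty (x ∷ w) (b ∷ S)))) (sym (step-C₂ x b _)))))
  where
  l = ℕₚ.suc-injective (Stable.lengths st)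
  st′ = Stable-rotL {x ∷ w} {b ∷ S} st

departures-∷ʳ : ∀ s w S x b → length w ≡ length S →
                departures s (w ∷ʳ x) (S ∷ʳ b) ≡ departures s w S ∷ʳ proj₁ (step (kind x) b (final s w S))
departures-∷ʳ s []      []      x b _ = refl
departures-∷ʳ s (y ∷ w) (c ∷ S) x b l = cong (_ ∷_) (departures-∷ʳ _ w S x b (ℕₚ.suc-injective l))

queue-rotL : ∀ w S → Stable w S → queue (rotL w) (rotL S) ≡ rotL (queue w S)
queue-rotL []      []      st = refl
queue-rotL (x ∷ w) (b ∷ S) st = begin
  departures (final empty (w ∷ʳ x) (S ∷ʳ b)) (w ∷ʳ x) (S ∷ʳ b)
    ≡⟨ cong (λ s → departures s (w ∷ʳ x) (S ∷ʳ b)) (final-rotL x w b S st) ⟩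
  departures s₁ (w ∷ʳ x) (S ∷ʳ b)
    ≡⟨ departures-∷ʳ s₁ w S x b (ℕₚ.suc-injective (Stable.lengths st)) ⟩
  departures s₁ w S ∷ʳ proj₁ (step (kind x) b (final s₁ w S))
    ≡⟨ cong (λ s → departures s₁ w S ∷ʳ proj₁ (step (kind x) b s)) (final-fixed (x ∷ w) (b ∷ S) st) ⟩
  departures s₁ w S ∷ʳ proj₁ (step (kind x) b (final empty (x ∷ w) (b ∷ S))) ∎
  where
  open ≡-Reasoning
  s₁ = proj₂ (step (kind x) b (final empty (x ∷ w) (b ∷ S)))

queue-rot : ∀ k w S → Stable w S → queue (rot k w) (rot k S) ≡ rot k (queue w S)
queue-rot zero    w S st = refl
queue-rot (suc k) w S st = trans (queue-rot k (rotL w) (rotL S) (Stable-rotL st)) (cong (rot k) (queue-rotL w S st))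

length-departures : ∀ s w S → length w ≡ length S → length (departures s w S) ≡ length w
length-departures s []      S       l = refl
length-departures s (x ∷ w) (b ∷ S) l = cong suc (length-departures _ w S (ℕₚ.suc-injective l))

step-conserves₁ : ∀ x b s → ind 1 (proj₁ (step (kind x) b s)) + proj₁ (proj₂ (step (kind x) b s)) ≡ ind 1 x + proj₁ s
step-conserves₁ 0 true  s = refl
step-conserves₁ 0 false s = refl
step-conserves₁ 1 true  s = refl
step-conserves₁ 1 false s = refl
step-conserves₁ 2 true  (zero , r)  = refl
step-conserves₁ 2 true  (suc q , r) = refl
step-conserves₁ 2 false s = refl
step-conserves₁ (suc (suc (suc x))) true  (zero , zero)  = refl
step-conserves₁ (suc (suc (suc x))) true  (zero , suc r) = refl
step-conserves₁ (suc (suc (suc x))) true  (suc q , r)    = refl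
step-conserves₁ (suc (suc (suc x))) false s = refl

step-conserves₂ : ∀ x b s → ind 2 (proj₁ (step (kind x) b s)) + total (proj₂ (step (kind x) b s)) ≡ ind 2 x + total s
step-conserves₂ 0 true  s = refl
step-conserves₂ 0 false s = refl
step-conserves₂ 1 true  s = refl
step-conserves₂ 1 false s = refl
step-conserves₂ 2 true  (zero , r)  = refl
step-conserves₂ 2 true  (suc q , r) = cong suc (ℕₚ.+-suc q r)
step-conserves₂ 2 false (q , r)     = ℕₚ.+-suc q r
step-conserves₂ (suc (suc (suc x))) true  (zero , zero)  = refl
step-conserves₂ (suc (suc (suc x))) true  (zero , suc r) = refl
step-conserves₂ (suc (suc (suc x))) true  (suc q , r)    = refl
step-conserves₂ (suc (suc (suc x))) false s = refl

conserve : ∀ {i j k l m n p : ℕ} → i + j ≡ k + l → m + n ≡ j + p → i + m + n ≡ l + (k + p)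
conserve {i} {j} {k} {l} {m} {n} {p} e e′ = begin
  i + m + n    ≡⟨ ℕₚ.+-assoc i m n ⟩
  i + (m + n)  ≡⟨ cong (_+_ i) e′ ⟩
  i + (j + p)  ≡⟨ sym (ℕₚ.+-assoc i j p) ⟩
  i + j + p    ≡⟨ cong (_+ p) e ⟩
  k + l + p    ≡⟨ lem k l p ⟩
  l + (k + p)  ∎
  where
  open ≡-Reasoning
  lem : ∀ k l p → k + l + p ≡ l + (k + p)
  lem = ℕ-Ring.solve-∀

departures-conserve₁ : ∀ s w S → length w ≡ length S →
  cntLe 1 (departures s w S) + proj₁ (final s w S) ≡ proj₁ s + cntLe 1 w
departures-conserve₁ s []      []      l = sym (ℕₚ.+-identityʳ _)
departures-conserve₁ s (x ∷ w) (b ∷ S) l =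
  conserve {i = ind 1 (proj₁ (step (kind x) b s))} {k = ind 1 x} {l = proj₁ s} (step-conserves₁ x b s) (departures-conserve₁ _ w S (ℕₚ.suc-injective l))

departures-conserve₂ : ∀ s w S → length w ≡ length S →
  cntLe 2 (departures s w S) + total (final s w S) ≡ total s + cntLe 2 w
departures-conserve₂ s []      []      l = sym (ℕₚ.+-identityʳ _)
departures-conserve₂ s (x ∷ w) (b ∷ S) l =
  conserve {i = ind 2 (proj₁ (step (kind x) b s))} {k = ind 2 x} {l = total s} (step-conserves₂ x b s) (departures-conserve₂ _ w S (ℕₚ.suc-injective l))

serve-≤3 : ∀ s → ind 3 (proj₁ (serve s)) ≡ 1
serve-≤3 (suc q , r)    = refl
serve-≤3 (zero , suc r) = refl
serve-≤3 (zero , zero)  = refl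

cntLe-3-departures : ∀ s w S → length w ≡ length S → cntLe 3 (departures s w S) ≡ cntTrue S
cntLe-3-departures s []      []          l = refl
cntLe-3-departures s (x ∷ w) (true ∷ S)  l = cong₂ _+_ (serve-≤3 (arrive (kind x) s)) (cntLe-3-departures _ w S (ℕₚ.suc-injective l))
cntLe-3-departures s (x ∷ w) (false ∷ S) l = cntLe-3-departures _ w S (ℕₚ.suc-injective l)

-- Over a full turn the queue returns to its starting state, so the conservation of customers has no
-- boundary term.
cntLe-1-queue : ∀ w S → Stable w S → cntLe 1 (queue w S) ≡ cntLe 1 w
cntLe-1-queue w S st = ℕₚ.+-cancelˡ-≡ (proj₁ s₀) _ _ (trans (ℕₚ.+-comm (proj₁ s₀) _)
  (trans (cong (λ s → cntLe 1 (queue w S) + proj₁ s) (sym (final-fixed w S st))) (departures-conserve₁ s₀ w S (Stable.lengths st))))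
  where s₀ = final empty w S

cntLe-2-queue : ∀ w S → Stable w S → cntLe 2 (queue w S) ≡ cntLe 2 w
cntLe-2-queue w S st = ℕₚ.+-cancelˡ-≡ (total s₀) _ _ (trans (ℕₚ.+-comm (total s₀) _)
  (trans (cong (λ s → cntLe 2 (queue w S) + total s) (sym (final-fixed w S st))) (departures-conserve₂ s₀ w S (Stable.lengths st))))
  where s₀ = final empty w S

-- The queue intertwines the generators

allBits : ℕ → List (List Bool)
allBits zero    = [] ∷ []
allBits (suc L) = map (false ∷_) (allBits L) ++ map (true ∷_) (allBits L)

∑-allBits-suc : ∀ L (f : List Bool → ℚ) →
  ∑ (allBits (suc L)) f ≡ ∑ (allBits L) (λ S → f (false ∷ S)) +ℚ ∑ (allBits L) (λ S → f (true ∷ S))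
∑-allBits-suc L f = trans (∑-++ (map (false ∷_) (allBits L)) (map (true ∷_) (allBits L)) f)
  (cong₂ _+ℚ_ (∑-map (false ∷_) (allBits L) f) (∑-map (true ∷_) (allBits L) f))

-- Splitting off the last bit gives the same two halves as splitting off the first bit does after
-- `rotL`; this is the rotation invariance of uniform services.
∑-allBits-∷ʳ : ∀ L (f : List Bool → ℚ) →
  ∑ (allBits (suc L)) f ≡ ∑ (allBits L) (λ S → f (S ∷ʳ false)) +ℚ ∑ (allBits L) (λ S → f (S ∷ʳ true))
∑-allBits-∷ʳ zero    f = ∑-allBits-suc 0 f
∑-allBits-∷ʳ (suc L) f = begin
  ∑ (allBits (2 + L)) f
    ≡⟨ ∑-allBits-suc (suc L) f ⟩
  ∑ (allBits (suc L)) (λ S → f (false ∷ S)) +ℚ ∑ (allBits (suc L)) (λ S → f (true ∷ S))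
    ≡⟨ cong₂ _+ℚ_ (∑-allBits-∷ʳ L (λ S → f (false ∷ S))) (∑-allBits-∷ʳ L (λ S → f (true ∷ S))) ⟩
  (A false false +ℚ A false true) +ℚ (A true false +ℚ A true true)
    ≡⟨ +ℚ-interchange (A false false) (A false true) (A true false) (A true true) ⟩
  (A false false +ℚ A true false) +ℚ (A false true +ℚ A true true)
    ≡⟨ sym (cong₂ _+ℚ_ (∑-allBits-suc L (λ S → f (S ∷ʳ false))) (∑-allBits-suc L (λ S → f (S ∷ʳ true)))) ⟩
  ∑ (allBits (suc L)) (λ S → f (S ∷ʳ false)) +ℚ ∑ (allBits (suc L)) (λ S → f (S ∷ʳ true)) ∎
  where
  open ≡-Reasoning
  A : Bool → Bool → ℚ
  A b c = ∑ (allBits L) (λ S → f (b ∷ (S ∷ʳ c)))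

∑-allBits-rotL : ∀ L (f : List Bool → ℚ) → ∑ (allBits L) (λ S → f (rotL S)) ≡ ∑ (allBits L) f
∑-allBits-rotL zero    f = refl
∑-allBits-rotL (suc L) f = trans (∑-allBits-suc L (λ S → f (rotL S))) (sym (∑-allBits-∷ʳ L f))

bits : ℕ → ℕ → List (List Bool)
bits L m = filterᵇ (λ S → cntTrue S ≡ᵇ m) (allBits L)

allBits-∈ : ∀ L {S} → S ∈ allBits L → length S ≡ L
allBits-∈ zero    (here refl) = refl
allBits-∈ (suc L) S∈ with ∈ₚ.∈-++⁻ (map (false ∷_) (allBits L)) S∈
... | inj₁ p with ∈ₚ.∈-map⁻ (false ∷_) p
...   | S′ , S′∈ , refl = cong suc (allBits-∈ L S′∈)
allBits-∈ (suc L) S∈ | inj₂ p with ∈ₚ.∈-map⁻ (true ∷_) p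
...   | S′ , S′∈ , refl = cong suc (allBits-∈ L S′∈)

bits-∈ : ∀ L m {S} → S ∈ bits L m → length S ≡ L × cntTrue S ≡ m
bits-∈ L m {S} S∈ with ∈ₚ.∈-filter⁻ (λ S → T? (cntTrue S ≡ᵇ m)) {xs = allBits L} S∈
... | S∈′ , t = allBits-∈ L S∈′ , ℕₚ.≡ᵇ⇒≡ (cntTrue S) m t

∑-bits-rotL : ∀ L m (f : List Bool → ℚ) → ∑ (bits L m) (λ S → f (rotL S)) ≡ ∑ (bits L m) f
∑-bits-rotL L m f = begin
  ∑ (bits L m) (λ S → f (rotL S))
    ≡⟨ ∑-filter (λ S → cntTrue S ≡ᵇ m) (allBits L) (λ S → f (rotL S)) ⟩
  ∑ (allBits L) (λ S → if cntTrue S ≡ᵇ m then f (rotL S) else 0ℚ)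
    ≡⟨ ∑-cong (allBits L) (λ S → cong (λ c → if c ≡ᵇ m then f (rotL S) else 0ℚ) (sym (cntTrue-rotL S))) ⟩
  ∑ (allBits L) (λ S → if cntTrue (rotL S) ≡ᵇ m then f (rotL S) else 0ℚ)
    ≡⟨ ∑-allBits-rotL L (λ S → if cntTrue S ≡ᵇ m then f S else 0ℚ) ⟩
  ∑ (allBits L) (λ S → if cntTrue S ≡ᵇ m then f S else 0ℚ)
    ≡⟨ sym (∑-filter (λ S → cntTrue S ≡ᵇ m) (allBits L) f) ⟩
  ∑ (bits L m) f ∎
  where open ≡-Reasoning

∑-bits-rot : ∀ L m k (f : List Bool → ℚ) → ∑ (bits L m) (λ S → f (rot k S)) ≡ ∑ (bits L m) f
∑-bits-rot L m zero    f = refl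
∑-bits-rot L m (suc k) f = trans (∑-bits-rotL L m (λ S → f (rot k S))) (∑-bits-rot L m k f)

-- The queue at one bond

sort₂ : List ℕ → List ℕ
sort₂ (x ∷ y ∷ w) = (x ⊓ y) ∷ (x ⊔ y) ∷ w
sort₂ w           = w

-- A jump leaves its bond sorted, and a bond without a jump is sorted already. This removes the
-- comparison of labels from the generator.
D₀-sort₂ : ∀ (g : List ℕ → ℚ) w → D₀ g w ≡ g (sort₂ w) -ℚ g w
D₀-sort₂ g []          = sym (ℚₚ.+-inverseʳ (g []))
D₀-sort₂ g (x ∷ [])    = sym (ℚₚ.+-inverseʳ (g (x ∷ [])))
D₀-sort₂ g (x ∷ y ∷ w) with y <? x
... | yes y<x rewrite <ᵇ-true y<x | ℕₚ.m≥n⇒m⊓n≡n (ℕₚ.<⇒≤ y<x) | ℕₚ.m≥n⇒m⊔n≡m (ℕₚ.<⇒≤ y<x) = refl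
... | no y≮x rewrite <ᵇ-false (ℕₚ.≮⇒≥ y≮x) | ℕₚ.m≤n⇒m⊓n≡m (ℕₚ.≮⇒≥ y≮x) | ℕₚ.m≤n⇒m⊔n≡n (ℕₚ.≮⇒≥ y≮x) =
  sym (ℚₚ.+-inverseʳ (g (x ∷ y ∷ w)))

cntLe-sort₂ : ∀ t w → cntLe t (sort₂ w) ≡ cntLe t w
cntLe-sort₂ t []          = refl
cntLe-sort₂ t (x ∷ [])    = refl
cntLe-sort₂ t (x ∷ y ∷ w) with ℕₚ.≤-total x y
... | inj₁ x≤y rewrite ℕₚ.m≤n⇒m⊓n≡m x≤y | ℕₚ.m≤n⇒m⊔n≡n x≤y = refl
... | inj₂ y≤x rewrite ℕₚ.m≥n⇒m⊓n≡n y≤x | ℕₚ.m≥n⇒m⊔n≡m y≤x = lem (ind t y) (ind t x) (cntLe t w)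
  where
  lem : ∀ i j k → i + (j + k) ≡ j + (i + k)
  lem = ℕ-Ring.solve-∀

length-sort₂ : ∀ w → length (sort₂ w) ≡ length w
length-sort₂ []          = refl
length-sort₂ (x ∷ [])    = refl
length-sort₂ (x ∷ y ∷ w) = refl

steps₂ : Kind → Kind → Bool → Bool → State → ℕ × ℕ × State
steps₂ k k′ b b′ s = proj₁ (step k b s) , step k′ b′ (proj₂ (step k b s))

sortOut : ℕ × ℕ × State → ℕ × ℕ × State
sortOut (o , o′ , s) = o ⊓ o′ , o ⊔ o′ , s

data _≼_ : Kind → Kind → Set where
  first≼  : ∀ {k} → first ≼ k
  second≼ : second ≼ second
  second≼none : second ≼ none
  none≼   : none ≼ none

kind-mono : ∀ {x y} → x ≤ y → kind x ≼ kind y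
kind-mono {0} _ = first≼
kind-mono {1} _ = first≼
kind-mono {2} {2} _ = second≼
kind-mono {2} {suc (suc (suc y))} _ = second≼none
kind-mono {2} {1} (s≤s ())
kind-mono {suc (suc (suc x))} {suc (suc (suc y))} _ = none≼
kind-mono {suc (suc (suc x))} {2} (s≤s (s≤s ()))
kind-mono {suc (suc (suc x))} {1} (s≤s ())

arrive-comm : ∀ k k′ s → arrive k (arrive k′ s) ≡ arrive k′ (arrive k s)
arrive-comm first  first  s = refl
arrive-comm first  second s = refl
arrive-comm first  none   s = refl
arrive-comm second first  s = refl
arrive-comm second second s = refl
arrive-comm second none   s = refl
arrive-comm none   first  s = refl
arrive-comm none   second s = refl
arrive-comm none   none   s = refl

steps₂-comm : ∀ k k′ b s → steps₂ k k′ false b s ≡ steps₂ k′ k false b s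
steps₂-comm k k′ true  s = cong (λ t → 4 , serve t) (arrive-comm k′ k s)
steps₂-comm k k′ false s = cong (λ t → 4 , 4 , t) (arrive-comm k′ k s)

-- If the better customer arrives first, the first service goes to someone at least as good, and the
-- later arrival overtakes nobody, so the departures come out sorted. In the reverse order the same
-- departures occur and the same customers remain, but possibly in the wrong order.
steps₂-serve-both : ∀ {k k′} → k ≼ k′ → ∀ s →
  steps₂ k k′ true true s ≡ sortOut (steps₂ k k′ true true s) ×
  steps₂ k k′ true true s ≡ sortOut (steps₂ k′ k true true s)
steps₂-serve-both (first≼ {first})  s                          = refl , refl
steps₂-serve-both (first≼ {second}) (zero , r)                 = refl , refl
steps₂-serve-both (first≼ {second}) (suc q , r)                = refl , refl
steps₂-serve-both (first≼ {none})   (zero , zero)              = refl , refl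
steps₂-serve-both (first≼ {none})   (zero , suc r)             = refl , refl
steps₂-serve-both (first≼ {none})   (suc q , r)                = refl , refl
steps₂-serve-both second≼           (zero , r)                 = refl , refl
steps₂-serve-both second≼           (suc zero , r)             = refl , refl
steps₂-serve-both second≼           (suc (suc q) , r)          = refl , refl
steps₂-serve-both second≼none       (zero , zero)              = refl , refl
steps₂-serve-both second≼none       (zero , suc r)             = refl , refl
steps₂-serve-both second≼none       (suc zero , r)             = refl , refl
steps₂-serve-both second≼none       (suc (suc q) , r)          = refl , refl
steps₂-serve-both none≼             (zero , zero)              = refl , refl
steps₂-serve-both none≼             (zero , suc zero)          = refl , refl
steps₂-serve-both none≼             (zero , suc (suc r))       = refl , refl
steps₂-serve-both none≼             (suc zero , zero)          = refl , refl
steps₂-serve-both none≼             (suc zero , suc r)         = refl , refl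
steps₂-serve-both none≼             (suc (suc q) , r)          = refl , refl

-- A service at the second site also sees the later arrival. That arrival is no better than the
-- earlier one, so the same class is served as by a service at the first site.
steps₂-serve-one : ∀ {k k′} → k ≼ k′ → ∀ s → steps₂ k k′ true false s ≡ sortOut (steps₂ k k′ false true s)
steps₂-serve-one (first≼ {first})  s              = refl
steps₂-serve-one (first≼ {second}) s              = refl
steps₂-serve-one (first≼ {none})   s              = refl
steps₂-serve-one second≼           (zero , r)     = refl
steps₂-serve-one second≼           (suc q , r)    = refl
steps₂-serve-one second≼none       (zero , r)     = refl
steps₂-serve-one second≼none       (suc q , r)    = refl
steps₂-serve-one none≼             (zero , zero)  = refl
steps₂-serve-one none≼             (zero , suc r) = refl
steps₂-serve-one none≼             (suc q , r)    = refl

serve-≤4 : ∀ s → proj₁ (serve s) ≤ 4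
serve-≤4 (suc q , r)    = s≤s z≤n
serve-≤4 (zero , suc r) = s≤s (s≤s z≤n)
serve-≤4 (zero , zero)  = s≤s (s≤s (s≤s z≤n))

-- The queue with its transition over the front two sites as a parameter. The transition enters
-- twice, in the turn that finds the starting state and in the departures; an identity between
-- transitions that holds in all states therefore lifts to whole departure words.
queue₂ : (State → ℕ × ℕ × State) → List ℕ → List Bool → List ℕ
queue₂ t w S = out (t (final (proj₂ (proj₂ (t empty))) w S))
  where
  out : ℕ × ℕ × State → List ℕ
  out (o , o′ , s) = o ∷ o′ ∷ departures s w S

queue₂-cong : ∀ {t t′} → (∀ s → t s ≡ t′ s) → ∀ w S → queue₂ t w S ≡ queue₂ t′ w S
queue₂-cong {t} {t′} e w S rewrite e empty | e (final (proj₂ (proj₂ (t′ empty))) w S) = refl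

queue-sort₂-false : ∀ x y w b S → queue (sort₂ (x ∷ y ∷ w)) (false ∷ b ∷ S) ≡ queue (x ∷ y ∷ w) (false ∷ b ∷ S)
queue-sort₂-false x y w b S with ℕₚ.≤-total x y
... | inj₁ x≤y rewrite ℕₚ.m≤n⇒m⊓n≡m x≤y | ℕₚ.m≤n⇒m⊔n≡n x≤y = refl
... | inj₂ y≤x rewrite ℕₚ.m≥n⇒m⊓n≡n y≤x | ℕₚ.m≥n⇒m⊔n≡m y≤x =
  queue₂-cong (steps₂-comm (kind y) (kind x) b) w S

queue-sort₂-both : ∀ x y w S → queue (sort₂ (x ∷ y ∷ w)) (true ∷ true ∷ S) ≡ sort₂ (queue (x ∷ y ∷ w) (true ∷ true ∷ S))
queue-sort₂-both x y w S with ℕₚ.≤-total x y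
... | inj₁ x≤y rewrite ℕₚ.m≤n⇒m⊓n≡m x≤y | ℕₚ.m≤n⇒m⊔n≡n x≤y =
  queue₂-cong {t′ = λ s → sortOut (steps₂ (kind x) (kind y) true true s)} (λ s → proj₁ (steps₂-serve-both (kind-mono x≤y) s)) w S
... | inj₂ y≤x rewrite ℕₚ.m≥n⇒m⊓n≡n y≤x | ℕₚ.m≥n⇒m⊔n≡m y≤x =
  queue₂-cong {t′ = λ s → sortOut (steps₂ (kind x) (kind y) true true s)} (λ s → proj₂ (steps₂-serve-both (kind-mono y≤x) s)) w S

queue-sort₂-one : ∀ x y w S → queue (sort₂ (x ∷ y ∷ w)) (true ∷ false ∷ S) ≡ sort₂ (queue (x ∷ y ∷ w) (false ∷ true ∷ S))
queue-sort₂-one x y w S with ℕₚ.≤-total x y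
... | inj₁ x≤y rewrite ℕₚ.m≤n⇒m⊓n≡m x≤y | ℕₚ.m≤n⇒m⊔n≡n x≤y =
  queue₂-cong {t′ = λ s → sortOut (steps₂ (kind x) (kind y) false true s)} (steps₂-serve-one (kind-mono x≤y)) w S
... | inj₂ y≤x rewrite ℕₚ.m≥n⇒m⊓n≡n y≤x | ℕₚ.m≥n⇒m⊔n≡m y≤x =
  queue₂-cong {t′ = λ s → sortOut (steps₂ (kind x) (kind y) false true s)}
    (λ s → trans (steps₂-serve-one (kind-mono y≤x) s) (cong sortOut (steps₂-comm (kind y) (kind x) true s))) w S

sort₂-≤ : ∀ {x y} w → x ≤ y → sort₂ (x ∷ y ∷ w) ≡ x ∷ y ∷ w
sort₂-≤ w x≤y = cong₂ (λ o o′ → o ∷ o′ ∷ w) (ℕₚ.m≤n⇒m⊓n≡m x≤y) (ℕₚ.m≤n⇒m⊔n≡n x≤y)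

sort₂-queue-one : ∀ x y w S → sort₂ (queue (x ∷ y ∷ w) (true ∷ false ∷ S)) ≡ queue (x ∷ y ∷ w) (true ∷ false ∷ S)
sort₂-queue-one x y w S = sort₂-≤ _ (serve-≤4 (arrive (kind x) (final empty (x ∷ y ∷ w) (true ∷ false ∷ S))))

vacant : List Bool → ℚ
vacant (false ∷ S) = 1ℚ
vacant _           = 0ℚ

Λ : ℕ → ℕ → (List ℕ → ℚ) → List ℕ → ℚ
Λ L m g w = ∑ (bits L m) (λ S → g (queue w S))

-- The services 01 and 10 at the bond cancel each other; 00 and 11 contribute nothing.
module Bond (g : List ℕ → ℚ) (x y : ℕ) (w : List ℕ) where

  A B K E : List Bool → ℚ
  A S = g (queue (sort₂ (x ∷ y ∷ w)) S)
  B S = g (queue (x ∷ y ∷ w) S)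
  K S = g (sort₂ (queue (x ∷ y ∷ w) S))
  -- The gradient of the vacancy at the front bond: +1 for services 01, -1 for 10, and 0 for 00 and
  -- 11.
  E S = (vacant S -ℚ vacant (rotL S)) *ℚ B S

  defect : List Bool → ℚ
  defect S = (A S -ℚ K S) -ℚ E S

  defect-00 : ∀ S → defect (false ∷ false ∷ S) ≡ 0ℚ
  defect-00 S rewrite queue-sort₂-false x y w false S = lem (B (false ∷ false ∷ S))
    where
    lem : ∀ b → (b -ℚ b) -ℚ (1ℚ -ℚ 1ℚ) *ℚ b ≡ 0ℚ
    lem = solve 1 (λ b → (b :- b) :- (con 1ℚ :- con 1ℚ) :* b := con 0ℚ) refl
      where open ℚ-Solver.+-*-Solver

  defect-11 : ∀ S → defect (true ∷ true ∷ S) ≡ 0ℚ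
  defect-11 S rewrite queue-sort₂-both x y w S = lem (K (true ∷ true ∷ S)) (B (true ∷ true ∷ S))
    where
    lem : ∀ c b → (c -ℚ c) -ℚ (0ℚ -ℚ 0ℚ) *ℚ b ≡ 0ℚ
    lem = solve 2 (λ c b → (c :- c) :- (con 0ℚ :- con 0ℚ) :* b := con 0ℚ) refl
      where open ℚ-Solver.+-*-Solver

  -- The two defects are -K and +K, with K taken at the services 01. At 01 the order of the two
  -- arrivals is not felt at all. At 10 sorting the arrivals produces the sorted departures of 01,
  -- while the departures of 10 are sorted already.
  defect-01+10 : ∀ S → defect (false ∷ true ∷ S) +ℚ defect (true ∷ false ∷ S) ≡ 0ℚ
  defect-01+10 S rewrite queue-sort₂-false x y w true S | queue-sort₂-one x y w S | sort₂-queue-one x y w S =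
    lem (B (false ∷ true ∷ S)) (K (false ∷ true ∷ S)) (B (true ∷ false ∷ S))
    where
    lem : ∀ b c d → ((b -ℚ c) -ℚ (1ℚ -ℚ 0ℚ) *ℚ b) +ℚ ((c -ℚ d) -ℚ (0ℚ -ℚ 1ℚ) *ℚ d) ≡ 0ℚ
    lem = solve 3 (λ b c d → ((b :- c) :- (con 1ℚ :- con 0ℚ) :* b) :+ ((c :- d) :- (con 0ℚ :- con 1ℚ) :* d) := con 0ℚ) refl
      where open ℚ-Solver.+-*-Solver

  ∑-defect : ∀ l m → ∑ (bits (2 + l) m) defect ≡ 0ℚ
  ∑-defect l m = begin
    ∑ (bits (2 + l) m) defect
      ≡⟨ ∑-filter (λ S → cntTrue S ≡ᵇ m) (allBits (2 + l)) defect ⟩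
    ∑ (allBits (2 + l)) F
      ≡⟨ trans (∑-allBits-suc (suc l) F) (cong₂ _+ℚ_ (∑-allBits-suc l (λ S → F (false ∷ S))) (∑-allBits-suc l (λ S → F (true ∷ S)))) ⟩
    (G false false +ℚ G false true) +ℚ (G true false +ℚ G true true)
      ≡⟨ cong₂ (λ p q → (p +ℚ G false true) +ℚ (G true false +ℚ q))
           (∑-zero (allBits l) (λ S _ → if-0 (cntTrue S ≡ᵇ m) (defect-00 S)))
           (∑-zero (allBits l) (λ S _ → if-0 (2 + cntTrue S ≡ᵇ m) (defect-11 S))) ⟩
    (0ℚ +ℚ G false true) +ℚ (G true false +ℚ 0ℚ)
      ≡⟨ cong₂ _+ℚ_ (ℚₚ.+-identityˡ (G false true)) (ℚₚ.+-identityʳ (G true false)) ⟩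
    G false true +ℚ G true false
      ≡⟨ sym (∑-+ (allBits l) (λ S → F (false ∷ true ∷ S)) (λ S → F (true ∷ false ∷ S))) ⟩
    ∑ (allBits l) (λ S → F (false ∷ true ∷ S) +ℚ F (true ∷ false ∷ S))
      ≡⟨ ∑-zero (allBits l) (λ S _ → if-+ (1 + cntTrue S ≡ᵇ m) (defect-01+10 S)) ⟩
    0ℚ ∎
    where
    open ≡-Reasoning
    F : List Bool → ℚ
    F S = if cntTrue S ≡ᵇ m then defect S else 0ℚ
    G : Bool → Bool → ℚ
    G b c = ∑ (allBits l) (λ S → F (b ∷ c ∷ S))
    if-0 : ∀ b {p} → p ≡ 0ℚ → (if b then p else 0ℚ) ≡ 0ℚ
    if-0 true  e = e
    if-0 false e = refl
    if-+ : ∀ b {p q} → p +ℚ q ≡ 0ℚ → (if b then p else 0ℚ) +ℚ (if b then q else 0ℚ) ≡ 0ℚ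
    if-+ true  e = e
    if-+ false e = refl

∑-telescope : ∀ n (h : ℕ → ℚ) → ∑ (upTo n) (λ r → h r -ℚ h (suc r)) ≡ h 0 -ℚ h n
∑-telescope zero    h = sym (ℚₚ.+-inverseʳ (h 0))
∑-telescope (suc n) h = trans (∑-upTo-suc n (λ r → h r -ℚ h (suc r)))
  (trans (cong ((h 0 -ℚ h 1) +ℚ_) (∑-telescope n (λ r → h (suc r)))) (lem (h 0) (h 1) (h (suc n))))
  where
  lem : ∀ a b c → (a -ℚ b) +ℚ (b -ℚ c) ≡ a -ℚ c
  lem = solve 3 (λ a b c → (a :- b) :+ (b :- c) := a :- c) refl
    where open ℚ-Solver.+-*-Solver

rotL-rot : {A : Set} (k : ℕ) (w : List A) → rotL (rot k w) ≡ rot (suc k) w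
rotL-rot k w = trans (sym (rot-+ k 1 w)) (cong (λ j → rot j w) (ℕₚ.+-comm k 1))

rot-∸ : {A : Set} (r : ℕ) (w : List A) → r ≤ length w → rot (length w ∸ r) (rot r w) ≡ w
rot-∸ r w le = trans (sym (rot-+ r (length w ∸ r) w)) (trans (cong (λ j → rot j w) (ℕₚ.m+[n∸m]≡n le)) (rot-length w))

-- Rotating arrivals and services together rotates the departures, and rotating the services alone
-- only permutes the summands.
Λ-rot : ∀ L m (g : List ℕ → ℚ) k w → length w ≡ L → cntLe 2 w ≤ m → Λ L m g (rot k w) ≡ Λ L m (λ v → g (rot k v)) w
Λ-rot L m g k w l le = trans (sym (∑-bits-rot L m k (λ S → g (queue (rot k w) S))))
  (∑-cong-∈ (bits L m) λ S S∈ → cong g (queue-rot k w S (stable (trans l (sym (proj₁ (bits-∈ L m S∈))))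
    (subst (cntLe 2 w ≤_) (sym (proj₂ (bits-∈ L m S∈))) le))))

module Intertwining (l m : ℕ) (g : List ℕ → ℚ) (w : List ℕ) (len : length w ≡ 2 + l) (load : cntLe 2 w ≤ m) where

  L : ℕ
  L = 2 + l

  g′ : ℕ → List ℕ → ℚ
  g′ r v = g (rot (L ∸ r) v)

  Δ : ℕ → ℚ
  Δ r = ∑ (bits L m) (λ S → (vacant (rot r S) -ℚ vacant (rot (suc r) S)) *ℚ g (queue w S))

  bits-stable : ∀ {S} → S ∈ bits L m → Stable w S
  bits-stable S∈ = stable (trans len (sym (proj₁ (bits-∈ L m S∈)))) (subst (cntLe 2 w ≤_) (sym (proj₂ (bits-∈ L m S∈))) load)

  -- Reindexing the services by `rot r` brings the correction at bond r back to the unrotated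
  -- `queue w S`. The factor `g (queue w S)` is then common to all bonds, and the gradients in `Δ`
  -- telescope.
  bond-defect : ∀ r → r ≤ L →
    ∑ (bits L m) (λ S → (g′ r (queue (sort₂ (rot r w)) S) -ℚ g′ r (sort₂ (queue (rot r w) S)))) ≡ Δ r
  bond-defect r r≤L = begin
    ∑ (bits L m) (λ S → A S -ℚ K S)
      ≡⟨ p-q≡0⇒p≡q _ _ (trans (sym (∑-- (bits L m) (λ S → A S -ℚ K S) E)) (bond (rot r w) (trans (length-rot r w) len))) ⟩
    ∑ (bits L m) E
      ≡⟨ sym (∑-bits-rot L m r E) ⟩
    ∑ (bits L m) (λ S → E (rot r S))
      ≡⟨ ∑-cong-∈ (bits L m) (λ S S∈ → cong₂ _*ℚ_
           (cong (λ S′ → vacant (rot r S) -ℚ vacant S′) (rotL-rot r S))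
           (cong g (trans (cong (rot (L ∸ r)) (queue-rot r w S (bits-stable S∈))) (unrot (queue w S)
             (trans (length-departures _ w S (Stable.lengths (bits-stable S∈))) len))))) ⟩
    Δ r ∎
    where
    open ≡-Reasoning
    A K E : List Bool → ℚ
    A S = g′ r (queue (sort₂ (rot r w)) S)
    K S = g′ r (sort₂ (queue (rot r w) S))
    E S = (vacant S -ℚ vacant (rotL S)) *ℚ g′ r (queue (rot r w) S)
    bond : ∀ v → length v ≡ L → ∑ (bits L m) (λ S → (g′ r (queue (sort₂ v) S) -ℚ g′ r (sort₂ (queue v S)))
             -ℚ (vacant S -ℚ vacant (rotL S)) *ℚ g′ r (queue v S)) ≡ 0ℚ
    bond (x ∷ y ∷ v) _ = Bond.∑-defect (g′ r) x y v l m
    unrot : ∀ v → length v ≡ L → rot (L ∸ r) (rot r v) ≡ v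
    unrot v e = trans (cong (λ k → rot (k ∸ r) (rot r v)) (sym e)) (rot-∸ r v (subst (r ≤_) (sym e) r≤L))

  term : ∀ r → r ≤ L →
    𝓛-term L (Λ L m g) w r ≡ ∑ (bits L m) (λ S → 𝓛-term L g (queue w S) r) +ℚ Δ r
  term r r≤L = begin
    D₀ (λ v → Λ L m g (rot (L ∸ r) v)) wr
      ≡⟨ D₀-sort₂ (λ v → Λ L m g (rot (L ∸ r) v)) wr ⟩
    Λ L m g (rot (L ∸ r) (sort₂ wr)) -ℚ Λ L m g (rot (L ∸ r) wr)
      ≡⟨ cong₂ _-ℚ_ (Λ-rot L m g (L ∸ r) (sort₂ wr) (trans (length-sort₂ wr) len-wr)
                       (subst (_≤ m) (sym (trans (cntLe-sort₂ 2 wr) (cntLe-rot 2 r w))) load))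
                    (Λ-rot L m g (L ∸ r) wr len-wr (subst (_≤ m) (sym (cntLe-rot 2 r w)) load)) ⟩
    ∑ (bits L m) A -ℚ ∑ (bits L m) B
      ≡⟨ lem (∑ (bits L m) A) (∑ (bits L m) B) (∑ (bits L m) K) ⟩
    (∑ (bits L m) K -ℚ ∑ (bits L m) B) +ℚ (∑ (bits L m) A -ℚ ∑ (bits L m) K)
      ≡⟨ cong₂ _+ℚ_ (sym (∑-- (bits L m) K B)) (trans (sym (∑-- (bits L m) A K)) (bond-defect r r≤L)) ⟩
    ∑ (bits L m) (λ S → K S -ℚ B S) +ℚ Δ r
      ≡⟨ cong (_+ℚ Δ r) (∑-cong (bits L m) (λ S → sym (D₀-sort₂ (g′ r) (queue wr S)))) ⟩
    ∑ (bits L m) (λ S → D₀ (g′ r) (queue wr S)) +ℚ Δ r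
      ≡⟨ cong (_+ℚ Δ r) (sym (∑-bits-rot L m r (λ S → D₀ (g′ r) (queue wr S)))) ⟩
    ∑ (bits L m) (λ S → D₀ (g′ r) (queue wr (rot r S))) +ℚ Δ r
      ≡⟨ cong (_+ℚ Δ r) (∑-cong-∈ (bits L m) (λ S S∈ → cong (D₀ (g′ r)) (queue-rot r w S (bits-stable S∈)))) ⟩
    ∑ (bits L m) (λ S → D₀ (g′ r) (rot r (queue w S))) +ℚ Δ r ∎
    where
    open ≡-Reasoning
    wr = rot r w
    len-wr : length wr ≡ L
    len-wr = trans (length-rot r w) len
    A B K : List Bool → ℚ
    A S = g′ r (queue (sort₂ wr) S)
    B S = g′ r (queue wr S)
    K S = g′ r (sort₂ (queue wr S))
    lem : ∀ a b c → a -ℚ b ≡ (c -ℚ b) +ℚ (a -ℚ c)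
    lem = solve 3 (λ a b c → a :- b := (c :- b) :+ (a :- c)) refl
      where open ℚ-Solver.+-*-Solver

  ∑-Δ : ∑ (upTo L) Δ ≡ 0ℚ
  ∑-Δ = trans (∑-swap (upTo L) (bits L m) (λ r S → δ S r *ℚ g (queue w S))) (∑-zero (bits L m) λ S S∈ → begin
    ∑ (upTo L) (λ r → δ S r *ℚ g (queue w S))
      ≡⟨ ∑-cong (upTo L) (λ r → ℚₚ.*-comm (δ S r) (g (queue w S))) ⟩
    ∑ (upTo L) (λ r → g (queue w S) *ℚ δ S r)
      ≡⟨ ∑-*ˡ (g (queue w S)) (upTo L) (δ S) ⟩
    g (queue w S) *ℚ ∑ (upTo L) (δ S)
      ≡⟨ cong (g (queue w S) *ℚ_) (trans (∑-telescope L (λ r → vacant (rot r S)))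
           (trans (cong (λ S′ → vacant S -ℚ vacant S′) (rot-full S (proj₁ (bits-∈ L m S∈)))) (ℚₚ.+-inverseʳ (vacant S)))) ⟩
    g (queue w S) *ℚ 0ℚ
      ≡⟨ ℚₚ.*-zeroʳ (g (queue w S)) ⟩
    0ℚ ∎)
    where
    open ≡-Reasoning
    δ : List Bool → ℕ → ℚ
    δ S r = vacant (rot r S) -ℚ vacant (rot (suc r) S)
    rot-full : ∀ S → length S ≡ L → rot L S ≡ S
    rot-full S e = trans (cong (λ k → rot k S) (sym e)) (rot-length S)

  intertwine : 𝓛 L (Λ L m g) w ≡ Λ L m (𝓛 L g) w
  intertwine = begin
    ∑ (upTo L) (𝓛-term L (Λ L m g) w)
      ≡⟨ ∑-cong-∈ (upTo L) (λ r r∈ → term r (ℕₚ.<⇒≤ (∈ₚ.∈-upTo⁻ r∈))) ⟩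
    ∑ (upTo L) (λ r → ∑ (bits L m) (λ S → 𝓛-term L g (queue w S) r) +ℚ Δ r)
      ≡⟨ ∑-+ (upTo L) (λ r → ∑ (bits L m) (λ S → 𝓛-term L g (queue w S) r)) Δ ⟩
    ∑ (upTo L) (λ r → ∑ (bits L m) (λ S → 𝓛-term L g (queue w S) r)) +ℚ ∑ (upTo L) Δ
      ≡⟨ cong₂ _+ℚ_ (∑-swap (upTo L) (bits L m) (λ r S → 𝓛-term L g (queue w S) r)) ∑-Δ ⟩
    Λ L m (𝓛 L g) w +ℚ 0ℚ
      ≡⟨ ℚₚ.+-identityʳ _ ⟩
    Λ L m (𝓛 L g) w ∎
    where open ≡-Reasoning

-- Multiline queues

record Content (L a b c : ℕ) (w : List ℕ) : Set where
  field
    len    : length w ≡ L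
    le₁    : cntLe 1 w ≡ a
    le₂    : cntLe 2 w ≡ b
    le₃    : cntLe 3 w ≡ c
    labels : All (Label 4) w

serve-Label : ∀ s → Label 4 (proj₁ (serve s))
serve-Label (suc q , r)    = s≤s z≤n , s≤s z≤n
serve-Label (zero , suc r) = s≤s z≤n , s≤s (s≤s z≤n)
serve-Label (zero , zero)  = s≤s z≤n , s≤s (s≤s (s≤s z≤n))

departures-labels : ∀ s w S → All (Label 4) (departures s w S)
departures-labels s []      S           = []
departures-labels s (x ∷ w) []          = []
departures-labels s (x ∷ w) (true ∷ S)  = serve-Label (arrive (kind x) s) ∷ departures-labels _ w S
departures-labels s (x ∷ w) (false ∷ S) = (s≤s z≤n , s≤s (s≤s (s≤s (s≤s z≤n)))) ∷ departures-labels _ w S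

cntLe-pred : ∀ t w → cntLe t (map pred w) ≡ cntLe (suc t) w
cntLe-pred t []          = refl
cntLe-pred t (zero ∷ w)  = cong suc (cntLe-pred t w)
cntLe-pred t (suc x ∷ w) = cong (ind t x +_) (cntLe-pred t w)

nextRow : ℕ → ℕ → List (List ℕ) → List (List ℕ)
nextRow L m ws = concatMap (λ w → map (queue (map pred w)) (bits L m)) ws

∑-nextRow : ∀ L m ws (g : List ℕ → ℚ) → ∑ (nextRow L m ws) g ≡ ∑ ws (λ w → Λ L m g (map pred w))
∑-nextRow L m ws g = trans (∑-concatMap (λ w → map (queue (map pred w)) (bits L m)) ws g)
  (∑-cong ws (λ w → ∑-map (queue (map pred w)) (bits L m) g))

nextRow-Content : ∀ {L a b c m} ws → c ≤ m → (∀ {w} → w ∈ ws → Content L a b c w) →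
                  ∀ {v} → v ∈ nextRow L m ws → Content L b c m v
nextRow-Content {L} {a} {b} {c} {m} ws c≤m content v∈
  with find (∈ₚ.∈-concatMap⁻ (λ w → map (queue (map pred w)) (bits L m)) {xs = ws} v∈)
... | w , w∈ , v∈′ with ∈ₚ.∈-map⁻ (queue (map pred w)) v∈′
... | S , S∈ , refl = record
  { len    = trans (length-departures _ w′ S (Stable.lengths st)) w′-len
  ; le₁    = trans (cntLe-1-queue w′ S st) (trans (cntLe-pred 1 w) (Content.le₂ k))
  ; le₂    = trans (cntLe-2-queue w′ S st) w′-load
  ; le₃    = trans (cntLe-3-departures _ w′ S (Stable.lengths st)) (proj₂ (bits-∈ L m S∈))
  ; labels = departures-labels _ w′ S }
  where
  k = content w∈
  w′ = map pred w
  w′-len : length w′ ≡ L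
  w′-len = trans (Listₚ.length-map pred w) (Content.len k)
  w′-load : cntLe 2 w′ ≡ c
  w′-load = trans (cntLe-pred 2 w) (Content.le₃ k)
  st : Stable w′ S
  st = stable (trans w′-len (sym (proj₁ (bits-∈ L m S∈))))
         (subst (_≤ cntTrue S) (sym w′-load) (subst (c ≤_) (sym (proj₂ (bits-∈ L m S∈))) c≤m))

Annihilates : ℕ → List (List ℕ) → Set
Annihilates L ws = ∀ (g : List ℕ → ℚ) → ∑ ws (𝓛 L g) ≡ 0ℚ

-- `pred` is monotone, so it passes through the generator, and the intertwining carries the
-- generator through the queue. What remains is the stationarity of the previous row, tested against
-- `Λ L m g` after `pred`.
nextRow-annihilates : ∀ {l a b c m} ws → c ≤ m → (∀ {w} → w ∈ ws → Content (2 + l) a b c w) →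
                      Annihilates (2 + l) ws → Annihilates (2 + l) (nextRow (2 + l) m ws)
nextRow-annihilates {l} {m = m} ws c≤m content ann g = begin
  ∑ (nextRow L m ws) (𝓛 L g)
    ≡⟨ ∑-nextRow L m ws (𝓛 L g) ⟩
  ∑ ws (λ w → Λ L m (𝓛 L g) (map pred w))
    ≡⟨ ∑-cong-∈ ws (λ w w∈ → sym (trans (𝓛-lump L (Λ L m g) ℕₚ.pred-mono-≤ w)
         (Intertwining.intertwine l m g (map pred w)
           (trans (Listₚ.length-map pred w) (Content.len (content w∈)))
           (subst (_≤ m) (sym (trans (cntLe-pred 2 w) (Content.le₃ (content w∈)))) c≤m)))) ⟩
  ∑ ws (𝓛 L (λ v → Λ L m g (map pred v)))
    ≡⟨ ann (λ v → Λ L m g (map pred v)) ⟩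
  0ℚ ∎
  where
  open ≡-Reasoning
  L = 2 + l

rows₀ : ℕ → List (List ℕ)
rows₀ L = replicate L 4 ∷ []

replicate-Content : ∀ L → Content L 0 0 0 (replicate L 4)
replicate-Content zero    = record { len = refl ; le₁ = refl ; le₂ = refl ; le₃ = refl ; labels = [] }
replicate-Content (suc L) = record { len = cong suc len ; le₁ = le₁ ; le₂ = le₂ ; le₃ = le₃
                                   ; labels = (s≤s z≤n , s≤s (s≤s (s≤s (s≤s z≤n)))) ∷ labels }
  where open Content (replicate-Content L)

D₀-constant : ∀ g {k} w → All (_≡ k) w → D₀ g w ≡ 0ℚ
D₀-constant g []          _                   = refl
D₀-constant g (x ∷ [])    _                   = refl
D₀-constant g (x ∷ y ∷ w) (refl ∷ refl ∷ _) rewrite <ᵇ-false (ℕₚ.≤-refl {x}) = refl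

All-rotL : {A : Set} {P : A → Set} (w : List A) → All P w → All P (rotL w)
All-rotL []      []       = []
All-rotL (x ∷ w) (p ∷ ps) = Allₚ.++⁺ ps (p ∷ [])

All-rot : {A : Set} {P : A → Set} (k : ℕ) (w : List A) → All P w → All P (rot k w)
All-rot zero    w ps = ps
All-rot (suc k) w ps = All-rot k (rotL w) (All-rotL w ps)

rows₀-annihilates : ∀ L → Annihilates L (rows₀ L)
rows₀-annihilates L g = trans (ℚₚ.+-identityʳ _)
  (∑-zero (upTo L) (λ r _ → D₀-constant _ (rot r (replicate L 4)) (All-rot r (replicate L 4) (Allₚ.replicate⁺ L refl))))

-- The words carried by the multiline queues with row sizes a, b, n, with multiplicity.
mlqs : ℕ → ℕ → ℕ → ℕ → List (List ℕ)
mlqs L a b n = nextRow L n (nextRow L b (nextRow L a (rows₀ L)))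

module _ (l : ℕ) {a b n : ℕ} (a≤b : a ≤ b) (b≤n : b ≤ n) where

  private
    L = 2 + l
    content₀ : ∀ {w} → w ∈ rows₀ L → Content L 0 0 0 w
    content₀ (here refl) = replicate-Content L
    content₁ : ∀ {w} → w ∈ nextRow L a (rows₀ L) → Content L 0 0 a w
    content₁ = nextRow-Content (rows₀ L) z≤n content₀
    content₂ : ∀ {w} → w ∈ nextRow L b (nextRow L a (rows₀ L)) → Content L 0 a b w
    content₂ = nextRow-Content (nextRow L a (rows₀ L)) a≤b content₁

  mlqs-Content : ∀ {w} → w ∈ mlqs L a b n → Content L a b n w
  mlqs-Content = nextRow-Content (nextRow L b (nextRow L a (rows₀ L))) b≤n content₂

  mlqs-annihilates : Annihilates L (mlqs L a b n)
  mlqs-annihilates = nextRow-annihilates _ b≤n content₂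
    (nextRow-annihilates _ a≤b content₁ (nextRow-annihilates (rows₀ L) z≤n content₀ (rows₀-annihilates L)))

  ∑-mlqs-rotL : ∀ (g : List ℕ → ℚ) → ∑ (mlqs L a b n) (λ w → g (rotL w)) ≡ ∑ (mlqs L a b n) g
  ∑-mlqs-rotL g = step₃ b≤n content₂ (step₃ a≤b content₁ (step₃ z≤n content₀ base)) g
    where
    Invariant : List (List ℕ) → Set
    Invariant ws = ∀ (h : List ℕ → ℚ) → ∑ ws (λ w → h (rotL w)) ≡ ∑ ws h
    base : Invariant (rows₀ L)
    base h = cong (λ w → h w +ℚ 0ℚ) (lem L)
      where
      lem : ∀ k → rotL (replicate k 4) ≡ replicate k 4
      lem zero          = refl
      lem (suc zero)    = refl
      lem (suc (suc k)) = cong (4 ∷_) (lem (suc k))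
    step₃ : ∀ {p q r m ws} → r ≤ m → (∀ {w} → w ∈ ws → Content L p q r w) → Invariant ws → Invariant (nextRow L m ws)
    step₃ {m = m} {ws} r≤m content inv h = begin
      ∑ (nextRow L m ws) (λ w → h (rotL w))
        ≡⟨ ∑-nextRow L m ws (λ w → h (rotL w)) ⟩
      ∑ ws (λ w → Λ L m (λ v → h (rotL v)) (map pred w))
        ≡⟨ ∑-cong-∈ ws (λ w w∈ → sym (trans (cong (Λ L m h) (map-rotL pred w)) (Λ-rot L m h 1 (map pred w)
             (trans (Listₚ.length-map pred w) (Content.len (content w∈)))
             (subst (_≤ m) (sym (trans (cntLe-pred 2 w) (Content.le₃ (content w∈)))) r≤m)))) ⟩
      ∑ ws (λ w → Λ L m h (map pred (rotL w)))
        ≡⟨ inv (λ w → Λ L m h (map pred w)) ⟩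
      ∑ ws (λ w → Λ L m h (map pred w))
        ≡⟨ sym (∑-nextRow L m ws h) ⟩
      ∑ (nextRow L m ws) h ∎
      where open ≡-Reasoning

-- Uniqueness of the stationary law by a maximum principle

-- Minimum and maximum are taken at every position instead of stopping at the right place. Each step
-- then sorts one adjacent pair, so a set closed under the jumps contains the sorted form of each of
-- its words.
ins : ℕ → List ℕ → List ℕ
ins x []      = x ∷ []
ins x (y ∷ w) = (x ⊓ y) ∷ ins (x ⊔ y) w

isort : List ℕ → List ℕ
isort []      = []
isort (x ∷ w) = ins x (isort w)

SortClosed : (List ℕ → Set) → Set
SortClosed P = ∀ u x y z → P (u ++ x ∷ y ∷ z) → P (u ++ (x ⊓ y) ∷ (x ⊔ y) ∷ z)

ins-closed : ∀ P → SortClosed P → ∀ u x w → P (u ++ x ∷ w) → P (u ++ ins x w)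
ins-closed P closed u x []      p = p
ins-closed P closed u x (y ∷ w) p =
  subst P (Listₚ.++-assoc u (x ⊓ y ∷ []) (ins (x ⊔ y) w))
    (ins-closed P closed (u ∷ʳ (x ⊓ y)) (x ⊔ y) w
      (subst P (sym (Listₚ.++-assoc u (x ⊓ y ∷ []) (x ⊔ y ∷ w))) (closed u x y w p)))

isort-closed : ∀ P → SortClosed P → ∀ u w → P (u ++ w) → P (u ++ isort w)
isort-closed P closed u []      p = p
isort-closed P closed u (x ∷ w) p = ins-closed P closed u x (isort w)
  (subst P (Listₚ.++-assoc u (x ∷ []) (isort w))
    (isort-closed P closed (u ∷ʳ x) w (subst P (sym (Listₚ.++-assoc u (x ∷ []) w)) p)))

All-ins : ∀ {P : ℕ → Set} x w → P x → All P w → All P (ins x w)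
All-ins         x []      px ps        = px ∷ []
All-ins {P} x (y ∷ w) px (py ∷ ps) = pick (ℕₚ.⊓-sel x y) ∷ All-ins (x ⊔ y) w (pick (ℕₚ.⊔-sel x y)) ps
  where
  pick : ∀ {z} → z ≡ x ⊎ z ≡ y → P z
  pick (inj₁ refl) = px
  pick (inj₂ refl) = py

All-isort : ∀ {P : ℕ → Set} w → All P w → All P (isort w)
All-isort []      []       = []
All-isort (x ∷ w) (p ∷ ps) = All-ins x (isort w) p (All-isort w ps)

data Sorted : List ℕ → Set where
  []  : Sorted []
  _∷_ : ∀ {x w} → All (x ≤_) w → Sorted w → Sorted (x ∷ w)

ins-Sorted : ∀ x {w} → Sorted w → Sorted (ins x w)
ins-Sorted x []                    = [] ∷ []
ins-Sorted x {y ∷ w} (y≤w ∷ w-sorted) =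
  All-ins (x ⊔ y) w (ℕₚ.m⊓n≤m⊔n x y) (All.map (ℕₚ.≤-trans (ℕₚ.m⊓n≤n x y)) y≤w) ∷ ins-Sorted (x ⊔ y) w-sorted

isort-Sorted : ∀ w → Sorted (isort w)
isort-Sorted []      = []
isort-Sorted (x ∷ w) = ins-Sorted x (isort-Sorted w)

cntLe-ins : ∀ t x w → cntLe t (ins x w) ≡ ind t x + cntLe t w
cntLe-ins t x []      = refl
cntLe-ins t x (y ∷ w) = trans (cong (ind t (x ⊓ y) +_) (cntLe-ins t (x ⊔ y) w)) (cntLe-sort₂ t (x ∷ y ∷ w))

cntLe-isort : ∀ t w → cntLe t (isort w) ≡ cntLe t w
cntLe-isort t []      = refl
cntLe-isort t (x ∷ w) = trans (cntLe-ins t x (isort w)) (cong (ind t x +_) (cntLe-isort t w))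

length-ins : ∀ x w → length (ins x w) ≡ suc (length w)
length-ins x []      = refl
length-ins x (y ∷ w) = cong suc (length-ins (x ⊔ y) w)

length-isort : ∀ w → length (isort w) ≡ length w
length-isort []      = refl
length-isort (x ∷ w) = trans (length-ins x (isort w)) (cong suc (length-isort w))

ind-≤ : ∀ {t x} → x ≤ t → ind t x ≡ 1
ind-≤ x≤t rewrite <ᵇ-true (s≤s x≤t) = refl

ind-> : ∀ {t x} → t < x → ind t x ≡ 0
ind-> t<x rewrite <ᵇ-false t<x = refl

cntLe-> : ∀ {t} w → All (t <_) w → cntLe t w ≡ 0
cntLe-> []      []       = refl
cntLe-> (x ∷ w) (p ∷ ps) = cong₂ _+_ (ind-> p) (cntLe-> w ps)

-- If the heads differ, say x < y, the letters up to x are counted positively on one side and not at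
-- all on the other.
Sorted-unique : ∀ {w v} → Sorted w → Sorted v → All (Label 4) w → All (Label 4) v → length w ≡ length v →
                (∀ t → 1 ≤ t → t ≤ 3 → cntLe t w ≡ cntLe t v) → w ≡ v
Sorted-unique [] [] _ _ _ _ = refl
Sorted-unique {x ∷ w} {y ∷ v} (x≤w ∷ sw) (y≤v ∷ sv) ((1≤x , x≤4) ∷ lw) ((1≤y , y≤4) ∷ lv) len cnt with ℕₚ.<-cmp x y
... | Tri.tri≈ _ refl _ = cong (x ∷_) (Sorted-unique sw sv lw lv (ℕₚ.suc-injective len)
  (λ t p q → ℕₚ.+-cancelˡ-≡ (ind t x) _ _ (cnt t p q)))
... | Tri.tri< x<y _ _ = contradiction
  (trans (sym (cong (_+ cntLe x w) (ind-≤ (ℕₚ.≤-refl {x})))) (trans (cnt x 1≤x (ℕₚ.≤-pred (ℕₚ.≤-trans x<y y≤4)))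
    (cntLe-> (y ∷ v) (x<y ∷ All.map (ℕₚ.<-≤-trans x<y) y≤v)))) λ ()
... | Tri.tri> _ _ y<x = contradiction
  (trans (sym (cong (_+ cntLe y v) (ind-≤ (ℕₚ.≤-refl {y})))) (trans (sym (cnt y 1≤y (ℕₚ.≤-pred (ℕₚ.≤-trans y<x x≤4))))
    (cntLe-> (x ∷ w) (y<x ∷ All.map (ℕₚ.<-≤-trans y<x) x≤w)))) λ ()

isort-Content : ∀ {L a b c w v} → Content L a b c w → Content L a b c v → isort w ≡ isort v
isort-Content {w = w} {v} k k′ = Sorted-unique (isort-Sorted w) (isort-Sorted v)
  (All-isort w (Content.labels k)) (All-isort v (Content.labels k′))
  (trans (length-isort w) (trans (trans (Content.len k) (sym (Content.len k′))) (sym (length-isort v))))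
  (λ t p q → trans (cntLe-isort t w) (trans (cnt t p q) (sym (cntLe-isort t v))))
  where
  cnt : ∀ t → 1 ≤ t → t ≤ 3 → cntLe t w ≡ cntLe t v
  cnt 1 _ _ = trans (Content.le₁ k) (sym (Content.le₁ k′))
  cnt 2 _ _ = trans (Content.le₂ k) (sym (Content.le₂ k′))
  cnt 3 _ _ = trans (Content.le₃ k) (sym (Content.le₃ k′))
  cnt (suc (suc (suc (suc _)))) _ (s≤s (s≤s (s≤s ())))

listEqᵇ⇒≡ : ∀ v w → listEqᵇ v w ≡ true → v ≡ w
listEqᵇ⇒≡ []      []      _ = refl
listEqᵇ⇒≡ (x ∷ v) (y ∷ w) e with x ≡ᵇ y in eq
... | true = cong₂ _∷_ (ℕₚ.≡ᵇ⇒≡ x y (subst T (sym eq) tt)) (listEqᵇ⇒≡ v w e)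

∑-nonpos : {A : Set} (xs : List A) (f : A → ℚ) → (∀ x → x ∈ xs → f x ≤ℚ 0ℚ) → ∑ xs f ≤ℚ 0ℚ
∑-nonpos []       f h = ℚₚ.≤-refl
∑-nonpos (x ∷ xs) f h = ℚₚ.+-mono-≤ (h x (here refl)) (∑-nonpos xs f (λ y y∈ → h y (there y∈)))

+-nonpos-zero : ∀ {p q} → p ≤ℚ 0ℚ → q ≤ℚ 0ℚ → p +ℚ q ≡ 0ℚ → p ≡ 0ℚ × q ≡ 0ℚ
+-nonpos-zero {p} {q} p≤0 q≤0 e =
  ℚₚ.≤-antisym p≤0 (subst (_≤ℚ p) e (subst (p +ℚ q ≤ℚ_) (ℚₚ.+-identityʳ p) (ℚₚ.+-monoʳ-≤ p q≤0))) ,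
  ℚₚ.≤-antisym q≤0 (subst (_≤ℚ q) e (subst (p +ℚ q ≤ℚ_) (ℚₚ.+-identityˡ q) (ℚₚ.+-monoˡ-≤ q p≤0)))

∑-nonpos-zero : {A : Set} (xs : List A) (f : A → ℚ) → (∀ x → x ∈ xs → f x ≤ℚ 0ℚ) → ∑ xs f ≡ 0ℚ →
                ∀ x → x ∈ xs → f x ≡ 0ℚ
∑-nonpos-zero (y ∷ xs) f h e x x∈
  with +-nonpos-zero (h y (here refl)) (∑-nonpos xs f (λ z z∈ → h z (there z∈))) e | x∈
... | fy≡0 , _    | here refl = fy≡0
... | _    , rest | there x∈′ = ∑-nonpos-zero xs f (λ z z∈ → h z (there z∈)) rest x x∈′

positivity : ℚ → ℚ
positivity p with 0ℚ ℚₚ.<? p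
... | yes _ = 1ℚ
... | no  _ = 0ℚ

-- The difference of indicators is at most 0 when p > 0 and at least 0 otherwise.
positivity-nonpos : ∀ p q → p *ℚ (positivity q -ℚ positivity p) ≤ℚ 0ℚ
positivity-nonpos p q with 0ℚ ℚₚ.<? p | 0ℚ ℚₚ.<? q
... | yes 0<p | yes _ = ℚₚ.≤-reflexive (ℚₚ.*-zeroʳ p)
... | yes 0<p | no  _ = subst (_≤ℚ 0ℚ) (lem p) (ℚₚ.neg-antimono-≤ (ℚₚ.<⇒≤ 0<p))
  where
  lem : ∀ p → -ℚ p ≡ p *ℚ (0ℚ -ℚ 1ℚ)
  lem = solve 1 (λ p → :- p := p :* (con 0ℚ :- con 1ℚ)) refl
    where open ℚ-Solver.+-*-Solver
... | no 0≮p  | yes _ = subst (_≤ℚ 0ℚ) (sym (ℚₚ.*-identityʳ p)) (ℚₚ.≮⇒≥ 0≮p)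
... | no 0≮p  | no  _ = ℚₚ.≤-reflexive (ℚₚ.*-zeroʳ p)

positivity-spreads : ∀ p q → 0ℚ <ℚ p → p *ℚ (positivity q -ℚ positivity p) ≡ 0ℚ → 0ℚ <ℚ q
positivity-spreads p q 0<p e with 0ℚ ℚₚ.<? p | 0ℚ ℚₚ.<? q
... | no 0≮p | _ = contradiction 0<p 0≮p
... | yes _  | yes 0<q = 0<q
... | yes _  | no _ = contradiction 0<p (ℚₚ.<-irrefl (sym (trans (lem p) (cong -ℚ_ e))))
  where
  lem : ∀ p → p ≡ -ℚ (p *ℚ (0ℚ -ℚ 1ℚ))
  lem = solve 1 (λ p → p := :- (p :* (con 0ℚ :- con 1ℚ))) refl
    where open ℚ-Solver.+-*-Solver

Weighted : Set
Weighted = List (ℚ × List ℕ)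

weigh : Weighted → (List ℕ → ℚ) → ℚ
weigh I g = ∑ I (λ i → proj₁ i *ℚ g (proj₂ i))

density : Weighted → List ℕ → ℚ
density I v = weigh I (λ w → if listEqᵇ v w then 1ℚ else 0ℚ)

density-support : ∀ I v → density I v ≢ 0ℚ → ∃[ i ] (i ∈ I × v ≡ proj₂ i)
density-support []            v ne = contradiction refl ne
density-support ((c , w) ∷ I) v ne with listEqᵇ v w in eq
... | true  = (c , w) , here refl , listEqᵇ⇒≡ v w eq
... | false with density-support I v (λ e → ne (trans (cong (_+ℚ density I v) (ℚₚ.*-zeroʳ c)) (trans (ℚₚ.+-identityˡ _) e)))
... | i , i∈ , e = i , there i∈ , e

negate : Weighted → Weighted
negate = map (λ i → -ℚ proj₁ i , proj₂ i)

weigh-negate : ∀ I g → weigh (negate I) g ≡ -ℚ weigh I g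
weigh-negate I g = trans (∑-map (λ i → -ℚ proj₁ i , proj₂ i) I (λ i → proj₁ i *ℚ g (proj₂ i)))
  (trans (∑-cong I (λ i → sym (ℚₚ.neg-distribˡ-* (proj₁ i) (g (proj₂ i))))) (∑-neg I (λ i → proj₁ i *ℚ g (proj₂ i))))

∈-allWords : ∀ m {w} → All (Label m) w → w ∈ allWords m (length w)
∈-allWords m [] = here refl
∈-allWords m {suc x ∷ w} ((s≤s z≤n , x<m) ∷ ls) =
  ∈ₚ.∈-concatMap⁺ (λ x → map (suc x ∷_) (allWords m (length w)))
    (lose (∈ₚ.∈-upTo⁺ x<m) (∈ₚ.∈-map⁺ (suc x ∷_) (∈-allWords m ls)))

𝓛-term-sort₂ : ∀ L (g : List ℕ → ℚ) v r → length v ≡ L → r ≤ L →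
               𝓛-term L g v r ≡ g (rot (L ∸ r) (sort₂ (rot r v))) -ℚ g v
𝓛-term-sort₂ L g v r refl r≤L = trans (D₀-sort₂ (λ u → g (rot (L ∸ r) u)) (rot r v))
  (cong (λ u → g (rot (L ∸ r) (sort₂ (rot r v))) -ℚ g u) (rot-∸ r v r≤L))

module _ {L a b c : ℕ} where

  -- Abstracts the signed difference of two stationary laws of equal total mass. Fixing the content
  -- gives all words in the support the same sorted form, which plays the role of the state
  -- reachable from everywhere.
  record Balanced (I : Weighted) : Set where
    field
      content : ∀ {i} → i ∈ I → Content L a b c (proj₂ i)
      kills   : ∀ g → weigh I (𝓛 L g) ≡ 0ℚ
      mass    : weigh I (λ _ → 1ℚ) ≡ 0ℚ

  open Balanced

  negate-Balanced : ∀ {I} → Balanced I → Balanced (negate I)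
  negate-Balanced {I} bal = record
    { content = λ i∈ → let (j , j∈ , e) = ∈ₚ.∈-map⁻ (λ i → -ℚ proj₁ i , proj₂ i) i∈ in
                       subst (λ i → Content L a b c (proj₂ i)) (sym e) (content bal j∈)
    ; kills   = λ g → trans (weigh-negate I (𝓛 L g)) (cong -ℚ_ (kills bal g))
    ; mass    = trans (weigh-negate I (λ _ → 1ℚ)) (cong -ℚ_ (mass bal)) }

  module _ {I : Weighted} (bal : Balanced I) where

    private
      W = allWords 4 L
      d = density I

    weigh-density : ∀ g → weigh I g ≡ ∑ W (λ v → d v *ℚ g v)
    weigh-density g = begin
      ∑ I (λ i → proj₁ i *ℚ g (proj₂ i))
        ≡⟨ ∑-cong-∈ I (λ i i∈ → cong (proj₁ i *ℚ_) (sym (allWords-pick 4 L g (Content.len (content bal i∈)) (Content.labels (content bal i∈))))) ⟩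
      ∑ I (λ i → proj₁ i *ℚ ∑ W (λ v → if listEqᵇ v (proj₂ i) then g v else 0ℚ))
        ≡⟨ ∑-cong I (λ i → sym (∑-*ˡ (proj₁ i) W (λ v → if listEqᵇ v (proj₂ i) then g v else 0ℚ))) ⟩
      ∑ I (λ i → ∑ W (λ v → proj₁ i *ℚ (if listEqᵇ v (proj₂ i) then g v else 0ℚ)))
        ≡⟨ ∑-swap I W (λ i v → proj₁ i *ℚ (if listEqᵇ v (proj₂ i) then g v else 0ℚ)) ⟩
      ∑ W (λ v → ∑ I (λ i → proj₁ i *ℚ (if listEqᵇ v (proj₂ i) then g v else 0ℚ)))
        ≡⟨ ∑-cong W (λ v → trans (∑-cong I (λ i → lem (proj₁ i) (listEqᵇ v (proj₂ i)) (g v)))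
             (trans (∑-*ˡ (g v) I (λ i → proj₁ i *ℚ (if listEqᵇ v (proj₂ i) then 1ℚ else 0ℚ))) (ℚₚ.*-comm (g v) (d v)))) ⟩
      ∑ W (λ v → d v *ℚ g v) ∎
      where
      open ≡-Reasoning
      lem : ∀ p e q → p *ℚ (if e then q else 0ℚ) ≡ q *ℚ (p *ℚ (if e then 1ℚ else 0ℚ))
      lem p true  q = trans (ℚₚ.*-comm p q) (cong (q *ℚ_) (sym (ℚₚ.*-identityʳ p)))
      lem p false q = trans (ℚₚ.*-zeroʳ p) (sym (trans (cong (q *ℚ_) (ℚₚ.*-zeroʳ p)) (ℚₚ.*-zeroʳ q)))

    density-Content : ∀ {v} → 0ℚ <ℚ d v → Content L a b c v
    density-Content {v} 0<dv with density-support I v (λ e → ℚₚ.<-irrefl (sym e) 0<dv)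
    ... | i , i∈ , refl = content bal i∈

    -- Testing stationarity against the indicator of {d > 0} makes every term nonpositive.
    density-positive-closed : SortClosed (λ v → 0ℚ <ℚ d v)
    density-positive-closed u x y z 0<dv = subst (λ t → 0ℚ <ℚ d t) target
      (positivity-spreads (d v) (d (rot (L ∸ length u) (sort₂ (rot (length u) v)))) 0<dv
        (trans (sym (cong (d v *ℚ_) (𝓛-term-sort₂ L G v (length u) v-len (ℕₚ.<⇒≤ |u|<L)))) zero-term))
      where
      v = u ++ x ∷ y ∷ z
      G : List ℕ → ℚ
      G w = positivity (d w)
      k = density-Content 0<dv
      v-len : length v ≡ L
      v-len = Content.len k
      |u|<L : length u < L
      |u|<L = subst (length u <_) (trans (sym (Listₚ.length-++ u)) v-len) (ℕₚ.m<m+n (length u) (s≤s z≤n))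
      term-nonpos : ∀ w r → length w ≡ L → r ∈ upTo L → d w *ℚ 𝓛-term L G w r ≤ℚ 0ℚ
      term-nonpos w r len r∈ = subst (_≤ℚ 0ℚ) (cong (d w *ℚ_) (sym (𝓛-term-sort₂ L G w r len (ℕₚ.<⇒≤ (∈ₚ.∈-upTo⁻ r∈)))))
        (positivity-nonpos (d w) (d (rot (L ∸ r) (sort₂ (rot r w)))))
      zero-word : d v *ℚ 𝓛 L G v ≡ 0ℚ
      zero-word = ∑-nonpos-zero W (λ w → d w *ℚ 𝓛 L G w)
        (λ w w∈ → subst (_≤ℚ 0ℚ) (∑-*ˡ (d w) (upTo L) (𝓛-term L G w))
          (∑-nonpos (upTo L) _ (λ r r∈ → term-nonpos w r (proj₁ (allWords-∈ 4 L w∈)) r∈)))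
        (trans (sym (weigh-density (𝓛 L G))) (kills bal G)) v
        (subst (λ l → v ∈ allWords 4 l) v-len (∈-allWords 4 (Content.labels k)))
      zero-term : d v *ℚ 𝓛-term L G v (length u) ≡ 0ℚ
      zero-term = ∑-nonpos-zero (upTo L) (λ r → d v *ℚ 𝓛-term L G v r) (λ r r∈ → term-nonpos v r v-len r∈)
        (trans (∑-*ˡ (d v) (upTo L) (𝓛-term L G v)) zero-word) (length u) (∈ₚ.∈-upTo⁺ |u|<L)
      target : rot (L ∸ length u) (sort₂ (rot (length u) v)) ≡ u ++ (x ⊓ y) ∷ (x ⊔ y) ∷ z
      target = trans (cong₂ (λ i w → rot i (sort₂ w))
          (trans (cong (_∸ length u) (trans (sym v-len) (Listₚ.length-++ u))) (ℕₚ.m+n∸m≡n (length u) (2 + length z)))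
          (rot-++ u (x ∷ y ∷ z)))
        (rot-++ ((x ⊓ y) ∷ (x ⊔ y) ∷ z) u)

    density-positive-isort : ∀ {v} → 0ℚ <ℚ d v → 0ℚ <ℚ d (isort v)
    density-positive-isort {v} = isort-closed (λ u → 0ℚ <ℚ d u) density-positive-closed [] v

  -- A positive value somewhere forces a positive value at the sorted word. A negative value
  -- elsewhere would, by the same argument for the negated weights, force a negative value at that
  -- same word. So one positive value makes the whole density nonnegative, and total mass zero then
  -- makes it vanish.
  density-nonpos : ∀ {I} → Balanced I → ∀ v → v ∈ allWords 4 L → density I v ≤ℚ 0ℚ
  density-nonpos {I} bal v v∈ = ℚₚ.≮⇒≥ λ 0<dv → ℚₚ.<-irrefl (sym (dv≡0 0<dv)) 0<dv
    where
    d = density I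
    negative : ∀ w → density (negate I) w ≡ -ℚ d w
    negative w = weigh-negate I (λ w′ → if listEqᵇ w w′ then 1ℚ else 0ℚ)
    nonneg : 0ℚ <ℚ d v → ∀ w → 0ℚ ≤ℚ d w
    nonneg 0<dv w = ℚₚ.≮⇒≥ λ dw<0 →
      let neg>0 = subst (0ℚ <ℚ_) (sym (negative w)) (ℚₚ.neg-antimono-< dw<0)
          bal′ = negate-Balanced bal
          s≡ = isort-Content (density-Content bal′ {w} neg>0) (density-Content bal {v} 0<dv)
          neg = subst (0ℚ <ℚ_) (trans (cong (density (negate I)) s≡) (negative (isort v))) (density-positive-isort bal′ {w} neg>0)
      in ℚₚ.<-asym (density-positive-isort bal {v} 0<dv)
           (subst (_<ℚ 0ℚ) (neg-involutive (d (isort v))) (ℚₚ.neg-antimono-< neg))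
    dv≡0 : 0ℚ <ℚ d v → d v ≡ 0ℚ
    dv≡0 0<dv = ℚₚ.neg-injective (∑-nonpos-zero (allWords 4 L) (λ w → -ℚ d w)
      (λ w _ → ℚₚ.neg-antimono-≤ (nonneg 0<dv w))
      (trans (∑-neg (allWords 4 L) d) (cong -ℚ_ (trans (∑-cong (allWords 4 L) (λ w → sym (ℚₚ.*-identityʳ (d w))))
        (trans (sym (weigh-density bal (λ _ → 1ℚ))) (mass bal))))) v v∈)

  Balanced-zero : ∀ {I} → Balanced I → ∀ g → weigh I g ≡ 0ℚ
  Balanced-zero {I} bal g = trans (weigh-density bal g) (∑-zero (allWords 4 L) λ v v∈ →
    trans (cong (_*ℚ g v) (ℚₚ.≤-antisym (density-nonpos bal v v∈)
      (subst (0ℚ ≤ℚ_) (neg-involutive (density I v)) (ℚₚ.neg-antimono-≤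
        (subst (_≤ℚ 0ℚ) (weigh-negate I (λ w′ → if listEqᵇ v w′ then 1ℚ else 0ℚ)) (density-nonpos (negate-Balanced bal) v v∈))))))
      (ℚₚ.*-zeroˡ (g v)))

-- Lumping the labels into classes

classOf : ℕ → ℕ → ℕ → ℕ → ℕ
classOf a b n x = if x <ᵇ suc a then 1 else if x <ᵇ suc b then 2 else if x <ᵇ suc n then 3 else 4

data ClassView (a b n x : ℕ) : ℕ → Set where
  one   : x ≤ a → ClassView a b n x 1
  two   : a < x → x ≤ b → ClassView a b n x 2
  three : a < x → b < x → x ≤ n → ClassView a b n x 3
  four  : a < x → b < x → n < x → ClassView a b n x 4

classView : ∀ a b n x → ClassView a b n x (classOf a b n x)
classView a b n x with x ≤? a
... | yes x≤a rewrite <ᵇ-true (s≤s x≤a) = one x≤a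
... | no x≰a rewrite <ᵇ-false (ℕₚ.≰⇒> x≰a) with x ≤? b
... | yes x≤b rewrite <ᵇ-true (s≤s x≤b) = two (ℕₚ.≰⇒> x≰a) x≤b
... | no x≰b rewrite <ᵇ-false (ℕₚ.≰⇒> x≰b) with x ≤? n
... | yes x≤n rewrite <ᵇ-true (s≤s x≤n) = three (ℕₚ.≰⇒> x≰a) (ℕₚ.≰⇒> x≰b) x≤n
... | no x≰n rewrite <ᵇ-false (ℕₚ.≰⇒> x≰n) = four (ℕₚ.≰⇒> x≰a) (ℕₚ.≰⇒> x≰b) (ℕₚ.≰⇒> x≰n)

classOf-mono : ∀ a b n → Monotone (classOf a b n)
classOf-mono a b n {x} {y} x≤y with classOf a b n x | classView a b n x | classOf a b n y | classView a b n y
... | _ | one _       | _ | one _       = s≤s z≤n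
... | _ | one _       | _ | two _ _     = s≤s z≤n
... | _ | one _       | _ | three _ _ _ = s≤s z≤n
... | _ | one _       | _ | four _ _ _  = s≤s z≤n
... | _ | two a<x _   | _ | one y≤a     = contradiction (ℕₚ.≤-trans x≤y y≤a) (ℕₚ.<⇒≱ a<x)
... | _ | two _ _     | _ | two _ _     = s≤s (s≤s z≤n)
... | _ | two _ _     | _ | three _ _ _ = s≤s (s≤s z≤n)
... | _ | two _ _     | _ | four _ _ _  = s≤s (s≤s z≤n)
... | _ | three a<x _ _ | _ | one y≤a   = contradiction (ℕₚ.≤-trans x≤y y≤a) (ℕₚ.<⇒≱ a<x)
... | _ | three _ b<x _ | _ | two _ y≤b = contradiction (ℕₚ.≤-trans x≤y y≤b) (ℕₚ.<⇒≱ b<x)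
... | _ | three _ _ _ | _ | three _ _ _ = s≤s (s≤s (s≤s z≤n))
... | _ | three _ _ _ | _ | four _ _ _  = s≤s (s≤s (s≤s z≤n))
... | _ | four a<x _ _ | _ | one y≤a    = contradiction (ℕₚ.≤-trans x≤y y≤a) (ℕₚ.<⇒≱ a<x)
... | _ | four _ b<x _ | _ | two _ y≤b  = contradiction (ℕₚ.≤-trans x≤y y≤b) (ℕₚ.<⇒≱ b<x)
... | _ | four _ _ n<x | _ | three _ _ y≤n = contradiction (ℕₚ.≤-trans x≤y y≤n) (ℕₚ.<⇒≱ n<x)
... | _ | four _ _ _  | _ | four _ _ _  = s≤s (s≤s (s≤s (s≤s z≤n)))

classOf-Label : ∀ a b n x → Label 4 (classOf a b n x)
classOf-Label a b n x with classOf a b n x | classView a b n x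
... | _ | one _       = s≤s z≤n , s≤s z≤n
... | _ | two _ _     = s≤s z≤n , s≤s (s≤s z≤n)
... | _ | three _ _ _ = s≤s z≤n , s≤s (s≤s (s≤s z≤n))
... | _ | four _ _ _  = s≤s z≤n , s≤s (s≤s (s≤s (s≤s z≤n)))

ind-classOf-1 : ∀ a b n x → ind 1 (classOf a b n x) ≡ ind a x
ind-classOf-1 a b n x with classOf a b n x | classView a b n x
... | _ | one x≤a       = sym (ind-≤ x≤a)
... | _ | two a<x _     = sym (ind-> a<x)
... | _ | three a<x _ _ = sym (ind-> a<x)
... | _ | four a<x _ _  = sym (ind-> a<x)

ind-classOf-2 : ∀ {a b} n → a ≤ b → ∀ x → ind 2 (classOf a b n x) ≡ ind b x
ind-classOf-2 {a} {b} n a≤b x with classOf a b n x | classView a b n x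
... | _ | one x≤a       = sym (ind-≤ (ℕₚ.≤-trans x≤a a≤b))
... | _ | two _ x≤b     = sym (ind-≤ x≤b)
... | _ | three _ b<x _ = sym (ind-> b<x)
... | _ | four _ b<x _  = sym (ind-> b<x)

ind-classOf-3 : ∀ {a b n} → a ≤ b → b ≤ n → ∀ x → ind 3 (classOf a b n x) ≡ ind n x
ind-classOf-3 {a} {b} {n} a≤b b≤n x with classOf a b n x | classView a b n x
... | _ | one x≤a       = sym (ind-≤ (ℕₚ.≤-trans x≤a (ℕₚ.≤-trans a≤b b≤n)))
... | _ | two _ x≤b     = sym (ind-≤ (ℕₚ.≤-trans x≤b b≤n))
... | _ | three _ _ x≤n = sym (ind-≤ x≤n)
... | _ | four _ _ n<x  = sym (ind-> n<x)

cntLe-map : ∀ t t′ (h : ℕ → ℕ) → (∀ x → ind t (h x) ≡ ind t′ x) → ∀ w → cntLe t (map h w) ≡ cntLe t′ w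
cntLe-map t t′ h e []      = refl
cntLe-map t t′ h e (x ∷ w) = cong₂ _+_ (e x) (cntLe-map t t′ h e w)

≡ᵇ-refl : ∀ x → (x ≡ᵇ x) ≡ true
≡ᵇ-refl x = T⇒≡ (ℕₚ.≡⇒≡ᵇ x x refl)

≡ᵇ-false : ∀ {x y} → x ≢ y → (x ≡ᵇ y) ≡ false
≡ᵇ-false {x} {y} ne with x ≡ᵇ y in eq
... | false = refl
... | true  = contradiction (ℕₚ.≡ᵇ⇒≡ x y (subst T (sym eq) tt)) ne

cntLe-suc : ∀ t w → cntLe (suc t) w ≡ cntLe t w + countᵇ (suc t) w
cntLe-suc t []      = refl
cntLe-suc t (x ∷ w) with ℕₚ.<-cmp x (suc t)
... | Tri.tri< x≤t ne _ rewrite ≡ᵇ-false (λ e → ne (sym e)) | ind-≤ {suc t} (ℕₚ.<⇒≤ x≤t) | ind-≤ (ℕₚ.≤-pred x≤t) =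
  cong suc (cntLe-suc t w)
... | Tri.tri≈ _ refl _ rewrite ≡ᵇ-refl t | ind-≤ (ℕₚ.≤-refl {suc t}) | ind-> (ℕₚ.n<1+n t) =
  trans (cong suc (cntLe-suc t w)) (sym (ℕₚ.+-suc (cntLe t w) _))
... | Tri.tri> _ ne t<x rewrite ≡ᵇ-false (λ e → ne (sym e)) | ind-> t<x | ind-> (ℕₚ.<-trans (ℕₚ.n<1+n t) t<x) = cntLe-suc t w

and-∈ : {A : Set} (f : A → Bool) (xs : List A) → and (map f xs) ≡ true → ∀ {x} → x ∈ xs → f x ≡ true
and-∈ f (y ∷ xs) e x∈ with f y in eq | x∈
... | true | here refl = eq
... | true | there x∈′ = and-∈ f xs e x∈′

Config-count : ∀ {n L w} → Config n L w → ∀ {k} → k < n → countᵇ (suc k) w ≡ 1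
Config-count {n} {L} {w} c {k} k<n = ℕₚ.≡ᵇ⇒≡ _ 1
  (subst T (sym (and-∈ (λ k → countᵇ (suc k) w ≡ᵇ 1) (upTo n) (Config.config c) (∈ₚ.∈-upTo⁺ k<n))) tt)

Config-cntLe : ∀ {n L w} → Config n L w → ∀ t → t ≤ n → cntLe t w ≡ t
Config-cntLe {w = w} c zero    _   = cntLe-> w (All.map proj₁ (Config.labels c))
Config-cntLe {w = w} c (suc t) t<n = trans (cntLe-suc t w)
  (trans (cong₂ _+_ (Config-cntLe c t (ℕₚ.<⇒≤ t<n)) (Config-count c t<n)) (ℕₚ.+-comm t 1))

lump-Content : ∀ {n L a b w} → a ≤ b → b ≤ n → Config n L w → Content L a b n (map (classOf a b n) w)
lump-Content {n} {L} {a} {b} {w} a≤b b≤n c = record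
  { len    = trans (Listₚ.length-map _ w) (Config.len c)
  ; le₁    = trans (cntLe-map 1 a _ (ind-classOf-1 a b n) w) (Config-cntLe c a (ℕₚ.≤-trans a≤b b≤n))
  ; le₂    = trans (cntLe-map 2 b _ (ind-classOf-2 n a≤b) w) (Config-cntLe c b b≤n)
  ; le₃    = trans (cntLe-map 3 n _ (ind-classOf-3 a≤b b≤n) w) (Config-cntLe c n ℕₚ.≤-refl)
  ; labels = Allₚ.map⁺ (All.universal (classOf-Label a b n) w) }

map-∈ : {A B : Set} {P : B → Set} (f : A → B) (xs : List A) → (∀ {x} → x ∈ xs → P (f x)) → ∀ {y} → y ∈ map f xs → P y
map-∈ f xs h y∈ with ∈ₚ.∈-map⁻ f y∈
... | x , x∈ , refl = h x∈

module _ {n l : ℕ} {π : List ℕ → ℚ} (stat : IsStationary n (2 + l) π) {a b : ℕ} (a≤b : a ≤ b) (b≤n : b ≤ n) where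

  private
    L = 2 + l
    M = mlqs L a b n
    Z = ℕtoℚ (length M)
    ρ = classOf a b n
    lumped : List ℕ → ℚ × List ℕ
    lumped η = Z *ℚ π η , map ρ η
    negative : List ℕ → ℚ × List ℕ
    negative w = -ℚ 1ℚ , w
    I : Weighted
    -- The lumped law is scaled by the number of multiline queues instead of dividing the other
    -- side, so both parts have mass `Z`.
    I = map lumped (configs n L) ++ map negative M
    E : (List ℕ → ℚ) → ℚ
    E g = ∑ (configs n L) (λ η → π η *ℚ g (map ρ η))

    weigh-I : ∀ g → weigh I g ≡ Z *ℚ E g -ℚ ∑ M g
    weigh-I g = trans (∑-++ (map lumped (configs n L)) (map negative M) h) (cong₂ _+ℚ_
      (trans (∑-map lumped (configs n L) h) (trans
        (∑-cong (configs n L) (λ η → ℚₚ.*-assoc Z (π η) (g (map ρ η))))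
        (∑-*ˡ Z (configs n L) (λ η → π η *ℚ g (map ρ η)))))
      (trans (∑-map negative M h) (trans
        (∑-cong M (λ w → trans (sym (ℚₚ.neg-distribˡ-* 1ℚ (g w))) (cong -ℚ_ (ℚₚ.*-identityˡ (g w)))))
        (∑-neg M g))))
      where
      h : ℚ × List ℕ → ℚ
      h i = proj₁ i *ℚ g (proj₂ i)

    I-content : ∀ {i} → i ∈ I → Content L a b n (proj₂ i)
    I-content {i} i∈ = [ map-∈ {P = λ i → Content L a b n (proj₂ i)} lumped (configs n L) (λ η∈ → lump-Content a≤b b≤n (configs-∈ n L η∈))
                       , map-∈ {P = λ i → Content L a b n (proj₂ i)} negative M (λ w∈ → mlqs-Content l a≤b b≤n w∈)
                       ]′ (∈ₚ.∈-++⁻ (map lumped (configs n L)) i∈)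

    E-kills : ∀ g → E (𝓛 L g) ≡ 0ℚ
    E-kills g = trans (∑-cong (configs n L) (λ η → cong (π η *ℚ_) (sym (𝓛-lump L g (classOf-mono a b n) η))))
                      (stationary-𝓛 stat (λ w → g (map ρ w)))

    I-kills : ∀ g → weigh I (𝓛 L g) ≡ 0ℚ
    I-kills g = begin
      weigh I (𝓛 L g)                          ≡⟨ weigh-I (𝓛 L g) ⟩
      Z *ℚ E (𝓛 L g) -ℚ ∑ M (𝓛 L g)            ≡⟨ cong (λ p → Z *ℚ p -ℚ ∑ M (𝓛 L g)) (E-kills g) ⟩
      Z *ℚ 0ℚ -ℚ ∑ M (𝓛 L g)                   ≡⟨ cong (λ p → Z *ℚ 0ℚ -ℚ p) (mlqs-annihilates l a≤b b≤n g) ⟩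
      Z *ℚ 0ℚ -ℚ 0ℚ                            ≡⟨ cong (λ p → p -ℚ 0ℚ) (ℚₚ.*-zeroʳ Z) ⟩
      0ℚ                                       ∎
      where open ≡-Reasoning

    I-balanced : Balanced I
    I-balanced = record
      { content = I-content
      ; kills   = I-kills
      ; mass    = trans (weigh-I (λ _ → 1ℚ)) (trans (cong₂ _-ℚ_
                    (trans (cong (Z *ℚ_) (trans (∑-cong (configs n L) (λ η → ℚₚ.*-identityʳ (π η))) (proj₁ (proj₂ stat))))
                           (ℚₚ.*-identityʳ Z))
                    (trans (∑-const 1ℚ M) (ℚₚ.*-identityˡ Z))) (ℚₚ.+-inverseʳ Z)) }

  lumped-law : ∀ g → ℕtoℚ (length (mlqs (2 + l) a b n)) *ℚ ∑ (configs n (2 + l)) (λ η → π η *ℚ g (map (classOf a b n) η))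
                     ≡ ∑ (mlqs (2 + l) a b n) g
  lumped-law g = p-q≡0⇒p≡q _ _ (trans (sym (weigh-I g)) (Balanced-zero I-balanced g))

-- Adjacent pairs

𝟙 : Bool → ℚ
𝟙 b = if b then 1ℚ else 0ℚ

𝟙-∧ : ∀ b c → 𝟙 (b ∧ c) ≡ 𝟙 b *ℚ 𝟙 c
𝟙-∧ true  true  = refl
𝟙-∧ true  false = refl
𝟙-∧ false true  = refl
𝟙-∧ false false = refl

is : ℕ → Maybe ℕ → Bool
is j (just k) = k ≡ᵇ j
is j nothing  = false

startsPair : ℕ → ℕ → ℕ → List ℕ → Bool
startsPair n i j []      = false
startsPair n i j (x ∷ w) = (i ≡ᵇ x) ∧ is j (firstParticle n w)

adjacentᵇ-is : ∀ n i j η → adjacentᵇ n i j η ≡ is j (firstParticle n (afterCyclic i η []))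
adjacentᵇ-is n i j η with firstParticle n (afterCyclic i η [])
... | just k  = refl
... | nothing = refl

pairs : ℕ → (List ℕ → Bool) → List ℕ → ℚ
pairs L p w = ∑ (upTo L) (λ r → 𝟙 (p (rot r w)))

module _ (n i j : ℕ) where

  private
    t : List ℕ → ℚ
    t w = 𝟙 (startsPair n i j w)

    shift : ∀ (u : List ℕ) (x : ℕ) w k → rot (length u + suc k) (u ++ x ∷ w) ≡ rot (length (u ∷ʳ x) + k) ((u ∷ʳ x) ++ w)
    shift u x w k = cong₂ rot
      (trans (ℕₚ.+-suc (length u) k) (cong (_+ k) (sym (trans (Listₚ.length-++ u) (ℕₚ.+-comm (length u) 1)))))
      (sym (Listₚ.++-assoc u (x ∷ []) w))

    peel : ∀ u x w → ∑ (upTo (suc (length w))) (λ r → t (rot (length u + r) (u ++ x ∷ w)))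
             ≡ t (x ∷ w ++ u) +ℚ ∑ (upTo (length w)) (λ r → t (rot (length (u ∷ʳ x) + r) ((u ∷ʳ x) ++ w)))
    peel u x w = trans (∑-upTo-suc (length w) (λ r → t (rot (length u + r) (u ++ x ∷ w))))
      (cong₂ _+ℚ_ (cong t (trans (cong (λ k → rot k (u ++ x ∷ w)) (ℕₚ.+-identityʳ (length u))) (rot-++ u (x ∷ w))))
                  (∑-cong (upTo (length w)) (λ k → cong t (shift u x w k))))

  pairs-absent : ∀ u w → countᵇ i w ≡ 0 → ∑ (upTo (length w)) (λ r → t (rot (length u + r) (u ++ w))) ≡ 0ℚ
  pairs-absent u []      _ = refl
  pairs-absent u (x ∷ w) e with i ≡ᵇ x in eq
  ... | false = trans (peel u x w) (cong₂ _+ℚ_ (cong (λ b → 𝟙 (b ∧ is j (firstParticle n (w ++ u)))) eq)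
                  (pairs-absent (u ∷ʳ x) w e))

  -- `u` holds the sites already passed; reversed, it is the accumulator of `afterCyclic`. After the
  -- first occurrence of i there is no other one, so the remaining rotations contribute nothing.
  pairs-once : ∀ u w → countᵇ i w ≤ 1 →
    ∑ (upTo (length w)) (λ r → t (rot (length u + r) (u ++ w))) ≡ 𝟙 (is j (firstParticle n (afterCyclic i w (reverse u))))
  pairs-once u []      _  = refl
  pairs-once u (x ∷ w) le with i ≡ᵇ x in eq
  ... | true  = trans (peel u x w) (trans (cong₂ _+ℚ_
    (cong₂ (λ b v → 𝟙 (b ∧ is j (firstParticle n v))) eq (cong (w ++_) (sym (Listₚ.reverse-involutive u))))
    (pairs-absent (u ∷ʳ x) w (ℕₚ.n≤0⇒n≡0 (ℕₚ.≤-pred le)))) (ℚₚ.+-identityʳ _))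
  ... | false = trans (peel u x w) (trans (cong₂ _+ℚ_ (cong (λ b → 𝟙 (b ∧ is j (firstParticle n (w ++ u)))) eq)
    (trans (pairs-once (u ∷ʳ x) w le) (cong (λ v → 𝟙 (is j (firstParticle n (afterCyclic i w v)))) (Listₚ.reverse-++ u (x ∷ [])))))
    (ℚₚ.+-identityˡ _))

-- Since label i occurs once, an event about the cyclic word becomes a sum over rotations of an
-- event at the front, to which rotation invariance can be applied.
adjacent-pairs : ∀ {n L i j η} → 1 ≤ i → i ≤ n → Config n L η → 𝟙 (adjacentᵇ n i j η) ≡ pairs L (startsPair n i j) η
adjacent-pairs {n} {L} {suc i} {j} {η} _ i<n c = trans (cong 𝟙 (adjacentᵇ-is n (suc i) j η))
  (trans (sym (pairs-once n (suc i) j [] η (ℕₚ.≤-reflexive (Config-count c i<n))))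
    (cong (λ l → pairs l (startsPair n (suc i) j) η) (Config.len c)))

classOf-≡3 : ∀ {a b} n x → a ≤ b → (3 ≡ᵇ classOf a b n x) ≡ (b <ᵇ x) ∧ (x <ᵇ suc n)
classOf-≡3 {a} {b} n x a≤b with classOf a b n x | classView a b n x
... | _ | one x≤a         rewrite <ᵇ-false (ℕₚ.≤-trans x≤a a≤b) = refl
... | _ | two _ x≤b       rewrite <ᵇ-false x≤b = refl
... | _ | three _ b<x x≤n rewrite <ᵇ-true b<x | <ᵇ-true (s≤s x≤n) = refl
... | _ | four _ b<x n<x  rewrite <ᵇ-true b<x | <ᵇ-false n<x = refl

classOf-≡2 : ∀ a b n x → (classOf a b n x ≡ᵇ 2) ≡ (a <ᵇ x) ∧ (x <ᵇ suc b)
classOf-≡2 a b n x with classOf a b n x | classView a b n x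
... | _ | one x≤a         rewrite <ᵇ-false x≤a = refl
... | _ | two a<x x≤b     rewrite <ᵇ-true a<x | <ᵇ-true (s≤s x≤b) = refl
... | _ | three a<x b<x _ rewrite <ᵇ-true a<x | <ᵇ-false b<x = refl
... | _ | four a<x b<x _  rewrite <ᵇ-true a<x | <ᵇ-false b<x = refl

classOf-≡4 : ∀ {a b n x} → a ≤ b → b ≤ n → x ≤ suc n → (classOf a b n x ≡ᵇ 4) ≡ (x ≡ᵇ suc n)
classOf-≡4 {a} {b} {n} {x} a≤b b≤n x≤ with classOf a b n x | classView a b n x
... | _ | one x≤a       = sym (≡ᵇ-false (ℕₚ.<⇒≢ (s≤s (ℕₚ.≤-trans x≤a (ℕₚ.≤-trans a≤b b≤n)))))
... | _ | two _ x≤b     = sym (≡ᵇ-false (ℕₚ.<⇒≢ (s≤s (ℕₚ.≤-trans x≤b b≤n))))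
... | _ | three _ _ x≤n = sym (≡ᵇ-false (ℕₚ.<⇒≢ (s≤s x≤n)))
... | _ | four _ _ n<x  = sym (trans (cong (_≡ᵇ suc n) (ℕₚ.≤-antisym x≤ n<x)) (≡ᵇ-refl (suc n)))

firstParticle-lump : ∀ {a b n} → a ≤ b → b ≤ n → ∀ w → All (Label (suc n)) w →
                     firstParticle 3 (map (classOf a b n) w) ≡ Maybe.map (classOf a b n) (firstParticle n w)
firstParticle-lump a≤b b≤n []      []       = refl
firstParticle-lump {a} {b} {n} a≤b b≤n (x ∷ w) (p ∷ ps) rewrite classOf-≡4 a≤b b≤n (proj₂ p) with x ≡ᵇ suc n
... | true  = firstParticle-lump a≤b b≤n w ps
... | false = refl

exactly-third : ∀ {n i} x → i < n → 𝟙 ((i <ᵇ x) ∧ (x <ᵇ suc n)) -ℚ 𝟙 ((suc i <ᵇ x) ∧ (x <ᵇ suc n)) ≡ 𝟙 (suc i ≡ᵇ x)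
exactly-third {n} {i} x i<n with ℕₚ.<-cmp x (suc i)
... | Tri.tri< x≤i ne _ rewrite <ᵇ-false (ℕₚ.≤-pred x≤i) | <ᵇ-false (ℕₚ.<⇒≤ x≤i) | ≡ᵇ-false (λ e → ne (sym e)) = refl
... | Tri.tri≈ _ refl _ rewrite <ᵇ-true (ℕₚ.n<1+n i) | <ᵇ-false (ℕₚ.≤-refl {suc i}) | <ᵇ-true i<n | ≡ᵇ-refl i = refl
... | Tri.tri> _ ne i<x rewrite <ᵇ-true (ℕₚ.<-trans (ℕₚ.n<1+n i) i<x) | <ᵇ-true i<x | ≡ᵇ-false (λ e → ne (sym e)) =
  ℚₚ.+-inverseʳ (𝟙 (x <ᵇ suc n))

exactly-second : ∀ {b j} x → j < b → 𝟙 ((j <ᵇ x) ∧ (x <ᵇ suc b)) -ℚ 𝟙 ((suc j <ᵇ x) ∧ (x <ᵇ suc b)) ≡ 𝟙 (x ≡ᵇ suc j)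
exactly-second {b} {j} x j<b with ℕₚ.<-cmp x (suc j)
... | Tri.tri< x≤j ne _ rewrite <ᵇ-false (ℕₚ.≤-pred x≤j) | <ᵇ-false (ℕₚ.<⇒≤ x≤j) | ≡ᵇ-false ne = refl
... | Tri.tri≈ _ refl _ rewrite <ᵇ-true (ℕₚ.n<1+n j) | <ᵇ-false (ℕₚ.≤-refl {suc j}) | <ᵇ-true j<b | ≡ᵇ-refl j = refl
... | Tri.tri> _ ne j<x rewrite <ᵇ-true (ℕₚ.<-trans (ℕₚ.n<1+n j) j<x) | <ᵇ-true j<x | ≡ᵇ-false ne =
  ℚₚ.+-inverseʳ (𝟙 (x <ᵇ suc b))

lumpedPair : ℕ → ℕ → ℕ → List ℕ → ℚ
lumpedPair n b a w = 𝟙 (startsPair 3 3 2 (map (classOf a b n) w))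

lumpedPair-∷ : ∀ {n b a} → a ≤ b → b ≤ n → ∀ x w → All (Label (suc n)) w → lumpedPair n b a (x ∷ w)
               ≡ 𝟙 ((b <ᵇ x) ∧ (x <ᵇ suc n)) *ℚ 𝟙 (is 2 (Maybe.map (classOf a b n) (firstParticle n w)))
lumpedPair-∷ {n} {b} {a} a≤b b≤n x w ls = trans (𝟙-∧ (3 ≡ᵇ classOf a b n x) _)
  (cong₂ (λ p q → 𝟙 p *ℚ 𝟙 (is 2 q)) (classOf-≡3 n x a≤b) (firstParticle-lump a≤b b≤n w ls))

-- Inclusion-exclusion over the thresholds b ∈ {i - 1, i} and a ∈ {j - 1, j}.
startsPair-lump : ∀ {n i j} → suc j ≤ i → suc i ≤ n → ∀ w → All (Label (suc n)) w →
  𝟙 (startsPair n (suc i) (suc j) w)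
  ≡ (lumpedPair n i j w -ℚ lumpedPair n i (suc j) w) -ℚ (lumpedPair n (suc i) j w -ℚ lumpedPair n (suc i) (suc j) w)
startsPair-lump j<i i<n [] [] = refl
startsPair-lump {n} {i} {j} j<i i<n (x ∷ w) (_ ∷ ls)
  rewrite lumpedPair-∷ (ℕₚ.<⇒≤ j<i) (ℕₚ.<⇒≤ i<n) x w ls | lumpedPair-∷ j<i (ℕₚ.<⇒≤ i<n) x w ls
        | lumpedPair-∷ (ℕₚ.<⇒≤ (ℕₚ.<-trans j<i (ℕₚ.n<1+n i))) i<n x w ls | lumpedPair-∷ (ℕₚ.m≤n⇒m≤1+n j<i) i<n x w ls
  with firstParticle n w
... | nothing = trans (𝟙-∧ (suc i ≡ᵇ x) false) (lem (𝟙 (suc i ≡ᵇ x)) (𝟙 ((i <ᵇ x) ∧ (x <ᵇ suc n))) (𝟙 ((suc i <ᵇ x) ∧ (x <ᵇ suc n))))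
  where
  lem : ∀ p u u′ → p *ℚ 0ℚ ≡ (u *ℚ 0ℚ -ℚ u *ℚ 0ℚ) -ℚ (u′ *ℚ 0ℚ -ℚ u′ *ℚ 0ℚ)
  lem = solve 3 (λ p u u′ → p :* con 0ℚ := (u :* con 0ℚ :- u :* con 0ℚ) :- (u′ :* con 0ℚ :- u′ :* con 0ℚ)) refl
    where open ℚ-Solver.+-*-Solver
... | just k
  rewrite classOf-≡2 j i n k | classOf-≡2 (suc j) i n k | classOf-≡2 j (suc i) n k | classOf-≡2 (suc j) (suc i) n k =
  begin
  𝟙 ((suc i ≡ᵇ x) ∧ (k ≡ᵇ suc j))
    ≡⟨ 𝟙-∧ (suc i ≡ᵇ x) (k ≡ᵇ suc j) ⟩
  𝟙 (suc i ≡ᵇ x) *ℚ 𝟙 (k ≡ᵇ suc j)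
    ≡⟨ cong (_*ℚ 𝟙 (k ≡ᵇ suc j)) (sym (exactly-third x i<n)) ⟩
  (u -ℚ u′) *ℚ 𝟙 (k ≡ᵇ suc j)
    ≡⟨ lem u u′ (𝟙 (k ≡ᵇ suc j)) ⟩
  u *ℚ 𝟙 (k ≡ᵇ suc j) -ℚ u′ *ℚ 𝟙 (k ≡ᵇ suc j)
    ≡⟨ cong₂ (λ p q → u *ℚ p -ℚ u′ *ℚ q) (sym (exactly-second k j<i)) (sym (exactly-second k (ℕₚ.m≤n⇒m≤1+n j<i))) ⟩
  u *ℚ (v j i -ℚ v (suc j) i) -ℚ u′ *ℚ (v j (suc i) -ℚ v (suc j) (suc i))
    ≡⟨ lem′ u u′ (v j i) (v (suc j) i) (v j (suc i)) (v (suc j) (suc i)) ⟩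
  (u *ℚ v j i -ℚ u *ℚ v (suc j) i) -ℚ (u′ *ℚ v j (suc i) -ℚ u′ *ℚ v (suc j) (suc i)) ∎
  where
  open ≡-Reasoning
  u u′ : ℚ
  u  = 𝟙 ((i <ᵇ x) ∧ (x <ᵇ suc n))
  u′ = 𝟙 ((suc i <ᵇ x) ∧ (x <ᵇ suc n))
  v : ℕ → ℕ → ℚ
  v a b = 𝟙 ((a <ᵇ k) ∧ (k <ᵇ suc b))
  lem : ∀ u u′ p → (u -ℚ u′) *ℚ p ≡ u *ℚ p -ℚ u′ *ℚ p
  lem = solve 3 (λ u u′ p → (u :- u′) :* p := u :* p :- u′ :* p) refl
    where open ℚ-Solver.+-*-Solver
  lem′ : ∀ u u′ p q r s → u *ℚ (p -ℚ q) -ℚ u′ *ℚ (r -ℚ s) ≡ (u *ℚ p -ℚ u *ℚ q) -ℚ (u′ *ℚ r -ℚ u′ *ℚ s)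
  lem′ = solve 6 (λ u u′ p q r s → u :* (p :- q) :- u′ :* (r :- s) := (u :* p :- u :* q) :- (u′ :* r :- u′ :* s)) refl
    where open ℚ-Solver.+-*-Solver

-- The threshold b = n leaves class 3 empty. This happens exactly in the case i = n of the theorem.
lumpedPair-top : ∀ {n a} → a ≤ n → ∀ w → All (Label (suc n)) w → lumpedPair n n a w ≡ 0ℚ
lumpedPair-top a≤n [] [] = refl
lumpedPair-top {n} {a} a≤n (x ∷ w) (_ ∷ ls) = trans (lumpedPair-∷ a≤n ℕₚ.≤-refl x w ls) (trans (cong (λ b → 𝟙 b *ℚ p) (lem x)) (ℚₚ.*-zeroˡ p))
  where
  p = 𝟙 (is 2 (Maybe.map (classOf a n n) (firstParticle n w)))
  lem : ∀ x → (n <ᵇ x) ∧ (x <ᵇ suc n) ≡ false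
  lem x with x ≤? n
  ... | yes x≤n rewrite <ᵇ-false x≤n = refl
  ... | no x≰n rewrite <ᵇ-true (ℕₚ.≰⇒> x≰n) | <ᵇ-false (ℕₚ.≰⇒> x≰n) = refl

expectedPairs : (n L : ℕ) → (List ℕ → ℚ) → ℕ → ℕ → ℚ
expectedPairs n L π b a = ∑ (configs n L) (λ η → π η *ℚ pairs L (startsPair 3 3 2) (map (classOf a b n) η))

pairs-lump : ∀ n L b a η → pairs L (startsPair 3 3 2) (map (classOf a b n) η) ≡ ∑ (upTo L) (λ r → lumpedPair n b a (rot r η))
pairs-lump n L b a η = ∑-cong (upTo L) (λ r → cong (λ w → 𝟙 (startsPair 3 3 2 w)) (sym (map-rot (classOf a b n) r η)))

expectedPairs-top : ∀ {n L a} π → a ≤ n → expectedPairs n L π n a ≡ 0ℚ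
expectedPairs-top {n} {L} {a} π a≤n = ∑-zero (configs n L) λ η η∈ → trans (cong (π η *ℚ_) (trans (pairs-lump n L n a η)
  (∑-zero (upTo L) (λ r _ → lumpedPair-top a≤n (rot r η) (All-rot r η (Config.labels (configs-∈ n L η∈))))))) (ℚₚ.*-zeroʳ (π η))

adjProb-expectedPairs : ∀ {n L i j} π → suc j ≤ i → suc i ≤ n → adjProb n L π (suc i) (suc j)
  ≡ (expectedPairs n L π i j -ℚ expectedPairs n L π i (suc j)) -ℚ (expectedPairs n L π (suc i) j -ℚ expectedPairs n L π (suc i) (suc j))
adjProb-expectedPairs {n} {L} {i} {j} π j<i i<n = begin
  ∑ (filterᵇ (adjacentᵇ n (suc i) (suc j)) (configs n L)) π
    ≡⟨ ∑-filter (adjacentᵇ n (suc i) (suc j)) (configs n L) π ⟩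
  ∑ (configs n L) (λ η → if adjacentᵇ n (suc i) (suc j) η then π η else 0ℚ)
    ≡⟨ ∑-cong-∈ (configs n L) (λ η η∈ → trans (if-𝟙 (adjacentᵇ n (suc i) (suc j) η) (π η)) (cong (π η *ℚ_) (pointwise η (configs-∈ n L η∈)))) ⟩
  ∑ (configs n L) (λ η → π η *ℚ ((P i j η -ℚ P i (suc j) η) -ℚ (P (suc i) j η -ℚ P (suc i) (suc j) η)))
    ≡⟨ ∑-cong (configs n L) (λ η → distrib (π η) (P i j η) (P i (suc j) η) (P (suc i) j η) (P (suc i) (suc j) η)) ⟩
  ∑ (configs n L) (λ η → (Q i j η -ℚ Q i (suc j) η) -ℚ (Q (suc i) j η -ℚ Q (suc i) (suc j) η))
    ≡⟨ ∑-4 (configs n L) (Q i j) (Q i (suc j)) (Q (suc i) j) (Q (suc i) (suc j)) ⟩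
  (expectedPairs n L π i j -ℚ expectedPairs n L π i (suc j)) -ℚ (expectedPairs n L π (suc i) j -ℚ expectedPairs n L π (suc i) (suc j)) ∎
  where
  open ≡-Reasoning
  P Q : ℕ → ℕ → List ℕ → ℚ
  P b a η = pairs L (startsPair 3 3 2) (map (classOf a b n) η)
  Q b a η = π η *ℚ P b a η
  if-𝟙 : ∀ b p → (if b then p else 0ℚ) ≡ p *ℚ 𝟙 b
  if-𝟙 true  p = sym (ℚₚ.*-identityʳ p)
  if-𝟙 false p = sym (ℚₚ.*-zeroʳ p)
  distrib : ∀ c p q r s → c *ℚ ((p -ℚ q) -ℚ (r -ℚ s)) ≡ (c *ℚ p -ℚ c *ℚ q) -ℚ (c *ℚ r -ℚ c *ℚ s)
  distrib = solve 5 (λ c p q r s → c :* ((p :- q) :- (r :- s)) := (c :* p :- c :* q) :- (c :* r :- c :* s)) refl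
    where open ℚ-Solver.+-*-Solver
  ∑-4 : {A : Set} (xs : List A) (p q r s : A → ℚ) →
        ∑ xs (λ x → (p x -ℚ q x) -ℚ (r x -ℚ s x)) ≡ (∑ xs p -ℚ ∑ xs q) -ℚ (∑ xs r -ℚ ∑ xs s)
  ∑-4 xs p q r s = trans (∑-- xs (λ x → p x -ℚ q x) (λ x → r x -ℚ s x)) (cong₂ _-ℚ_ (∑-- xs p q) (∑-- xs r s))
  pointwise : ∀ η → Config n L η → 𝟙 (adjacentᵇ n (suc i) (suc j) η) ≡ (P i j η -ℚ P i (suc j) η) -ℚ (P (suc i) j η -ℚ P (suc i) (suc j) η)
  pointwise η c = trans (adjacent-pairs (s≤s z≤n) i<n c)
    (trans (∑-cong (upTo L) (λ r → startsPair-lump j<i i<n (rot r η) (All-rot r η (Config.labels c))))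
    (trans (∑-4 (upTo L) (l i j) (l i (suc j)) (l (suc i) j) (l (suc i) (suc j)))
      (cong₂ _-ℚ_ (cong₂ _-ℚ_ (sym (pairs-lump n L i j η)) (sym (pairs-lump n L i (suc j) η)))
                  (cong₂ _-ℚ_ (sym (pairs-lump n L (suc i) j η)) (sym (pairs-lump n L (suc i) (suc j) η))))))
    where
    l : ℕ → ℕ → ℕ → ℚ
    l b a r = lumpedPair n b a (rot r η)

-- By rotation invariance the L rotations contribute equally.
expectedPairs-mlqs : ∀ {n l a b π} → IsStationary n (2 + l) π → a ≤ b → b ≤ n →
  ℕtoℚ (length (mlqs (2 + l) a b n)) *ℚ expectedPairs n (2 + l) π b a
  ≡ ℕtoℚ (2 + l) *ℚ ∑ (mlqs (2 + l) a b n) (λ w → 𝟙 (startsPair 3 3 2 w))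
expectedPairs-mlqs {n} {l} {a} {b} {π} stat a≤b b≤n = begin
  ℕtoℚ (length M) *ℚ expectedPairs n L π b a
    ≡⟨ lumped-law stat a≤b b≤n (pairs L (startsPair 3 3 2)) ⟩
  ∑ M (λ w → ∑ (upTo L) (λ r → g (rot r w)))
    ≡⟨ ∑-swap M (upTo L) (λ w r → g (rot r w)) ⟩
  ∑ (upTo L) (λ r → ∑ M (λ w → g (rot r w)))
    ≡⟨ ∑-cong (upTo L) (λ r → invariant r) ⟩
  ∑ (upTo L) (λ r → ∑ M g)
    ≡⟨ ∑-const (∑ M g) (upTo L) ⟩
  ∑ M g *ℚ ℕtoℚ (length (upTo L))
    ≡⟨ trans (ℚₚ.*-comm (∑ M g) _) (cong (λ k → ℕtoℚ k *ℚ ∑ M g) (Listₚ.length-upTo L)) ⟩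
  ℕtoℚ L *ℚ ∑ M g ∎
  where
  open ≡-Reasoning
  L = 2 + l
  M = mlqs L a b n
  g : List ℕ → ℚ
  g w = 𝟙 (startsPair 3 3 2 w)
  invariant : ∀ r → ∑ M (λ w → g (rot r w)) ≡ ∑ M g
  invariant zero    = refl
  invariant (suc r) = trans (∑-mlqs-rotL l a≤b b≤n (λ w → g (rot r w))) (invariant r)

-- From multiline queues to words

-- X, Y, Z stand for an occupied site of the first, second and third row.
data Letter : Set where
  X Y Z : Letter

-- Customers of row 1 waiting for row 2, and the queue in front of row 3.
Tandem : Set
Tandem = ℕ × State

act : Letter → Tandem → Tandem
act X (p , s)     = suc p , s
act Y (suc p , s) = p , arrive first s
act Y (zero , s)  = zero , arrive second s
act Z (p , s)     = p , proj₂ (serve s)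

run : Tandem → List Letter → Tandem
run s []      = s
run s (l ∷ w) = run (act l s) w

firstOut : Tandem → List Letter → Maybe ℕ
firstOut s []      = nothing
firstOut s (X ∷ w) = firstOut (act X s) w
firstOut s (Y ∷ w) = firstOut (act Y s) w
firstOut s (Z ∷ w) = just (proj₁ (serve (proj₂ s)))

idle : Tandem
idle = 0 , empty

isIdle : Tandem → Bool
isIdle (zero , zero , zero) = true
isIdle _                    = false

good : List Letter → Bool
good w = isIdle (run idle w) ∧ is 2 (firstOut idle w)

pre : Bool → Letter → List Letter → List Letter
pre true  l w = l ∷ w
pre false l w = w

-- X precedes Y and Y precedes Z because a customer joins the queue before the service of the same
-- site, as in `step`.
column : Bool → Bool → Bool → List Letter → List Letter
column b₁ b₂ b₃ w = pre b₁ X (pre b₂ Y (pre b₃ Z w))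

word : List Bool → List Bool → List Bool → List Letter
word (b₁ ∷ S₁) (b₂ ∷ S₂) (b₃ ∷ S₃) = column b₁ b₂ b₃ (word S₁ S₂ S₃)
word _         _         _         = []

arrivals₂ : List Bool → List ℕ
arrivals₂ = map (λ b → if b then 2 else 3)

arrivals₃ : ℕ → List Bool → List Bool → List ℕ
arrivals₃ p S₁ S₂ = map pred (departures (0 , p) (arrivals₂ S₁) S₂)

mlq : ℕ → List Bool → List Bool → List Bool → List ℕ
mlq L S₁ S₂ S₃ = queue (map pred (queue (map pred (queue (map pred (replicate L 4)) S₁)) S₂)) S₃

first-row-final : ∀ L S → final empty (map pred (replicate L 4)) S ≡ empty
first-row-final zero    S           = refl
first-row-final (suc L) []          = refl
first-row-final (suc L) (true ∷ S)  = first-row-final L S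
first-row-final (suc L) (false ∷ S) = first-row-final L S

first-row : ∀ L S → length S ≡ L → map pred (queue (map pred (replicate L 4)) S) ≡ arrivals₂ S
first-row L S len rewrite first-row-final L S = lem L S len
  where
  lem : ∀ L S → length S ≡ L → map pred (departures empty (map pred (replicate L 4)) S) ≡ arrivals₂ S
  lem zero    []          _ = refl
  lem (suc L) (true ∷ S)  e = cong (2 ∷_) (lem L S (ℕₚ.suc-injective e))
  lem (suc L) (false ∷ S) e = cong (3 ∷_) (lem L S (ℕₚ.suc-injective e))

tandem-final : ∀ p s S₁ S₂ S₃ → length S₁ ≡ length S₂ → length S₂ ≡ length S₃ →
  final (0 , p) (arrivals₂ S₁) S₂ ≡ (0 , proj₁ (run (p , s) (word S₁ S₂ S₃))) ×
  final s (arrivals₃ p S₁ S₂) S₃ ≡ proj₂ (run (p , s) (word S₁ S₂ S₃))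
tandem-final p s [] [] [] _ _ = refl , refl
tandem-final p s (true  ∷ S₁) (true  ∷ S₂) (true  ∷ S₃) e f = tandem-final _ _ S₁ S₂ S₃ (ℕₚ.suc-injective e) (ℕₚ.suc-injective f)
tandem-final p s (true  ∷ S₁) (true  ∷ S₂) (false ∷ S₃) e f = tandem-final _ _ S₁ S₂ S₃ (ℕₚ.suc-injective e) (ℕₚ.suc-injective f)
tandem-final p s (true  ∷ S₁) (false ∷ S₂) (true  ∷ S₃) e f = tandem-final _ _ S₁ S₂ S₃ (ℕₚ.suc-injective e) (ℕₚ.suc-injective f)
tandem-final p s (true  ∷ S₁) (false ∷ S₂) (false ∷ S₃) e f = tandem-final _ _ S₁ S₂ S₃ (ℕₚ.suc-injective e) (ℕₚ.suc-injective f)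
tandem-final zero    s (false ∷ S₁) (true  ∷ S₂) (true  ∷ S₃) e f = tandem-final _ _ S₁ S₂ S₃ (ℕₚ.suc-injective e) (ℕₚ.suc-injective f)
tandem-final zero    s (false ∷ S₁) (true  ∷ S₂) (false ∷ S₃) e f = tandem-final _ _ S₁ S₂ S₃ (ℕₚ.suc-injective e) (ℕₚ.suc-injective f)
tandem-final (suc p) s (false ∷ S₁) (true  ∷ S₂) (true  ∷ S₃) e f = tandem-final _ _ S₁ S₂ S₃ (ℕₚ.suc-injective e) (ℕₚ.suc-injective f)
tandem-final (suc p) s (false ∷ S₁) (true  ∷ S₂) (false ∷ S₃) e f = tandem-final _ _ S₁ S₂ S₃ (ℕₚ.suc-injective e) (ℕₚ.suc-injective f)
tandem-final zero    s (false ∷ S₁) (false ∷ S₂) (true  ∷ S₃) e f = tandem-final _ _ S₁ S₂ S₃ (ℕₚ.suc-injective e) (ℕₚ.suc-injective f)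
tandem-final zero    s (false ∷ S₁) (false ∷ S₂) (false ∷ S₃) e f = tandem-final _ _ S₁ S₂ S₃ (ℕₚ.suc-injective e) (ℕₚ.suc-injective f)
tandem-final (suc p) s (false ∷ S₁) (false ∷ S₂) (true  ∷ S₃) e f = tandem-final _ _ S₁ S₂ S₃ (ℕₚ.suc-injective e) (ℕₚ.suc-injective f)
tandem-final (suc p) s (false ∷ S₁) (false ∷ S₂) (false ∷ S₃) e f = tandem-final _ _ S₁ S₂ S₃ (ℕₚ.suc-injective e) (ℕₚ.suc-injective f)

serve-not-hole : ∀ s → (proj₁ (serve s) ≡ᵇ 4) ≡ false
serve-not-hole (suc q , r)    = refl
serve-not-hole (zero , suc r) = refl
serve-not-hole (zero , zero)  = refl

tandem-firstOut : ∀ p s S₁ S₂ S₃ → length S₁ ≡ length S₂ → length S₂ ≡ length S₃ →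
  firstParticle 3 (departures s (arrivals₃ p S₁ S₂) S₃) ≡ firstOut (p , s) (word S₁ S₂ S₃)
tandem-firstOut p s [] [] [] _ _ = refl
tandem-firstOut p s (true  ∷ S₁) (true  ∷ S₂) (true  ∷ S₃) e f rewrite serve-not-hole (arrive first s) = refl
tandem-firstOut p s (true  ∷ S₁) (true  ∷ S₂) (false ∷ S₃) e f = tandem-firstOut _ _ S₁ S₂ S₃ (ℕₚ.suc-injective e) (ℕₚ.suc-injective f)
tandem-firstOut p s (true  ∷ S₁) (false ∷ S₂) (true  ∷ S₃) e f rewrite serve-not-hole s = refl
tandem-firstOut p s (true  ∷ S₁) (false ∷ S₂) (false ∷ S₃) e f = tandem-firstOut _ _ S₁ S₂ S₃ (ℕₚ.suc-injective e) (ℕₚ.suc-injective f)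
tandem-firstOut zero    s (false ∷ S₁) (true  ∷ S₂) (true  ∷ S₃) e f rewrite serve-not-hole (arrive second s) = refl
tandem-firstOut zero    s (false ∷ S₁) (true  ∷ S₂) (false ∷ S₃) e f = tandem-firstOut _ _ S₁ S₂ S₃ (ℕₚ.suc-injective e) (ℕₚ.suc-injective f)
tandem-firstOut (suc p) s (false ∷ S₁) (true  ∷ S₂) (true  ∷ S₃) e f rewrite serve-not-hole (arrive first s) = refl
tandem-firstOut (suc p) s (false ∷ S₁) (true  ∷ S₂) (false ∷ S₃) e f = tandem-firstOut _ _ S₁ S₂ S₃ (ℕₚ.suc-injective e) (ℕₚ.suc-injective f)
tandem-firstOut p s (false ∷ S₁) (false ∷ S₂) (true  ∷ S₃) e f rewrite serve-not-hole s = refl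
tandem-firstOut p s (false ∷ S₁) (false ∷ S₂) (false ∷ S₃) e f = tandem-firstOut _ _ S₁ S₂ S₃ (ℕₚ.suc-injective e) (ℕₚ.suc-injective f)

firstOut-first : ∀ p q r w → is 2 (firstOut (p , suc q , r) w) ≡ false
firstOut-first p q r []            = refl
firstOut-first p q r (X ∷ w)       = firstOut-first (suc p) q r w
firstOut-first (suc p) q r (Y ∷ w) = firstOut-first p (suc q) r w
firstOut-first zero q r (Y ∷ w)    = firstOut-first zero q (suc r) w
firstOut-first p q r (Z ∷ w)       = refl

firstOut-waiting : ∀ p w → is 2 (firstOut (suc p , empty) w) ≡ false
firstOut-waiting p []      = refl
firstOut-waiting p (X ∷ w) = firstOut-waiting (suc p) w
firstOut-waiting p (Y ∷ w) = firstOut-first p 0 0 w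
firstOut-waiting p (Z ∷ w) = refl

onlyThird : Bool → Bool → Bool → Bool
onlyThird false false true = true
onlyThird _     _     _    = false

module _ (S₁ S₂ S₃ : List Bool) (e : length S₁ ≡ length S₂) (f : length S₂ ≡ length S₃) where

  private
    W = word S₁ S₂ S₃

  starts-from : ∀ p s b₁ b₂ b₃ →
    startsPair 3 3 2 (departures s (arrivals₃ p (b₁ ∷ S₁) (b₂ ∷ S₂)) (b₃ ∷ S₃))
    ≡ onlyThird b₁ b₂ b₃ ∧ (isIdle (p , s) ∧ is 2 (firstOut idle W))
  starts-from p s       true  true  false = refl
  starts-from p s       true  false false = refl
  starts-from zero s    false true  false = refl
  starts-from (suc p) s false true  false = refl
  starts-from p s       false false false = refl
  starts-from p s       true  true  true  = refl
  starts-from zero (zero , r)  false true true = refl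
  starts-from zero (suc q , r) false true true = refl
  starts-from (suc p) s        false true true = refl
  starts-from p (suc q , r)    true false true = refl
  starts-from p (zero , suc r) true false true = refl
  starts-from p (zero , zero)  true false true =
    trans (cong (is 2) (tandem-firstOut (suc p) empty S₁ S₂ S₃ e f)) (firstOut-waiting p W)
  starts-from zero (suc q , r)       false false true = refl
  starts-from (suc p) (suc q , r)    false false true = refl
  starts-from zero (zero , suc r)    false false true = refl
  starts-from (suc p) (zero , suc r) false false true = refl
  starts-from (suc p) (zero , zero)  false false true =
    trans (cong (is 2) (tandem-firstOut (suc p) empty S₁ S₂ S₃ e f)) (firstOut-waiting p W)
  starts-from zero (zero , zero)     false false true = cong (is 2) (tandem-firstOut 0 empty S₁ S₂ S₃ e f)

  mlq-starts : ∀ b₁ b₂ b₃ → startsPair 3 3 2 (mlq (suc (length S₁)) (b₁ ∷ S₁) (b₂ ∷ S₂) (b₃ ∷ S₃)) ≡ onlyThird b₁ b₂ b₃ ∧ good W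
  mlq-starts b₁ b₂ b₃ = begin
    startsPair 3 3 2 (mlq (suc (length S₁)) T₁ T₂ T₃)
      ≡⟨ cong (λ v → startsPair 3 3 2 (queue (map pred (queue v T₂)) T₃)) (first-row (suc (length S₁)) T₁ refl) ⟩
    startsPair 3 3 2 (queue (map pred (queue (arrivals₂ T₁) T₂)) T₃)
      ≡⟨ cong (λ s → startsPair 3 3 2 (queue (map pred (departures s (arrivals₂ T₁) T₂)) T₃)) (proj₁ (finals 0)) ⟩
    startsPair 3 3 2 (queue (arrivals₃ p T₁ T₂) T₃)
      ≡⟨ cong (λ s → startsPair 3 3 2 (departures s (arrivals₃ p T₁ T₂) T₃)) (proj₂ (finals p)) ⟩
    startsPair 3 3 2 (departures (proj₂ (run (p , empty) (word T₁ T₂ T₃))) (arrivals₃ p T₁ T₂) T₃)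
      ≡⟨ starts-from p (proj₂ (run (p , empty) (word T₁ T₂ T₃))) b₁ b₂ b₃ ⟩
    onlyThird b₁ b₂ b₃ ∧ (isIdle (p , proj₂ (run (p , empty) (word T₁ T₂ T₃))) ∧ is 2 (firstOut idle W))
      ≡⟨ reduce b₁ b₂ b₃ ⟩
    onlyThird b₁ b₂ b₃ ∧ good W ∎
    where
    open ≡-Reasoning
    T₁ = b₁ ∷ S₁
    T₂ = b₂ ∷ S₂
    T₃ = b₃ ∷ S₃
    -- Row 3 is fed by a row 2 that already begins in its cyclic starting state `p`. The event
    -- forces p = 0, so that both rows may be run from idle; the leading Z does nothing to an idle
    -- tandem.
    p = proj₁ (run idle (word T₁ T₂ T₃))
    finals : ∀ p → _
    finals p = tandem-final p empty T₁ T₂ T₃ (cong suc e) (cong suc f)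
    reduce : ∀ b₁ b₂ b₃ → let p = proj₁ (run idle (column b₁ b₂ b₃ W)) in
      onlyThird b₁ b₂ b₃ ∧ (isIdle (p , proj₂ (run (p , empty) (column b₁ b₂ b₃ W))) ∧ is 2 (firstOut idle W)) ≡ onlyThird b₁ b₂ b₃ ∧ good W
    reduce false false true  with run idle W in eq
    ... | zero , s rewrite eq = refl
    ... | suc p , s = refl
    reduce false false false = refl
    reduce false true  _     = refl
    reduce true  _     _     = refl

-- Sums over three rows as counts of words

∑³ : ℕ → (List Bool → List Bool → List Bool → ℚ) → ℚ
∑³ L F = ∑ (allBits L) (λ S₁ → ∑ (allBits L) (λ S₂ → ∑ (allBits L) (λ S₃ → F S₁ S₂ S₃)))

∑³-cong : ∀ L {F G : List Bool → List Bool → List Bool → ℚ} →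
  (∀ S₁ S₂ S₃ → length S₁ ≡ L → length S₂ ≡ L → length S₃ ≡ L → F S₁ S₂ S₃ ≡ G S₁ S₂ S₃) → ∑³ L F ≡ ∑³ L G
∑³-cong L e = ∑-cong-∈ (allBits L) λ S₁ p₁ → ∑-cong-∈ (allBits L) λ S₂ p₂ → ∑-cong-∈ (allBits L) λ S₃ p₃ →
  e S₁ S₂ S₃ (allBits-∈ L p₁) (allBits-∈ L p₂) (allBits-∈ L p₃)

sum₈ : (Bool → Bool → Bool → ℚ) → ℚ
sum₈ c = ((c false false false +ℚ c false false true) +ℚ (c false true false +ℚ c false true true))
      +ℚ ((c true false false +ℚ c true false true) +ℚ (c true true false +ℚ c true true true))

∑³-suc : ∀ L (F : List Bool → List Bool → List Bool → ℚ) →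
  ∑³ (suc L) F ≡ sum₈ (λ b₁ b₂ b₃ → ∑³ L (λ S₁ S₂ S₃ → F (b₁ ∷ S₁) (b₂ ∷ S₂) (b₃ ∷ S₃)))
∑³-suc L F = trans (∑-allBits-suc L (λ S₁ → ∑ B (λ S₂ → ∑ B (λ S₃ → F S₁ S₂ S₃)))) (cong₂ _+ℚ_ (split₂ false) (split₂ true))
  where
  B = allBits (suc L)
  A = allBits L
  split₃ : ∀ b₁ b₂ → ∑ A (λ S₁ → ∑ A (λ S₂ → ∑ B (λ S₃ → F (b₁ ∷ S₁) (b₂ ∷ S₂) S₃)))
    ≡ ∑³ L (λ S₁ S₂ S₃ → F (b₁ ∷ S₁) (b₂ ∷ S₂) (false ∷ S₃)) +ℚ ∑³ L (λ S₁ S₂ S₃ → F (b₁ ∷ S₁) (b₂ ∷ S₂) (true ∷ S₃))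
  split₃ b₁ b₂ = trans (∑-cong A λ S₁ → trans (∑-cong A λ S₂ → ∑-allBits-suc L (λ S₃ → F (b₁ ∷ S₁) (b₂ ∷ S₂) S₃))
      (∑-+ A (λ S₂ → G false S₁ S₂) (λ S₂ → G true S₁ S₂)))
    (∑-+ A (λ S₁ → ∑ A (G false S₁)) (λ S₁ → ∑ A (G true S₁)))
    where
    G : Bool → List Bool → List Bool → ℚ
    G b S₁ S₂ = ∑ A (λ S₃ → F (b₁ ∷ S₁) (b₂ ∷ S₂) (b ∷ S₃))
  split₂ : ∀ b₁ → ∑ A (λ S₁ → ∑ B (λ S₂ → ∑ B (λ S₃ → F (b₁ ∷ S₁) S₂ S₃))) ≡ _
  split₂ b₁ = trans (∑-cong A λ S₁ → ∑-allBits-suc L (λ S₂ → ∑ B (λ S₃ → F (b₁ ∷ S₁) S₂ S₃)))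
    (trans (∑-+ A (G false) (G true)) (cong₂ _+ℚ_ (split₃ b₁ false) (split₃ b₁ true)))
    where
    G : Bool → List Bool → ℚ
    G b S₁ = ∑ A (λ S₂ → ∑ B (λ S₃ → F (b₁ ∷ S₁) (b ∷ S₂) S₃))

cnt₈ : (Bool → Bool → Bool → ℕ) → ℕ
cnt₈ c = ((c false false false + c false false true) + (c false true false + c false true true))
       + ((c true false false + c true false true) + (c true true false + c true true true))

columnsCount : ℕ → (List Letter → ℕ) → ℕ
columnsCount zero    φ = φ []
columnsCount (suc L) φ = cnt₈ (λ b₁ b₂ b₃ → columnsCount L (λ w → φ (column b₁ b₂ b₃ w)))

sum₈-ℕ : ∀ c → sum₈ (λ b₁ b₂ b₃ → ℕtoℚ (c b₁ b₂ b₃)) ≡ ℕtoℚ (cnt₈ c)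
sum₈-ℕ c = sym (trans (ℕtoℚ-+ (half false) (half true)) (cong₂ _+ℚ_ (halves false) (halves true)))
  where
  half : Bool → ℕ
  half b = (c b false false + c b false true) + (c b true false + c b true true)
  halves : ∀ b → ℕtoℚ (half b) ≡ (ℕtoℚ (c b false false) +ℚ ℕtoℚ (c b false true)) +ℚ (ℕtoℚ (c b true false) +ℚ ℕtoℚ (c b true true))
  halves b = trans (ℕtoℚ-+ (c b false false + c b false true) (c b true false + c b true true))
    (cong₂ _+ℚ_ (ℕtoℚ-+ (c b false false) (c b false true)) (ℕtoℚ-+ (c b true false) (c b true true)))

sum₈-cong : ∀ {c d : Bool → Bool → Bool → ℚ} → (∀ b₁ b₂ b₃ → c b₁ b₂ b₃ ≡ d b₁ b₂ b₃) → sum₈ c ≡ sum₈ d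
sum₈-cong e = cong₂ _+ℚ_
  (cong₂ _+ℚ_ (cong₂ _+ℚ_ (e _ _ _) (e _ _ _)) (cong₂ _+ℚ_ (e _ _ _) (e _ _ _)))
  (cong₂ _+ℚ_ (cong₂ _+ℚ_ (e _ _ _) (e _ _ _)) (cong₂ _+ℚ_ (e _ _ _) (e _ _ _)))

∑³-columnsCount : ∀ L φ → ∑³ L (λ S₁ S₂ S₃ → ℕtoℚ (φ (word S₁ S₂ S₃))) ≡ ℕtoℚ (columnsCount L φ)
∑³-columnsCount zero    φ = trans (ℚₚ.+-identityʳ _) (trans (ℚₚ.+-identityʳ _) (ℚₚ.+-identityʳ _))
∑³-columnsCount (suc L) φ = trans (∑³-suc L (λ S₁ S₂ S₃ → ℕtoℚ (φ (word S₁ S₂ S₃))))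
  (trans (sum₈-cong (λ b₁ b₂ b₃ → ∑³-columnsCount L (λ w → φ (column b₁ b₂ b₃ w))))
         (sum₈-ℕ (λ b₁ b₂ b₃ → columnsCount L (λ w → φ (column b₁ b₂ b₃ w)))))

#X #Y #Z : List Letter → ℕ
#X []      = 0
#X (X ∷ w) = suc (#X w)
#X (Y ∷ w) = #X w
#X (Z ∷ w) = #X w
#Y []      = 0
#Y (X ∷ w) = #Y w
#Y (Y ∷ w) = suc (#Y w)
#Y (Z ∷ w) = #Y w
#Z []      = 0
#Z (X ∷ w) = #Z w
#Z (Y ∷ w) = #Z w
#Z (Z ∷ w) = suc (#Z w)

has : ℕ → ℕ → ℕ → List Letter → Bool
has a b c w = (#X w ≡ᵇ a) ∧ ((#Y w ≡ᵇ b) ∧ (#Z w ≡ᵇ c))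

#-word : ∀ S₁ S₂ S₃ → length S₁ ≡ length S₂ → length S₂ ≡ length S₃ →
  #X (word S₁ S₂ S₃) ≡ cntTrue S₁ × #Y (word S₁ S₂ S₃) ≡ cntTrue S₂ × #Z (word S₁ S₂ S₃) ≡ cntTrue S₃
#-word [] [] [] _ _ = refl , refl , refl
#-word (b₁ ∷ S₁) (b₂ ∷ S₂) (b₃ ∷ S₃) e f with #-word S₁ S₂ S₃ (ℕₚ.suc-injective e) (ℕₚ.suc-injective f)
#-word (false ∷ S₁) (false ∷ S₂) (false ∷ S₃) e f | i , j , k = i , j , k
#-word (false ∷ S₁) (false ∷ S₂) (true  ∷ S₃) e f | i , j , k = i , j , cong suc k
#-word (false ∷ S₁) (true  ∷ S₂) (false ∷ S₃) e f | i , j , k = i , cong suc j , k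
#-word (false ∷ S₁) (true  ∷ S₂) (true  ∷ S₃) e f | i , j , k = i , cong suc j , cong suc k
#-word (true  ∷ S₁) (false ∷ S₂) (false ∷ S₃) e f | i , j , k = cong suc i , j , k
#-word (true  ∷ S₁) (false ∷ S₂) (true  ∷ S₃) e f | i , j , k = cong suc i , j , cong suc k
#-word (true  ∷ S₁) (true  ∷ S₂) (false ∷ S₃) e f | i , j , k = cong suc i , cong suc j , k
#-word (true  ∷ S₁) (true  ∷ S₂) (true  ∷ S₃) e f | i , j , k = cong suc i , cong suc j , cong suc k

sized : ℕ → ℕ → ℕ → List Bool → List Bool → List Bool → Bool
sized a b c S₁ S₂ S₃ = (cntTrue S₁ ≡ᵇ a) ∧ ((cntTrue S₂ ≡ᵇ b) ∧ (cntTrue S₃ ≡ᵇ c))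

has-word : ∀ a b c S₁ S₂ S₃ → length S₁ ≡ length S₂ → length S₂ ≡ length S₃ → sized a b c S₁ S₂ S₃ ≡ has a b c (word S₁ S₂ S₃)
has-word a b c S₁ S₂ S₃ e f with #-word S₁ S₂ S₃ e f
... | i , j , k rewrite i | j | k = refl

∑-mlqs : ∀ L a b n (g : List ℕ → ℚ) → ∑ (mlqs L a b n) g ≡ ∑³ L (λ S₁ S₂ S₃ → if sized a b n S₁ S₂ S₃ then g (mlq L S₁ S₂ S₃) else 0ℚ)
∑-mlqs L a b n g = begin
  ∑ (mlqs L a b n) g
    ≡⟨ ∑-nextRow L n R₂ g ⟩
  ∑ R₂ (λ w → Λ L n g (map pred w))
    ≡⟨ ∑-nextRow L b R₁ (λ w → Λ L n g (map pred w)) ⟩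
  ∑ R₁ (λ w → Λ L b (λ w → Λ L n g (map pred w)) (map pred w))
    ≡⟨ ∑-nextRow L a (rows₀ L) (λ w → Λ L b (λ w → Λ L n g (map pred w)) (map pred w)) ⟩
  ∑ (bits L a) K₁ +ℚ 0ℚ
    ≡⟨ ℚₚ.+-identityʳ (∑ (bits L a) K₁) ⟩
  ∑ (bits L a) K₁
    ≡⟨ ∑-filter (λ S → cntTrue S ≡ᵇ a) (allBits L) K₁ ⟩
  ∑ (allBits L) (λ S₁ → if cntTrue S₁ ≡ᵇ a then K₁ S₁ else 0ℚ)
    ≡⟨ ∑-cong (allBits L) (λ S₁ → trans (cong (λ p → if cntTrue S₁ ≡ᵇ a then p else 0ℚ) (row₂ S₁))
         (trans (sym (∑-if (cntTrue S₁ ≡ᵇ a) (allBits L) (λ S₂ → ∑ (allBits L) (K₃ S₁ S₂))))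
           (∑-cong (allBits L) (λ S₂ → trans (sym (∑-if (cntTrue S₁ ≡ᵇ a) (allBits L) (K₃ S₁ S₂)))
             (∑-cong (allBits L) (λ S₃ → sym (if-∧ (cntTrue S₁ ≡ᵇ a) ((cntTrue S₂ ≡ᵇ b) ∧ (cntTrue S₃ ≡ᵇ n)) (g (mlq L S₁ S₂ S₃))))))))) ⟩
  ∑³ L (λ S₁ S₂ S₃ → if sized a b n S₁ S₂ S₃ then g (mlq L S₁ S₂ S₃) else 0ℚ) ∎
  where
  open ≡-Reasoning
  R₁ = nextRow L a (rows₀ L)
  R₂ = nextRow L b R₁
  K₂ : List Bool → List Bool → ℚ
  K₂ S₁ S₂ = ∑ (bits L n) (λ S₃ → g (mlq L S₁ S₂ S₃))
  K₁ : List Bool → ℚ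
  K₁ S₁ = ∑ (bits L b) (K₂ S₁)
  K₃ : List Bool → List Bool → List Bool → ℚ
  K₃ S₁ S₂ S₃ = if (cntTrue S₂ ≡ᵇ b) ∧ (cntTrue S₃ ≡ᵇ n) then g (mlq L S₁ S₂ S₃) else 0ℚ
  row₂ : ∀ S₁ → K₁ S₁ ≡ ∑ (allBits L) (λ S₂ → ∑ (allBits L) (K₃ S₁ S₂))
  row₂ S₁ = trans (∑-filter (λ S → cntTrue S ≡ᵇ b) (allBits L) (K₂ S₁)) (∑-cong (allBits L) (λ S₂ →
    trans (cong (λ p → if cntTrue S₂ ≡ᵇ b then p else 0ℚ) (∑-filter (λ S → cntTrue S ≡ᵇ n) (allBits L) (λ S₃ → g (mlq L S₁ S₂ S₃))))
      (trans (sym (∑-if (cntTrue S₂ ≡ᵇ b) (allBits L) (λ S₃ → if cntTrue S₃ ≡ᵇ n then g (mlq L S₁ S₂ S₃) else 0ℚ)))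
        (∑-cong (allBits L) (λ S₃ → sym (if-∧ (cntTrue S₂ ≡ᵇ b) (cntTrue S₃ ≡ᵇ n) (g (mlq L S₁ S₂ S₃))))))))

𝟏 : Bool → ℕ
𝟏 b = if b then 1 else 0

if-𝟙-𝟏 : ∀ b c → (if b then 𝟙 c else 0ℚ) ≡ ℕtoℚ (𝟏 (b ∧ c))
if-𝟙-𝟏 true  true  = refl
if-𝟙-𝟏 true  false = refl
if-𝟙-𝟏 false c     = refl

mlqs-length : ∀ L a b n → length (mlqs L a b n) ≡ columnsCount L (λ w → 𝟏 (has a b n w))
mlqs-length L a b n = ℕtoℚ-injective (begin
  ℕtoℚ (length (mlqs L a b n))
    ≡⟨ sym (trans (∑-const 1ℚ (mlqs L a b n)) (ℚₚ.*-identityˡ _)) ⟩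
  ∑ (mlqs L a b n) (λ _ → 1ℚ)
    ≡⟨ ∑-mlqs L a b n (λ _ → 1ℚ) ⟩
  ∑³ L (λ S₁ S₂ S₃ → if sized a b n S₁ S₂ S₃ then 1ℚ else 0ℚ)
    ≡⟨ ∑³-cong L (λ S₁ S₂ S₃ e f g → trans (cong 𝟙 (has-word a b n S₁ S₂ S₃ (trans e (sym f)) (trans f (sym g)))) (lem (has a b n (word S₁ S₂ S₃)))) ⟩
  ∑³ L (λ S₁ S₂ S₃ → ℕtoℚ (𝟏 (has a b n (word S₁ S₂ S₃))))
    ≡⟨ ∑³-columnsCount L (λ w → 𝟏 (has a b n w)) ⟩
  ℕtoℚ (columnsCount L (λ w → 𝟏 (has a b n w))) ∎)
  where
  open ≡-Reasoning
  lem : ∀ b → 𝟙 b ≡ ℕtoℚ (𝟏 b)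
  lem true  = refl
  lem false = refl
  ℕtoℚ-injective : ∀ {i j} → ℕtoℚ i ≡ ℕtoℚ j → i ≡ j
  ℕtoℚ-injective {i} {j} e with ℕₚ.<-cmp i j
  ... | Tri.tri< i<j _ _ = contradiction (ℕtoℚ-mono-< i<j) (ℚₚ.<-irrefl e)
  ... | Tri.tri≈ _ i≡j _ = i≡j
  ... | Tri.tri> _ _ j<i = contradiction (ℕtoℚ-mono-< j<i) (ℚₚ.<-irrefl (sym e))

-- Site 0 must be occupied in row 3 only. Removing it leaves one column and one Z fewer, and `good`
-- is the condition on the remaining word.
mlqs-starts : ∀ L a b n → ∑ (mlqs (suc L) a b (suc n)) (λ w → 𝟙 (startsPair 3 3 2 w))
                          ≡ ℕtoℚ (columnsCount L (λ w → 𝟏 (has a b n w ∧ good w)))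
mlqs-starts L a b n = begin
  ∑ (mlqs (suc L) a b (suc n)) (λ w → 𝟙 (startsPair 3 3 2 w))
    ≡⟨ ∑-mlqs (suc L) a b (suc n) (λ w → 𝟙 (startsPair 3 3 2 w)) ⟩
  ∑³ (suc L) F
    ≡⟨ ∑³-suc L F ⟩
  sum₈ (λ b₁ b₂ b₃ → ∑³ L (λ S₁ S₂ S₃ → F (b₁ ∷ S₁) (b₂ ∷ S₂) (b₃ ∷ S₃)))
    ≡⟨ sum₈-cong value ⟩
  sum₈ (λ b₁ b₂ b₃ → if onlyThird b₁ b₂ b₃ then N₀ else 0ℚ)
    ≡⟨ solve 1 (λ t → ((con 0ℚ :+ t) :+ (con 0ℚ :+ con 0ℚ)) :+ ((con 0ℚ :+ con 0ℚ) :+ (con 0ℚ :+ con 0ℚ)) := t) refl N₀ ⟩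
  N₀ ∎
  where
  open ≡-Reasoning
  open ℚ-Solver.+-*-Solver using (solve; con; _:+_; _:=_)
  F : List Bool → List Bool → List Bool → ℚ
  F S₁ S₂ S₃ = if sized a b (suc n) S₁ S₂ S₃ then 𝟙 (startsPair 3 3 2 (mlq (suc L) S₁ S₂ S₃)) else 0ℚ
  N₀ = ℕtoℚ (columnsCount L (λ w → 𝟏 (has a b n w ∧ good w)))
  if-const : ∀ b → (if b then 0ℚ else 0ℚ) ≡ 0ℚ
  if-const true  = refl
  if-const false = refl
  starts : ∀ b₁ b₂ b₃ S₁ S₂ S₃ → length S₁ ≡ L → length S₂ ≡ L → length S₃ ≡ L → F (b₁ ∷ S₁) (b₂ ∷ S₂) (b₃ ∷ S₃)
    ≡ (if sized a b (suc n) (b₁ ∷ S₁) (b₂ ∷ S₂) (b₃ ∷ S₃) then 𝟙 (onlyThird b₁ b₂ b₃ ∧ good (word S₁ S₂ S₃)) else 0ℚ)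
  starts b₁ b₂ b₃ S₁ S₂ S₃ refl f g = cong (λ p → if sized a b (suc n) (b₁ ∷ S₁) (b₂ ∷ S₂) (b₃ ∷ S₃) then 𝟙 p else 0ℚ)
    (mlq-starts S₁ S₂ S₃ (sym f) (trans f (sym g)) b₁ b₂ b₃)
  none′ : ∀ b₁ b₂ b₃ → onlyThird b₁ b₂ b₃ ≡ false → ∑³ L (λ S₁ S₂ S₃ → F (b₁ ∷ S₁) (b₂ ∷ S₂) (b₃ ∷ S₃)) ≡ 0ℚ
  none′ b₁ b₂ b₃ e = trans (∑³-cong L (λ S₁ S₂ S₃ f g h → trans (starts b₁ b₂ b₃ S₁ S₂ S₃ f g h)
      (trans (cong (λ o → if sized a b (suc n) (b₁ ∷ S₁) (b₂ ∷ S₂) (b₃ ∷ S₃) then 𝟙 (o ∧ good (word S₁ S₂ S₃)) else 0ℚ) e)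
        (if-const (sized a b (suc n) (b₁ ∷ S₁) (b₂ ∷ S₂) (b₃ ∷ S₃))))))
    (trans (∑-cong (allBits L) (λ S₁ → trans (∑-cong (allBits L) (λ S₂ → ∑-0 (allBits L))) (∑-0 (allBits L)))) (∑-0 (allBits L)))
  value : ∀ b₁ b₂ b₃ → ∑³ L (λ S₁ S₂ S₃ → F (b₁ ∷ S₁) (b₂ ∷ S₂) (b₃ ∷ S₃)) ≡ (if onlyThird b₁ b₂ b₃ then N₀ else 0ℚ)
  value false false true  = trans (∑³-cong L (λ S₁ S₂ S₃ f g h → trans (starts false false true S₁ S₂ S₃ f g h)
      (trans (if-𝟙-𝟏 (sized a b n S₁ S₂ S₃) (good (word S₁ S₂ S₃)))
        (cong (λ o → ℕtoℚ (𝟏 (o ∧ good (word S₁ S₂ S₃)))) (has-word a b n S₁ S₂ S₃ (trans f (sym g)) (trans g (sym h)))))))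
    (∑³-columnsCount L (λ w → 𝟏 (has a b n w ∧ good w)))
  value false false false = none′ false false false refl
  value false true  true  = none′ false true true refl
  value false true  false = none′ false true false refl
  value true  false true  = none′ true false true refl
  value true  false false = none′ true false false refl
  value true  true  true  = none′ true true true refl
  value true  true  false = none′ true true false refl

-- Asymptotics in the number of columns

wordsCount : ℕ → (List Letter → ℕ) → ℕ
wordsCount zero    φ = φ []
wordsCount (suc N) φ = wordsCount N (λ w → φ (X ∷ w)) + (wordsCount N (λ w → φ (Y ∷ w)) + wordsCount N (λ w → φ (Z ∷ w)))

wordsCount-∷ : ∀ N φ l → wordsCount N (λ w → φ (l ∷ w)) ≤ wordsCount (suc N) φ
wordsCount-∷ N φ X = ℕₚ.m≤m+n _ _
wordsCount-∷ N φ Y = ℕₚ.≤-trans (ℕₚ.m≤m+n _ _) (ℕₚ.m≤n+m _ (wordsCount N (λ w → φ (X ∷ w))))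
wordsCount-∷ N φ Z = ℕₚ.≤-trans (ℕₚ.m≤n+m _ (wordsCount N (λ w → φ (Y ∷ w)))) (ℕₚ.m≤n+m _ (wordsCount N (λ w → φ (X ∷ w))))

OfLength : ℕ → (List Letter → ℕ) → Set
OfLength N φ = ∀ w → length w ≢ N → φ w ≡ 0

OfLength-∷ : ∀ {N φ} l → OfLength (suc N) φ → OfLength N (λ w → φ (l ∷ w))
OfLength-∷ l ofL w ne = ofL (l ∷ w) (λ e → ne (ℕₚ.suc-injective e))

columnsCount-zero : ∀ L φ → (∀ w → φ w ≡ 0) → columnsCount L φ ≡ 0
columnsCount-zero zero    φ e = e []
columnsCount-zero (suc L) φ e
  rewrite columnsCount-zero L (λ w → φ (column false false false w)) (λ w → e _)
        | columnsCount-zero L (λ w → φ (column false false true w))  (λ w → e _)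
        | columnsCount-zero L (λ w → φ (column false true false w))  (λ w → e _)
        | columnsCount-zero L (λ w → φ (column false true true w))   (λ w → e _)
        | columnsCount-zero L (λ w → φ (column true false false w))  (λ w → e _)
        | columnsCount-zero L (λ w → φ (column true false true w))   (λ w → e _)
        | columnsCount-zero L (λ w → φ (column true true false w))   (λ w → e _)
        | columnsCount-zero L (λ w → φ (column true true true w))    (λ w → e _) = refl

-- Pascal's recursion runs parallel to the recursion of `columnsCount` over the columns.
binom : ℕ → ℕ → ℕ
binom L       zero    = 1
binom zero    (suc N) = 0
binom (suc L) (suc N) = binom L N + binom L (suc N)

binom-absorb : ∀ L N → suc N * binom (suc L) (suc N) ≡ suc L * binom L N
binom-absorb zero    zero    = refl
binom-absorb zero    (suc N) = ℕₚ.*-zeroʳ N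
binom-absorb (suc L) zero    = cong suc (binom-absorb L zero)
binom-absorb (suc L) (suc N) = begin
  suc (suc N) * (B + C′)                ≡⟨ lem N B C′ ⟩
  B + suc N * B + suc (suc N) * C′      ≡⟨ cong₂ (λ i j → B + i + j) (binom-absorb L N) (binom-absorb L (suc N)) ⟩
  B + suc L * binom L N + suc L * binom L (suc N) ≡⟨ lem′ (suc L) B (binom L N) (binom L (suc N)) ⟩
  suc (suc L) * B ∎
  where
  open ≡-Reasoning
  B  = binom (suc L) (suc N)
  C′ = binom (suc L) (suc (suc N))
  lem : ∀ N B C → suc (suc N) * (B + C) ≡ B + suc N * B + suc (suc N) * C
  lem = ℕ-Ring.solve-∀
  lem′ : ∀ m B i j → B + m * i + m * j ≡ B + m * (i + j)
  lem′ = ℕ-Ring.solve-∀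

binom-upper : ∀ M N → N ! * binom M N ≤ M ^ N
binom-upper M       zero    = ℕₚ.≤-refl
binom-upper zero    (suc N) = ℕₚ.≤-reflexive (ℕₚ.*-zeroʳ (suc N !))
binom-upper (suc M) (suc N) = begin
  suc N * N ! * binom (suc M) (suc N)     ≡⟨ lem (suc N) (N !) (binom (suc M) (suc N)) ⟩
  N ! * (suc N * binom (suc M) (suc N))   ≡⟨ cong (N ! *_) (binom-absorb M N) ⟩
  N ! * (suc M * binom M N)               ≡⟨ lem′ (N !) (suc M) (binom M N) ⟩
  suc M * (N ! * binom M N)               ≤⟨ ℕₚ.*-monoʳ-≤ (suc M) (binom-upper M N) ⟩
  suc M * M ^ N                           ≤⟨ ℕₚ.*-monoʳ-≤ (suc M) (ℕₚ.^-monoˡ-≤ N (ℕₚ.n≤1+n M)) ⟩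
  suc M * suc M ^ N ∎
  where
  open ℕₚ.≤-Reasoning
  lem : ∀ i j k → i * j * k ≡ j * (i * k)
  lem = ℕ-Ring.solve-∀
  lem′ : ∀ i j k → i * (j * k) ≡ j * (i * k)
  lem′ = ℕ-Ring.solve-∀

binom-lower : ∀ A N → A ^ N ≤ N ! * binom (N + A) N
binom-lower A zero    = ℕₚ.≤-refl
binom-lower A (suc N) = begin
  A * A ^ N                                   ≤⟨ ℕₚ.*-mono-≤ (ℕₚ.m≤n+m A (suc N)) (binom-lower A N) ⟩
  (suc N + A) * (N ! * binom (N + A) N)       ≡⟨ lem (suc N + A) (N !) (binom (N + A) N) ⟩
  N ! * ((suc N + A) * binom (N + A) N)       ≡⟨ cong (N ! *_) (sym (binom-absorb (N + A) N)) ⟩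
  N ! * (suc N * binom (suc N + A) (suc N))   ≡⟨ lem′ (N !) (suc N) (binom (suc N + A) (suc N)) ⟩
  suc N * N ! * binom (suc N + A) (suc N) ∎
  where
  open ℕₚ.≤-Reasoning
  lem : ∀ i j k → i * (j * k) ≡ j * (i * k)
  lem = ℕ-Ring.solve-∀
  lem′ : ∀ i j k → i * (j * k) ≡ j * i * k
  lem′ = ℕ-Ring.solve-∀

-- An upper bound for the weakly increasing placements of N letters in L columns. Their exact number
-- is the binomial coefficient of L + N - 1 over N; the shift avoids truncated subtraction and is
-- invisible in the limit.
multichoose : ℕ → ℕ → ℕ
multichoose L N = binom (L + N) N

multichoose-suc : ∀ L N → multichoose (suc L) (suc N) ≡ multichoose (suc L) N + multichoose L (suc N)
multichoose-suc L N = cong (λ k → binom k N + binom (L + suc N) (suc N)) (ℕₚ.+-suc L N)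

multichoose-mono : ∀ L N → multichoose L N ≤ multichoose (suc L) N
multichoose-mono L zero    = ℕₚ.≤-refl
multichoose-mono L (suc N) = subst (multichoose L (suc N) ≤_) (sym (multichoose-suc L N)) (ℕₚ.m≤n+m _ _)

-- Only columns with at most one letter are kept: N of the L columns are chosen, and the word is
-- spread over them.
columnsCount-lower : ∀ L N φ → binom L N * wordsCount N φ ≤ columnsCount L φ
columnsCount-lower zero    zero    φ = ℕₚ.≤-reflexive (ℕₚ.+-identityʳ (φ []))
columnsCount-lower zero    (suc N) φ = z≤n
columnsCount-lower (suc L) zero    φ = ℕₚ.≤-trans (columnsCount-lower L zero φ)
  (ℕₚ.≤-trans (ℕₚ.m≤m+n _ _) (ℕₚ.≤-trans (ℕₚ.m≤m+n _ _) (ℕₚ.m≤m+n _ _)))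
columnsCount-lower (suc L) (suc N) φ = begin
  (binom L N + binom L (suc N)) * (x + (y + z))
    ≡⟨ lem (binom L N) (binom L (suc N)) x y z ⟩
  binom L (suc N) * (x + (y + z)) + (binom L N * x + (binom L N * y + binom L N * z))
    ≤⟨ ℕₚ.+-mono-≤ (columnsCount-lower L (suc N) φ) (ℕₚ.+-mono-≤ (columnsCount-lower L N (λ w → φ (X ∷ w)))
         (ℕₚ.+-mono-≤ (columnsCount-lower L N (λ w → φ (Y ∷ w))) (columnsCount-lower L N (λ w → φ (Z ∷ w))))) ⟩
  c false false false + (c true false false + (c false true false + c false false true))
    ≤⟨ ℕₚ.m≤m+n _ (c false true true + c true false true + c true true false + c true true true) ⟩
  c false false false + (c true false false + (c false true false + c false false true))
    + (c false true true + c true false true + c true true false + c true true true)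
    ≡⟨ lem′ (c false false false) (c true false false) (c false true false) (c false false true)
            (c false true true) (c true false true) (c true true false) (c true true true) ⟩
  cnt₈ c ∎
  where
  open ℕₚ.≤-Reasoning
  x = wordsCount N (λ w → φ (X ∷ w))
  y = wordsCount N (λ w → φ (Y ∷ w))
  z = wordsCount N (λ w → φ (Z ∷ w))
  c : Bool → Bool → Bool → ℕ
  c b₁ b₂ b₃ = columnsCount L (λ w → φ (column b₁ b₂ b₃ w))
  lem : ∀ i j x y z → (i + j) * (x + (y + z)) ≡ j * (x + (y + z)) + (i * x + (i * y + i * z))
  lem = ℕ-Ring.solve-∀
  lem′ : ∀ a b c d e f g h → a + (b + (c + d)) + (e + f + g + h) ≡ ((a + d) + (c + e)) + ((b + f) + (g + h))
  lem′ = ℕ-Ring.solve-∀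

-- A column with k letters consumes a prefix of length k, and the prefixes that occur are distinct
-- words. So the columns with k letters contribute at most `multichoose L (N ∸ k)` times the number
-- of all words. These bounds for k = 0, 1, 2, 3 add up to at most the bound for one more column.
columnsCount-upper : ∀ L N φ → OfLength N φ → columnsCount L φ ≤ multichoose L N * wordsCount N φ
columnsCount-upper zero zero φ ofL = ℕₚ.≤-reflexive (sym (ℕₚ.+-identityʳ (φ [])))
columnsCount-upper zero (suc N) φ ofL rewrite ofL [] (λ ()) = z≤n
columnsCount-upper (suc L) N φ ofL = begin
  cnt₈ c
    ≡⟨ regroup (c false false false) (c false false true) (c false true false) (c false true true)
               (c true false false) (c true false true) (c true true false) (c true true true) ⟩
  c false false false + ((c true false false + (c false true false + c false false true))
    + ((c true true false + (c true false true + c false true true)) + c true true true))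
    ≤⟨ ℕₚ.+-mono-≤ (columnsCount-upper L N φ ofL) (rest N ofL) ⟩
  multichoose L N * W N φ + rest-bound N * W N φ
    ≡⟨ sym (ℕₚ.*-distribʳ-+ (W N φ) (multichoose L N) (rest-bound N)) ⟩
  (multichoose L N + rest-bound N) * W N φ
    ≤⟨ ℕₚ.*-monoˡ-≤ (W N φ) (bound N) ⟩
  multichoose (suc L) N * W N φ ∎
  where
  open ℕₚ.≤-Reasoning
  W = wordsCount
  M = multichoose L
  c : Bool → Bool → Bool → ℕ
  c b₁ b₂ b₃ = columnsCount L (λ w → φ (column b₁ b₂ b₃ w))
  regroup : ∀ a d c e b f g h → ((a + d) + (c + e)) + ((b + f) + (g + h)) ≡ a + ((b + (c + d)) + ((g + (f + e)) + h))
  regroup = ℕ-Ring.solve-∀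
  rest-bound : ℕ → ℕ
  rest-bound zero                = 0
  rest-bound (suc zero)          = M 0
  rest-bound (suc (suc zero))    = M 1 + M 0
  rest-bound (suc (suc (suc N))) = M (suc (suc N)) + (M (suc N) + M N)
  bound : ∀ N → M N + rest-bound N ≤ multichoose (suc L) N
  bound zero = ℕₚ.≤-refl
  bound (suc zero) = ℕₚ.≤-reflexive (trans (ℕₚ.+-comm (M 1) (M 0)) (sym (multichoose-suc L 0)))
  bound (suc (suc zero)) = subst (M 2 + (M 1 + M 0) ≤_) (sym (multichoose-suc L 1))
    (ℕₚ.≤-trans (ℕₚ.≤-reflexive (ℕₚ.+-comm (M 2) (M 1 + M 0))) (ℕₚ.+-monoˡ-≤ (M 2) (bound 1)))
  bound (suc (suc (suc N))) = subst (M (3 + N) + (M (2 + N) + (M (suc N) + M N)) ≤_) (sym (multichoose-suc L (2 + N)))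
    (ℕₚ.≤-trans (ℕₚ.≤-reflexive (ℕₚ.+-comm (M (3 + N)) _)) (ℕₚ.+-monoˡ-≤ (M (3 + N)) (subst (M (2 + N) + (M (suc N) + M N) ≤_)
      (sym (multichoose-suc L (suc N))) (ℕₚ.≤-trans (ℕₚ.≤-reflexive (ℕₚ.+-comm (M (2 + N)) _)) (ℕₚ.+-monoˡ-≤ (M (2 + N))
        (subst (M (suc N) + M N ≤_) (sym (multichoose-suc L N)) (ℕₚ.≤-trans (ℕₚ.≤-reflexive (ℕₚ.+-comm (M (suc N)) (M N)))
          (ℕₚ.+-monoˡ-≤ (M (suc N)) (multichoose-mono L N)))))))))
  singles : ∀ N → OfLength (suc N) φ → c true false false + (c false true false + c false false true) ≤ M N * W (suc N) φ
  singles N ofL = ℕₚ.≤-trans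
    (ℕₚ.+-mono-≤ (columnsCount-upper L N (λ w → φ (X ∷ w)) (OfLength-∷ X ofL)) (ℕₚ.+-mono-≤
      (columnsCount-upper L N (λ w → φ (Y ∷ w)) (OfLength-∷ Y ofL))
      (columnsCount-upper L N (λ w → φ (Z ∷ w)) (OfLength-∷ Z ofL))))
    (ℕₚ.≤-reflexive (lem (M N) (W N (λ w → φ (X ∷ w))) (W N (λ w → φ (Y ∷ w))) (W N (λ w → φ (Z ∷ w)))))
    where
    lem : ∀ m x y z → m * x + (m * y + m * z) ≡ m * (x + (y + z))
    lem = ℕ-Ring.solve-∀
  double : Letter → Letter → List Letter → ℕ
  double l l′ w = φ (l ∷ l′ ∷ w)
  doubles : ∀ N → OfLength (2 + N) φ → c true true false + (c true false true + c false true true) ≤ M N * W (2 + N) φ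
  doubles N ofL = ℕₚ.≤-trans
    (ℕₚ.+-mono-≤ (columnsCount-upper L N (double X Y) (OfLength-∷ Y (OfLength-∷ X ofL))) (ℕₚ.+-mono-≤
      (columnsCount-upper L N (double X Z) (OfLength-∷ Z (OfLength-∷ X ofL)))
      (columnsCount-upper L N (double Y Z) (OfLength-∷ Z (OfLength-∷ Y ofL)))))
    (lem (M N) (W N (double X X)) (W N (double X Y)) (W N (double X Z)) (W N (double Y X)) (W N (double Y Y)) (W N (double Y Z)) _)
    where
    lem′ : ∀ m a b c d e f g → m * (a + (b + c) + ((d + (e + f)) + g)) ≡ m * b + (m * c + m * f) + m * (a + d + e + g)
    lem′ = ℕ-Ring.solve-∀
    lem : ∀ m a b c d e f g → m * b + (m * c + m * f) ≤ m * (a + (b + c) + ((d + (e + f)) + g))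
    lem m a b c d e f g = subst (m * b + (m * c + m * f) ≤_) (sym (lem′ m a b c d e f g)) (ℕₚ.m≤m+n _ _)
  triple : ∀ N → OfLength (3 + N) φ → c true true true ≤ M N * W (3 + N) φ
  triple N ofL = ℕₚ.≤-trans (columnsCount-upper L N (λ w → φ (X ∷ Y ∷ Z ∷ w)) (OfLength-∷ Z (OfLength-∷ Y (OfLength-∷ X ofL))))
    (ℕₚ.*-monoʳ-≤ (M N) (ℕₚ.≤-trans (wordsCount-∷ N (λ w → φ (X ∷ Y ∷ w)) Z)
      (ℕₚ.≤-trans (wordsCount-∷ (suc N) (λ w → φ (X ∷ w)) Y) (wordsCount-∷ (2 + N) φ X))))
  vanish : ∀ b₁ b₂ b₃ → (∀ w → φ (column b₁ b₂ b₃ w) ≡ 0) → c b₁ b₂ b₃ ≡ 0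
  vanish b₁ b₂ b₃ = columnsCount-zero L (λ w → φ (column b₁ b₂ b₃ w))
  rest : ∀ N → OfLength N φ → (c true false false + (c false true false + c false false true))
    + ((c true true false + (c true false true + c false true true)) + c true true true) ≤ rest-bound N * W N φ
  rest zero ofL
    rewrite vanish true false false (λ w → ofL _ λ ()) | vanish false true false (λ w → ofL _ λ ())
          | vanish false false true (λ w → ofL _ λ ()) | vanish true true false (λ w → ofL _ λ ())
          | vanish true false true (λ w → ofL _ λ ()) | vanish false true true (λ w → ofL _ λ ())
          | vanish true true true (λ w → ofL _ λ ()) = z≤n
  rest (suc zero) ofL
    rewrite vanish true true false (λ w → ofL _ λ ())
          | vanish true false true (λ w → ofL _ λ ()) | vanish false true true (λ w → ofL _ λ ())
          | vanish true true true (λ w → ofL _ λ ()) =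
    ℕₚ.≤-trans (ℕₚ.≤-reflexive (ℕₚ.+-identityʳ _)) (singles 0 ofL)
  rest (suc (suc zero)) ofL
    rewrite vanish true true true (λ w → ofL _ λ ()) =
    ℕₚ.≤-trans (ℕₚ.+-mono-≤ (singles 1 ofL) (ℕₚ.≤-trans (ℕₚ.≤-reflexive (ℕₚ.+-identityʳ _)) (doubles 0 ofL)))
      (ℕₚ.≤-reflexive (sym (ℕₚ.*-distribʳ-+ (W 2 φ) (M 1) (M 0))))
  rest (suc (suc (suc N))) ofL =
    ℕₚ.≤-trans (ℕₚ.+-mono-≤ (singles (2 + N) ofL) (ℕₚ.+-mono-≤ (doubles (suc N) ofL) (triple N ofL)))
      (ℕₚ.≤-reflexive (lem (M (2 + N)) (M (suc N)) (M N) (W (3 + N) φ)))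
    where
    lem : ∀ i j k w → i * w + (j * w + k * w) ≡ (i + (j + k)) * w
    lem = ℕ-Ring.solve-∀

-- Bernoulli's inequality (1 - c/t)^k ≥ 1 - kc/t with t = A + c, cleared of denominators, where `u`
-- stands for t - kc.
bernoulli : ∀ A c k u → A + c ≡ u + k * c → u * (A + c) ^ k ≤ (A + c) * A ^ k
bernoulli A c zero u e = ℕₚ.*-monoˡ-≤ 1 (subst (u ≤_) (sym e) (ℕₚ.m≤m+n u 0))
bernoulli A c (suc k) u e = begin
  u * (t * t ^ k)          ≡⟨ sym (ℕₚ.*-assoc u t (t ^ k)) ⟩
  u * t * t ^ k            ≤⟨ ℕₚ.*-monoˡ-≤ (t ^ k) (subst (_≤ (u + c) * A) (sym (ℕₚ.*-distribˡ-+ u A c)) step′) ⟩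
  (u + c) * A * t ^ k      ≡⟨ lem (u + c) A (t ^ k) ⟩
  A * ((u + c) * t ^ k)    ≤⟨ ℕₚ.*-monoʳ-≤ A (bernoulli A c k (u + c) (trans e (sym (ℕₚ.+-assoc u c (k * c))))) ⟩
  A * (t * A ^ k)          ≡⟨ lem′ A t (A ^ k) ⟩
  t * (A * A ^ k) ∎
  where
  open ℕₚ.≤-Reasoning
  t = A + c
  lem : ∀ i j k → i * j * k ≡ j * (i * k)
  lem = ℕ-Ring.solve-∀
  lem′ : ∀ i j k → i * (j * k) ≡ j * (i * k)
  lem′ = ℕ-Ring.solve-∀
  A≡ : A ≡ u + k * c
  A≡ = ℕₚ.+-cancelʳ-≡ c A (u + k * c) (trans e (lem″ u k c))
    where
    lem″ : ∀ u k c → u + (c + k * c) ≡ u + k * c + c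
    lem″ = ℕ-Ring.solve-∀
  step′ : u * A + u * c ≤ (u + c) * A
  step′ = subst (u * A + u * c ≤_) (sym (ℕₚ.*-distribʳ-+ A u c)) (ℕₚ.+-monoʳ-≤ (u * A)
    (ℕₚ.≤-trans (ℕₚ.≤-reflexive (ℕₚ.*-comm u c)) (ℕₚ.*-monoʳ-≤ c (subst (u ≤_) (sym A≡) (ℕₚ.m≤m+n u (k * c))))))

-- With m large the two products agree up to the factor (m + K) / m.
module Comparison (N : ℕ) {φ ψ : List Letter → ℕ} (φ-len : OfLength N φ) (ψ-len : OfLength (suc N) ψ) (m : ℕ) where

  c K A L′ : ℕ
  -- All factors of the binomial coefficients lie between A and B = A + c, where B = (L′ + 1) + (N +
  -- 1) fixes `c`. `K` is the total loss in Bernoulli's inequality with exponent N + 1, and `A` is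
  -- chosen so that B = m + K.
  c  = 2 * N + 2
  K  = suc N * c
  A  = m + N * c
  L′ = N + A

  private
    k = suc N
    h = wordsCount N φ
    W = wordsCount (suc N) ψ
    x = columnsCount L′ φ
    z = columnsCount (suc L′) ψ
    B = A + c

    power : m * B ^ k ≤ (m + K) * A ^ k
    power = subst (λ t → m * B ^ k ≤ t * A ^ k) e (bernoulli A c k m e)
      where
      e : A + c ≡ m + K
      e = lem m N c
        where
        lem : ∀ m N c → m + N * c + c ≡ m + suc N * c
        lem = ℕ-Ring.solve-∀

    B≡ : suc L′ + suc N ≡ B
    B≡ = lem N A
      where
      lem : ∀ N A → suc (N + A) + suc N ≡ A + (2 * N + 2)
      lem = ℕ-Ring.solve-∀

    x-upper : N ! * (suc L′ * x) ≤ B ^ k * h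
    x-upper = begin
      N ! * (suc L′ * x)                       ≤⟨ ℕₚ.*-monoʳ-≤ (N !) (ℕₚ.*-monoʳ-≤ (suc L′) (columnsCount-upper L′ N φ φ-len)) ⟩
      N ! * (suc L′ * (multichoose L′ N * h))  ≡⟨ lem (N !) (suc L′) (multichoose L′ N) h ⟩
      suc L′ * (N ! * multichoose L′ N) * h    ≤⟨ ℕₚ.*-monoˡ-≤ h (ℕₚ.*-mono-≤ L≤B (ℕₚ.≤-trans (binom-upper (L′ + N) N) (ℕₚ.^-monoˡ-≤ N L+N≤B))) ⟩
      B * B ^ N * h ∎
      where
      open ℕₚ.≤-Reasoning
      lem : ∀ n l m h → n * (l * (m * h)) ≡ l * (n * m) * h
      lem = ℕ-Ring.solve-∀
      L≤B : suc L′ ≤ B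
      L≤B = subst (suc L′ ≤_) B≡ (ℕₚ.m≤m+n (suc L′) (suc N))
      L+N≤B : L′ + N ≤ B
      L+N≤B = subst (L′ + N ≤_) B≡ (ℕₚ.+-mono-≤ (ℕₚ.n≤1+n L′) (ℕₚ.n≤1+n N))

    x-lower : A ^ k * h ≤ N ! * (suc L′ * x)
    x-lower = begin
      A * A ^ N * h                        ≤⟨ ℕₚ.*-monoˡ-≤ h (ℕₚ.*-mono-≤ (ℕₚ.≤-trans (ℕₚ.m≤n+m A N) (ℕₚ.n≤1+n L′)) (binom-lower A N)) ⟩
      suc L′ * (N ! * binom L′ N) * h      ≡⟨ lem (suc L′) (N !) (binom L′ N) h ⟩
      N ! * (suc L′ * (binom L′ N * h))    ≤⟨ ℕₚ.*-monoʳ-≤ (N !) (ℕₚ.*-monoʳ-≤ (suc L′) (columnsCount-lower L′ N φ)) ⟩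
      N ! * (suc L′ * x) ∎
      where
      open ℕₚ.≤-Reasoning
      lem : ∀ l n m h → l * (n * m) * h ≡ n * (l * (m * h))
      lem = ℕ-Ring.solve-∀

    z-upper : k ! * z ≤ B ^ k * W
    z-upper = begin
      k ! * z                                ≤⟨ ℕₚ.*-monoʳ-≤ (k !) (columnsCount-upper (suc L′) k ψ ψ-len) ⟩
      k ! * (multichoose (suc L′) k * W)     ≡⟨ sym (ℕₚ.*-assoc (k !) _ W) ⟩
      k ! * multichoose (suc L′) k * W       ≤⟨ ℕₚ.*-monoˡ-≤ W (subst (λ b → k ! * multichoose (suc L′) k ≤ b ^ k) B≡ (binom-upper (suc L′ + k) k)) ⟩
      B ^ k * W ∎
      where open ℕₚ.≤-Reasoning

    z-lower : A ^ k * W ≤ k ! * z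
    z-lower = begin
      A ^ k * W                    ≤⟨ ℕₚ.*-monoˡ-≤ W (binom-lower A k) ⟩
      k ! * binom (suc L′) k * W   ≡⟨ ℕₚ.*-assoc (k !) _ W ⟩
      k ! * (binom (suc L′) k * W) ≤⟨ ℕₚ.*-monoʳ-≤ (k !) (columnsCount-lower (suc L′) k ψ) ⟩
      k ! * z ∎
      where open ℕₚ.≤-Reasoning

  z-positive : 1 ≤ m → 1 ≤ W → 1 ≤ z
  z-positive 1≤m 1≤W = ℕₚ.n≢0⇒n>0 λ z≡0 → ℕₚ.<⇒≱
    (ℕₚ.*-mono-≤ (subst (_≤ A ^ k) (ℕₚ.^-zeroˡ k) (ℕₚ.^-monoˡ-≤ k (ℕₚ.≤-trans 1≤m (ℕₚ.m≤m+n m (N * c))))) 1≤W)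
    (subst (A ^ k * W ≤_) (trans (cong (k ! *_) z≡0) (ℕₚ.*-zeroʳ (k !))) z-lower)

  -- The count of good words is bounded above by a power of B and the count of all words below by
  -- the same power of A; `power` exchanges the two powers at the cost of the factor (m + K) / m.
  upper : m * (suc L′ * x * W) ≤ (m + K) * (suc N * h * z)
  upper = ℕₚ.*-cancelˡ-≤ (N !) {{N ℕₚ.!≢0}} (begin
    N ! * (m * (suc L′ * x * W))     ≡⟨ lem₁ (N !) m (suc L′ * x) W ⟩
    m * (N ! * (suc L′ * x)) * W     ≤⟨ ℕₚ.*-monoˡ-≤ W (ℕₚ.*-monoʳ-≤ m x-upper) ⟩
    m * (B ^ k * h) * W              ≡⟨ lem₂ m (B ^ k) h W ⟩
    m * B ^ k * (h * W)              ≤⟨ ℕₚ.*-monoˡ-≤ (h * W) power ⟩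
    (m + K) * A ^ k * (h * W)        ≡⟨ lem₃ (m + K) (A ^ k) h W ⟩
    (m + K) * (h * (A ^ k * W))      ≤⟨ ℕₚ.*-monoʳ-≤ (m + K) (ℕₚ.*-monoʳ-≤ h z-lower) ⟩
    (m + K) * (h * (suc N * N ! * z)) ≡⟨ lem₄ (m + K) h (suc N) (N !) z ⟩
    N ! * ((m + K) * (suc N * h * z)) ∎)
    where
    open ℕₚ.≤-Reasoning
    lem₁ : ∀ n m x w → n * (m * (x * w)) ≡ m * (n * x) * w
    lem₁ = ℕ-Ring.solve-∀
    lem₂ : ∀ m b h w → m * (b * h) * w ≡ m * b * (h * w)
    lem₂ = ℕ-Ring.solve-∀
    lem₃ : ∀ m a h w → m * a * (h * w) ≡ m * (h * (a * w))
    lem₃ = ℕ-Ring.solve-∀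
    lem₄ : ∀ m h s n z → m * (h * (s * n * z)) ≡ n * (m * (s * h * z))
    lem₄ = ℕ-Ring.solve-∀

  lower : m * (suc N * h * z) ≤ (m + K) * (suc L′ * x * W)
  lower = ℕₚ.*-cancelˡ-≤ (N !) {{N ℕₚ.!≢0}} (begin
    N ! * (m * (suc N * h * z))         ≡⟨ lem₁ (N !) m (suc N) h z ⟩
    m * (h * (suc N * N ! * z))         ≤⟨ ℕₚ.*-monoʳ-≤ m (ℕₚ.*-monoʳ-≤ h z-upper) ⟩
    m * (h * (B ^ k * W))               ≡⟨ lem₂ m h (B ^ k) W ⟩
    m * B ^ k * (h * W)                 ≤⟨ ℕₚ.*-monoˡ-≤ (h * W) power ⟩
    (m + K) * A ^ k * (h * W)           ≡⟨ lem₃ (m + K) (A ^ k) h W ⟩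
    (m + K) * (A ^ k * h) * W           ≤⟨ ℕₚ.*-monoˡ-≤ W (ℕₚ.*-monoʳ-≤ (m + K) x-lower) ⟩
    (m + K) * (N ! * (suc L′ * x)) * W  ≡⟨ lem₄ (m + K) (N !) (suc L′ * x) W ⟩
    N ! * ((m + K) * (suc L′ * x * W)) ∎)
    where
    open ℕₚ.≤-Reasoning
    lem₁ : ∀ n m s h z → n * (m * (s * h * z)) ≡ m * (h * (s * n * z))
    lem₁ = ℕ-Ring.solve-∀
    lem₂ : ∀ m h b w → m * (h * (b * w)) ≡ m * b * (h * w)
    lem₂ = ℕ-Ring.solve-∀
    lem₃ : ∀ m a h w → m * a * (h * w) ≡ m * (a * h) * w
    lem₃ = ℕ-Ring.solve-∀
    lem₄ : ∀ m n x w → m * (n * x) * w ≡ n * (m * (x * w))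
    lem₄ = ℕ-Ring.solve-∀

-- Closed forms

contentCount : ℕ → ℕ → ℕ → ℕ → (List Letter → Bool) → ℕ
contentCount N a b c ψ = wordsCount N (λ w → 𝟏 (has a b c w ∧ ψ w))

wordsCount-cong : ∀ N {φ ψ} → (∀ w → φ w ≡ ψ w) → wordsCount N φ ≡ wordsCount N ψ
wordsCount-cong zero    e = e []
wordsCount-cong (suc N) e = cong₂ _+_ (wordsCount-cong N (λ w → e (X ∷ w)))
  (cong₂ _+_ (wordsCount-cong N (λ w → e (Y ∷ w))) (wordsCount-cong N (λ w → e (Z ∷ w))))

wordsCount-mono : ∀ N {φ ψ} → (∀ w → φ w ≤ ψ w) → wordsCount N φ ≤ wordsCount N ψ
wordsCount-mono zero    e = e []
wordsCount-mono (suc N) e = ℕₚ.+-mono-≤ (wordsCount-mono N (λ w → e (X ∷ w)))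
  (ℕₚ.+-mono-≤ (wordsCount-mono N (λ w → e (Y ∷ w))) (wordsCount-mono N (λ w → e (Z ∷ w))))

wordsCount-zero : ∀ N {φ} → (∀ w → φ w ≡ 0) → wordsCount N φ ≡ 0
wordsCount-zero zero    e = e []
wordsCount-zero (suc N) e = cong₂ _+_ (wordsCount-zero N (λ w → e (X ∷ w)))
  (cong₂ _+_ (wordsCount-zero N (λ w → e (Y ∷ w))) (wordsCount-zero N (λ w → e (Z ∷ w))))

𝟏-∧-false : ∀ b → 𝟏 (b ∧ false) ≡ 0
𝟏-∧-false true  = refl
𝟏-∧-false false = refl

contentCount-false : ∀ N a b c {ψ} → (∀ w → ψ w ≡ false) → contentCount N a b c ψ ≡ 0
contentCount-false N a b c e = wordsCount-zero N (λ w → trans (cong (λ x → 𝟏 (has a b c w ∧ x)) (e w)) (𝟏-∧-false (has a b c w)))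

contentCount-cong : ∀ N a b c {ψ ψ′} → (∀ w → ψ w ≡ ψ′ w) → contentCount N a b c ψ ≡ contentCount N a b c ψ′
contentCount-cong N a b c e = wordsCount-cong N (λ w → cong (λ x → 𝟏 (has a b c w ∧ x)) (e w))

contentCount-∧ : ∀ N a b c (ψ ψ′ : List Letter → Bool) → contentCount N a b c (λ w → ψ w ∧ ψ′ w) ≤ contentCount N a b c ψ
contentCount-∧ N a b c ψ ψ′ = wordsCount-mono N (λ w → lem (has a b c w) (ψ w) (ψ′ w))
  where
  lem : ∀ x y z → 𝟏 (x ∧ (y ∧ z)) ≤ 𝟏 (x ∧ y)
  lem true  true  true  = ℕₚ.≤-refl
  lem true  true  false = z≤n
  lem true  false _     = z≤n
  lem false _     _     = z≤n

-- Spending one letter of a kind; the value is 0 if none is left.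
below : ℕ → (ℕ → ℕ) → ℕ
below zero    f = 0
below (suc k) f = f k

contentCount-suc : ∀ N a b c ψ → contentCount (suc N) a b c ψ
  ≡ below a (λ a′ → contentCount N a′ b c (λ w → ψ (X ∷ w)))
  + (below b (λ b′ → contentCount N a b′ c (λ w → ψ (Y ∷ w))) + below c (λ c′ → contentCount N a b c′ (λ w → ψ (Z ∷ w))))
contentCount-suc N a b c ψ = cong₂ _+_ (x-part a) (cong₂ _+_ (y-part b) (z-part c))
  where
  x-part : ∀ a → wordsCount N (λ w → 𝟏 (has a b c (X ∷ w) ∧ ψ (X ∷ w))) ≡ below a (λ a′ → contentCount N a′ b c (λ w → ψ (X ∷ w)))
  x-part zero    = wordsCount-zero N (λ w → refl)
  x-part (suc a) = refl
  y-part : ∀ b → wordsCount N (λ w → 𝟏 (has a b c (Y ∷ w) ∧ ψ (Y ∷ w))) ≡ below b (λ b′ → contentCount N a b′ c (λ w → ψ (Y ∷ w)))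
  y-part zero    = wordsCount-zero N (λ w → lem (#X w ≡ᵇ a) (ψ (Y ∷ w)))
    where
    lem : ∀ x y → 𝟏 ((x ∧ false) ∧ y) ≡ 0
    lem true  y = refl
    lem false y = refl
  y-part (suc b) = refl
  z-part : ∀ c → wordsCount N (λ w → 𝟏 (has a b c (Z ∷ w) ∧ ψ (Z ∷ w))) ≡ below c (λ c′ → contentCount N a b c′ (λ w → ψ (Z ∷ w)))
  z-part zero    = wordsCount-zero N (λ w → lem (#X w ≡ᵇ a) (#Y w ≡ᵇ b) (ψ (Z ∷ w)))
    where
    lem : ∀ x y z → 𝟏 ((x ∧ (y ∧ false)) ∧ z) ≡ 0
    lem true  true  z = refl
    lem true  false z = refl
    lem false y     z = refl
  z-part (suc c) = refl

total-serve : ∀ s → total (proj₂ (serve s)) ≡ pred (total s)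
total-serve (suc q , r)    = refl
total-serve (zero , suc r) = refl
total-serve (zero , zero)  = refl

-- The tandem started in (p , s) can be emptied by the remaining letters.
Clearable : Tandem → ℕ → ℕ → ℕ → Set
Clearable (p , s) a b c = p + a ≤ b × total s + b ≤ c

-- Ending idle is a condition on the suffixes: none may contain more X than Y or more Y than Z. The
-- start matters only through `Clearable`, so for clearable starts the count does not depend on `s`.
clearing : ℕ → Tandem → ℕ → ℕ → ℕ → ℕ
clearing N s a b c = contentCount N a b c (λ w → isIdle (run s w))

clearing-zero : ∀ N p s a b c → ¬ Clearable (p , s) a b c → clearing N (p , s) a b c ≡ 0
clearing-zero zero p s (suc a) b c ¬cl = refl
clearing-zero zero p s zero (suc b) c ¬cl = refl
clearing-zero zero p s zero zero (suc c) ¬cl = refl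
clearing-zero zero (suc p) s zero zero zero ¬cl = refl
clearing-zero zero zero (suc q , r) zero zero zero ¬cl = refl
clearing-zero zero zero (zero , suc r) zero zero zero ¬cl = refl
clearing-zero zero zero (zero , zero) zero zero zero ¬cl = contradiction (z≤n , z≤n) ¬cl
clearing-zero (suc N) p s a b c ¬cl = trans (contentCount-suc N a b c (λ w → isIdle (run (p , s) w)))
  (cong₂ _+_ (x-part a ¬cl) (cong₂ _+_ (y-part p b ¬cl) (z-part c ¬cl)))
  where
  x-part : ∀ a → ¬ Clearable (p , s) a b c → below a (λ a′ → clearing N (suc p , s) a′ b c) ≡ 0
  x-part zero    ¬cl = refl
  x-part (suc a) ¬cl = clearing-zero N (suc p) s a b c (λ (i , j) → ¬cl (subst (_≤ b) (sym (ℕₚ.+-suc p a)) i , j))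
  y-part : ∀ p b → ¬ Clearable (p , s) a b c → below b (λ b′ → clearing N (act Y (p , s)) a b′ c) ≡ 0
  y-part p       zero    ¬cl = refl
  y-part zero    (suc b) ¬cl = clearing-zero N zero (arrive second s) a b c
    (λ (i , j) → ¬cl (ℕₚ.m≤n⇒m≤1+n i , subst (_≤ c) (trans (cong (_+ b) (ℕₚ.+-suc (proj₁ s) (proj₂ s))) (sym (ℕₚ.+-suc (total s) b))) j))
  y-part (suc p) (suc b) ¬cl = clearing-zero N p (arrive first s) a b c
    (λ (i , j) → ¬cl (s≤s i , subst (_≤ c) (sym (ℕₚ.+-suc (total s) b)) j))
  z-part : ∀ c → ¬ Clearable (p , s) a b c → below c (λ c′ → clearing N (act Z (p , s)) a b c′) ≡ 0
  z-part zero    ¬cl = refl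
  z-part (suc c) ¬cl = clearing-zero N p (proj₂ (serve s)) a b c (λ (i , j) → ¬cl (i , lift (total s) (subst (λ t → t + b ≤ c) (total-serve s) j)))
    where
    lift : ∀ t → pred t + b ≤ c → t + b ≤ suc c
    lift zero    j = ℕₚ.m≤n⇒m≤1+n j
    lift (suc t) j = s≤s j

-- The hook length formula for the three-row ballot words, with d = b - a and e = c - b.
clearing-closed : ∀ N p s a b c d e → b ≡ a + d → c ≡ b + e → N ≡ a + b + c → p ≤ d → total s ≤ e →
  clearing N (p , s) a b c * (a ! * (suc b) ! * (2 + c) !) ≡ N ! * (suc e * suc d * (2 + (d + e)))
clearing-closed zero zero (zero , zero) zero .0 .0 zero zero refl refl _ _ _ = refl
clearing-closed zero p s zero .0 .(0 + suc e) zero (suc e) refl refl () _ _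
clearing-closed zero (suc p) s zero .0 .0 zero zero refl refl _ () _
clearing-closed zero zero (suc q , r) zero .0 .0 zero zero refl refl _ _ ()
clearing-closed zero zero (zero , suc r) zero .0 .0 zero zero refl refl _ _ ()
clearing-closed (suc N) p s a b c d e eb ec eN p≤d t≤e = begin
  clearing (suc N) (p , s) a b c * F
    ≡⟨ cong (_* F) (contentCount-suc N a b c (λ w → isIdle (run (p , s) w))) ⟩
  (x + (y + z)) * F
    ≡⟨ distrib x y z F ⟩
  x * F + (y * F + z * F)
    ≡⟨ cong₂ _+_ (x-part a eb eN) (cong₂ _+_ (y-part b d p eb ec eN p≤d) (z-part c e ec eN t≤e)) ⟩
  a * (N ! * (suc e * (2 + d) * (3 + (d + e)))) + (suc b * (N ! * ((2 + e) * d * (2 + (d + e)))) + (2 + c) * (N ! * (e * suc d * suc (d + e))))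
    ≡⟨ lem (N !) a b c d e eb ec ⟩
  (a + b + c) * (N ! * (suc e * suc d * (2 + (d + e))))
    ≡⟨ cong (_* (N ! * (suc e * suc d * (2 + (d + e))))) (sym eN) ⟩
  suc N * (N ! * (suc e * suc d * (2 + (d + e))))
    ≡⟨ sym (ℕₚ.*-assoc (suc N) (N !) _) ⟩
  suc N * N ! * (suc e * suc d * (2 + (d + e))) ∎
  where
  open ≡-Reasoning
  F = a ! * (suc b) ! * (2 + c) !
  x = below a (λ a′ → clearing N (suc p , s) a′ b c)
  y = below b (λ b′ → clearing N (act Y (p , s)) a b′ c)
  z = below c (λ c′ → clearing N (act Z (p , s)) a b c′)
  distrib : ∀ x y z F → (x + (y + z)) * F ≡ x * F + (y * F + z * F)
  distrib = ℕ-Ring.solve-∀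
  lem : ∀ n a b c d e → b ≡ a + d → c ≡ b + e →
    a * (n * (suc e * (2 + d) * (3 + (d + e)))) + (suc b * (n * ((2 + e) * d * (2 + (d + e)))) + (2 + c) * (n * (e * suc d * suc (d + e))))
    ≡ (a + b + c) * (n * (suc e * suc d * (2 + (d + e))))
  lem n a .(a + d) .(a + d + e) d e refl refl = poly n a d e
    where
    poly : ∀ n a d e → a * (n * (suc e * (2 + d) * (3 + (d + e)))) + (suc (a + d) * (n * ((2 + e) * d * (2 + (d + e)))) + (2 + (a + d + e)) * (n * (e * suc d * suc (d + e))))
           ≡ (a + (a + d) + (a + d + e)) * (n * (suc e * suc d * (2 + (d + e))))
    poly = ℕ-Ring.solve-∀
  x-part : ∀ a → b ≡ a + d → suc N ≡ a + b + c → below a (λ a′ → clearing N (suc p , s) a′ b c) * (a ! * (suc b) ! * (2 + c) !)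
           ≡ a * (N ! * (suc e * (2 + d) * (3 + (d + e))))
  x-part zero    _  _  = refl
  x-part (suc a) eb eN = trans (pull (clearing N (suc p , s) a b c) (suc a) (a !) ((suc b) !) ((2 + c) !))
    (cong (suc a *_) (clearing-closed N (suc p) s a b c (suc d) e (trans eb (sym (ℕₚ.+-suc a d))) ec (ℕₚ.suc-injective eN) (s≤s p≤d) t≤e))
    where
    pull : ∀ k m i j l → k * (m * i * j * l) ≡ m * (k * (i * j * l))
    pull = ℕ-Ring.solve-∀
  y-part : ∀ b d p → b ≡ a + d → c ≡ b + e → suc N ≡ a + b + c → p ≤ d → below b (λ b′ → clearing N (act Y (p , s)) a b′ c) * (a ! * (suc b) ! * (2 + c) !)
           ≡ suc b * (N ! * ((2 + e) * d * (2 + (d + e))))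
  y-part zero zero p _ _ _ _ = sym (trans (ℕₚ.+-identityʳ _) (trans (cong (N ! *_) (cong (_* (2 + e)) (ℕₚ.*-zeroʳ (2 + e)))) (ℕₚ.*-zeroʳ (N !))))
  y-part zero (suc d) p eb _ _ _ = contradiction (trans eb (ℕₚ.+-suc a d)) λ ()
  y-part (suc b) zero zero eb ec eN _ = trans (cong (_* (a ! * (2 + b) ! * (2 + c) !)) (clearing-zero N zero (arrive second s) a b c
      (λ (i , _) → ℕₚ.<⇒≱ (subst (b <_) (trans eb (ℕₚ.+-identityʳ a)) ℕₚ.≤-refl) i)))
    (sym (trans (cong (suc (suc b) *_) (trans (cong (N ! *_) (cong (_* (2 + e)) (ℕₚ.*-zeroʳ (2 + e)))) (ℕₚ.*-zeroʳ (N !)))) (ℕₚ.*-zeroʳ (suc (suc b)))))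
  y-part (suc b) (suc d) p eb ec eN p≤d = trans (pull (clearing N (act Y (p , s)) a b c) (suc (suc b)) (a !) ((suc b) !) ((2 + c) !))
    (cong (suc (suc b) *_) (trans (recurse p p≤d) (cong (λ i → N ! * ((2 + e) * suc d * (2 + i))) (ℕₚ.+-suc d e))))
    where
    pull : ∀ k m i j l → k * (i * (m * j) * l) ≡ m * (k * (i * j * l))
    pull = ℕ-Ring.solve-∀
    eb′ : b ≡ a + d
    eb′ = ℕₚ.suc-injective (trans eb (ℕₚ.+-suc a d))
    ec′ : c ≡ b + suc e
    ec′ = trans ec (sym (ℕₚ.+-suc b e))
    eN′ : N ≡ a + b + c
    eN′ = ℕₚ.suc-injective (trans eN (cong (_+ c) (ℕₚ.+-suc a b)))
    -- Whether this Y is used or not, d drops and e grows by one. Allowing every p ≤ d and every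
    -- total up to e makes both cases instances of the induction hypothesis.
    recurse : ∀ p → p ≤ suc d → clearing N (act Y (p , s)) a b c * (a ! * (suc b) ! * (2 + c) !) ≡ N ! * ((2 + e) * suc d * (2 + (d + suc e)))
    recurse zero    _   = clearing-closed N zero (arrive second s) a b c d (suc e) eb′ ec′ eN′ z≤n
                            (subst (_≤ suc e) (sym (ℕₚ.+-suc (proj₁ s) (proj₂ s))) (s≤s t≤e))
    recurse (suc p) (s≤s p≤d) = clearing-closed N p (arrive first s) a b c d (suc e) eb′ ec′ eN′ p≤d (s≤s t≤e)
  z-part : ∀ c e → c ≡ b + e → suc N ≡ a + b + c → total s ≤ e → below c (λ c′ → clearing N (act Z (p , s)) a b c′) * (a ! * (suc b) ! * (2 + c) !)
           ≡ (2 + c) * (N ! * (e * suc d * suc (d + e)))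
  z-part zero zero ec eN t≤e = sym (trans (cong (2 *_) (ℕₚ.*-zeroʳ (N !))) refl)
  z-part zero (suc e) ec eN t≤e = contradiction (trans ec (ℕₚ.+-suc b e)) λ ()
  z-part (suc c) zero ec eN t≤e = trans (cong (_* (a ! * (suc b) ! * (3 + c) !)) (clearing-zero N p (proj₂ (serve s)) a b c
      (λ (_ , j) → ℕₚ.<⇒≱ (subst (c <_) (trans ec (ℕₚ.+-identityʳ b)) ℕₚ.≤-refl) (ℕₚ.≤-trans (ℕₚ.m≤n+m b _) j))))
    (sym (trans (cong ((3 + c) *_) (ℕₚ.*-zeroʳ (N !))) (ℕₚ.*-zeroʳ (3 + c))))
  z-part (suc c) (suc e) ec eN t≤e = trans (pull (clearing N (act Z (p , s)) a b c) (3 + c) (a !) ((suc b) !) ((2 + c) !))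
    (cong ((3 + c) *_) (trans (clearing-closed N p (proj₂ (serve s)) a b c d e eb (ℕₚ.suc-injective (trans ec (ℕₚ.+-suc b e)))
        (ℕₚ.suc-injective (trans eN (ℕₚ.+-suc (a + b) c))) p≤d (subst (_≤ e) (sym (total-serve s)) (ℕₚ.pred-mono-≤ t≤e)))
      (cong (λ i → N ! * (suc e * suc d * suc i)) (sym (ℕₚ.+-suc d e)))))
    where
    pull : ∀ k m i j l → k * (i * j * (m * l)) ≡ m * (k * (i * j * l))
    pull = ℕ-Ring.solve-∀

shapeC : List Letter → Bool
shapeC []      = false
shapeC (X ∷ w) = shapeC w
shapeC (Y ∷ w) = false
shapeC (Z ∷ w) = true

shapeB : List Letter → Bool
shapeB (Y ∷ w) = shapeB w
shapeB w       = shapeC w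

countC : ℕ → Tandem → ℕ → ℕ → ℕ → ℕ
countC N s a b c = contentCount N a b c (λ w → isIdle (run s w) ∧ shapeC w)

countB : ℕ → Tandem → ℕ → ℕ → ℕ → ℕ
countB N s a b c = contentCount N a b c (λ w → isIdle (run s w) ∧ shapeB w)

-- polyC and polyR below are the polynomial factors fitted to the recurrences countC-suc and countB-suc.
polyC : ℕ → ℕ → ℕ → ℕ
polyC a d e = (2 * a + (2 * d + e) + 2) * (d * (d + e)) + 3 * a * (2 * d + e) + (2 * d + e) * (2 * d + e) + 6 * a + 3 * (2 * d + e) + 2

∧-false : ∀ b → b ∧ false ≡ false
∧-false true  = refl
∧-false false = refl

∧-true : ∀ b → b ∧ true ≡ b
∧-true true  = refl
∧-true false = refl

-- A leading Y is excluded by the shape, and after the first Z the shape imposes nothing more, so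
-- only the clearing condition is left.
countC-suc : ∀ N p s a b c → countC (suc N) (p , s) a b c
  ≡ below a (λ a′ → countC N (suc p , s) a′ b c) + below c (λ c′ → clearing N (act Z (p , s)) a b c′)
countC-suc N p s a b c = trans (contentCount-suc N a b c (λ w → isIdle (run (p , s) w) ∧ shapeC w))
  (cong (below a (λ a′ → countC N (suc p , s) a′ b c) +_) (cong₂ _+_ (y-part b) (z-part c)))
  where
  y-part : ∀ b → below b (λ b′ → contentCount N a b′ c (λ w → isIdle (run (act Y (p , s)) w) ∧ false)) ≡ 0
  y-part zero    = refl
  y-part (suc b) = contentCount-false N a b c (λ w → ∧-false (isIdle (run (act Y (p , s)) w)))
  z-part : ∀ c → below c (λ c′ → contentCount N a b c′ (λ w → isIdle (run (act Z (p , s)) w) ∧ true)) ≡ below c (λ c′ → clearing N (act Z (p , s)) a b c′)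
  z-part zero    = refl
  z-part (suc c) = contentCount-cong N a b c (λ w → ∧-true (isIdle (run (act Z (p , s)) w)))

-- Induction along the initial X: each of them trades a for d with b and c fixed, so the factors in
-- b + c stay the same. The Z at the end of the run leaves a clearing count, which the hook length
-- formula evaluates.
countC-closed : ∀ N p s a b c d e → b ≡ a + d → c ≡ b + e → N ≡ a + b + c → p ≤ d → 1 ≤ total s → total s ≤ e →
  countC N (p , s) a b c * (a ! * (suc b) ! * (suc c) !) * ((b + c) * (2 + (b + c))) ≡ e * (N ! * polyC a d e)
countC-closed N p s a b c d zero eb ec eN p≤d 1≤t t≤e = contradiction (ℕₚ.≤-trans 1≤t t≤e) λ ()
countC-closed zero p s a b zero d (suc e) eb ec eN p≤d 1≤t t≤e = contradiction (trans ec (ℕₚ.+-suc b e)) λ ()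
countC-closed zero p s a b (suc c) d (suc e) eb ec eN p≤d 1≤t t≤e = contradiction (trans eN (ℕₚ.+-suc (a + b) c)) λ ()
countC-closed (suc N) p s a b zero d (suc e) eb ec eN p≤d 1≤t t≤e = contradiction (trans ec (ℕₚ.+-suc b e)) λ ()
countC-closed (suc N) p s a b (suc c) d (suc e) eb ec eN p≤d 1≤t t≤e = trans (cong (λ k → k * F * G) (countC-suc N p s a b (suc c))) (whole a eb eN)
  where
  open ≡-Reasoning
  F = a ! * (suc b) ! * (2 + c) !
  G = (b + suc c) * (2 + (b + suc c))
  z-part : ∀ a → b ≡ a + d → suc N ≡ a + b + suc c → clearing N (act Z (p , s)) a b c * (a ! * (suc b) ! * (2 + c) !) ≡ N ! * (suc e * suc d * (2 + (d + e)))
  z-part a eb eN = clearing-closed N p (proj₂ (serve s)) a b c d e eb (ℕₚ.suc-injective (trans ec (ℕₚ.+-suc b e)))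
    (ℕₚ.suc-injective (trans eN (ℕₚ.+-suc (a + b) c))) p≤d (subst (_≤ e) (sym (total-serve s)) (ℕₚ.pred-mono-≤ t≤e))
  whole : ∀ a → b ≡ a + d → suc N ≡ a + b + suc c →
    (below a (λ a′ → countC N (suc p , s) a′ b (suc c)) + clearing N (act Z (p , s)) a b c) * (a ! * (suc b) ! * (2 + c) !) * G
    ≡ suc e * (suc N * N ! * polyC a d (suc e))
  whole zero eb eN = begin
    clearing N (act Z (p , s)) 0 b c * (1 * (suc b) ! * (2 + c) !) * G
      ≡⟨ cong (_* G) (z-part 0 eb eN) ⟩
    N ! * (suc e * suc d * (2 + (d + e))) * G
      ≡⟨ lem (N !) b (suc c) d e eb ec ⟩
    suc e * ((b + suc c) * N ! * polyC 0 d (suc e))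
      ≡⟨ cong (λ k → suc e * (k * N ! * polyC 0 d (suc e))) (sym eN) ⟩
    suc e * (suc N * N ! * polyC 0 d (suc e)) ∎
    where
    lem : ∀ n b c d e → b ≡ d → c ≡ b + suc e → n * (suc e * suc d * (2 + (d + e))) * ((b + c) * (2 + (b + c)))
          ≡ suc e * ((b + c) * n * polyC 0 d (suc e))
    lem n b .(b + suc e) .b e refl refl = poly n b e
      where
      poly : ∀ n d e → n * (suc e * suc d * (2 + (d + e))) * ((d + (d + suc e)) * (2 + (d + (d + suc e))))
        ≡ suc e * ((d + (d + suc e)) * n * ((2 * 0 + (2 * d + suc e) + 2) * (d * (d + suc e)) + 3 * 0 * (2 * d + suc e)
            + (2 * d + suc e) * (2 * d + suc e) + 6 * 0 + 3 * (2 * d + suc e) + 2))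
      poly = ℕ-Ring.solve-∀
  whole (suc a) eb eN = begin
    (x + z) * (suc a * a ! * (suc b) ! * (2 + c) !) * G
      ≡⟨ pull x z (suc a) (a !) ((suc b) !) ((2 + c) !) G ⟩
    suc a * (x * (a ! * (suc b) ! * (2 + c) !) * G) + z * (suc a * a ! * (suc b) ! * (2 + c) !) * G
      ≡⟨ cong₂ (λ i j → suc a * i + j * G)
           (countC-closed N (suc p) s a b (suc c) (suc d) (suc e) (trans eb (sym (ℕₚ.+-suc a d))) ec (ℕₚ.suc-injective eN) (s≤s p≤d) 1≤t t≤e)
           (z-part (suc a) eb eN) ⟩
    suc a * (suc e * (N ! * polyC a (suc d) (suc e))) + N ! * (suc e * suc d * (2 + (d + e))) * G
      ≡⟨ lem (N !) a b (suc c) d e eb ec ⟩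
    suc e * ((suc a + b + suc c) * N ! * polyC (suc a) d (suc e))
      ≡⟨ cong (λ k → suc e * (k * N ! * polyC (suc a) d (suc e))) (sym eN) ⟩
    suc e * (suc N * N ! * polyC (suc a) d (suc e)) ∎
    where
    x = countC N (suc p , s) a b (suc c)
    z = clearing N (act Z (p , s)) (suc a) b c
    pull : ∀ x z m i j l G → (x + z) * (m * i * j * l) * G ≡ m * (x * (i * j * l) * G) + z * (m * i * j * l) * G
    pull = ℕ-Ring.solve-∀
    lem : ∀ n a b c d e → b ≡ suc a + d → c ≡ b + suc e →
          suc a * (suc e * (n * polyC a (suc d) (suc e))) + n * (suc e * suc d * (2 + (d + e))) * ((b + c) * (2 + (b + c)))
          ≡ suc e * ((suc a + b + c) * n * polyC (suc a) d (suc e))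
    lem n a .(suc a + d) .(suc a + d + suc e) d e refl refl = poly n a d e
      where
      poly : ∀ n a d e → suc a * (suc e * (n * ((2 * a + (2 * suc d + suc e) + 2) * (suc d * (suc d + suc e)) + 3 * a * (2 * suc d + suc e)
            + (2 * suc d + suc e) * (2 * suc d + suc e) + 6 * a + 3 * (2 * suc d + suc e) + 2)))
          + n * (suc e * suc d * (2 + (d + e))) * ((suc a + d + (suc a + d + suc e)) * (2 + (suc a + d + (suc a + d + suc e))))
        ≡ suc e * ((suc a + (suc a + d) + (suc a + d + suc e)) * n * ((2 * suc a + (2 * d + suc e) + 2) * (d * (d + suc e)) + 3 * suc a * (2 * d + suc e)
            + (2 * d + suc e) * (2 * d + suc e) + 6 * suc a + 3 * (2 * d + suc e) + 2))
      poly = ℕ-Ring.solve-∀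

-- The two shapes differ only on words that begin with Y: there `shapeC` fails and `shapeB` goes on.
countB-suc : ∀ N s a b c → countB (suc N) (0 , s) a b c ≡ countC (suc N) (0 , s) a b c + below b (λ b′ → countB N (0 , arrive second s) a b′ c)
countB-suc N s a b c = begin
  countB (suc N) (0 , s) a b c
    ≡⟨ contentCount-suc N a b c (λ w → isIdle (run (0 , s) w) ∧ shapeB w) ⟩
  x + (y + z)
    ≡⟨ lem x y z ⟩
  (x + (0 + z)) + y
    ≡⟨ cong (λ k → (x + (k + z)) + y) (sym (y-part b)) ⟩
  (x + (y′ + z)) + y
    ≡⟨ cong (_+ y) (sym (contentCount-suc N a b c (λ w → isIdle (run (0 , s) w) ∧ shapeC w))) ⟩
  countC (suc N) (0 , s) a b c + y ∎
  where
  open ≡-Reasoning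
  x = below a (λ a′ → countC N (1 , s) a′ b c)
  y = below b (λ b′ → countB N (0 , arrive second s) a b′ c)
  y′ = below b (λ b′ → contentCount N a b′ c (λ w → isIdle (run (0 , arrive second s) w) ∧ false))
  z = below c (λ c′ → contentCount N a b c′ (λ w → isIdle (run (act Z (0 , s)) w) ∧ true))
  lem : ∀ x y z → x + (y + z) ≡ (x + (0 + z)) + y
  lem = ℕ-Ring.solve-∀
  y-part : ∀ b → below b (λ b′ → contentCount N a b′ c (λ w → isIdle (run (0 , arrive second s) w) ∧ false)) ≡ 0
  y-part zero    = refl
  y-part (suc b) = contentCount-false N a b c (λ w → ∧-false (isIdle (run (0 , arrive second s) w)))

countB-zero : ∀ N s a b c → b < a → countB N (0 , s) a b c ≡ 0
countB-zero N s a b c b<a = ℕₚ.n≤0⇒n≡0 (subst (countB N (0 , s) a b c ≤_)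
  (clearing-zero N 0 s a b c (λ (a≤b , _) → ℕₚ.<⇒≱ b<a a≤b)) (contentCount-∧ N a b c (λ w → isIdle (run (0 , s) w)) shapeB))

polyR : ℕ → ℕ → ℕ → ℕ
polyR a d e =
    a * a * (4 * d * e + 2 * d + 4 * e * e + 8 * e)
  + a * (6 * d * d * e + 4 * d * d + 10 * d * e * e + 18 * d * e + 4 * d + 4 * e * e * e + 12 * e * e + 8 * e)
  + (2 * d * d * d * e + 2 * d * d * d + 5 * d * d * e * e + 9 * d * d * e + 4 * d * d + 4 * d * e * e * e
     + 11 * d * e * e + 9 * d * e + 2 * d + e * e * e * e + 4 * e * e * e + 5 * e * e + 2 * e)

-- For rows of sizes a, b′ = b + 1 and n = c + 1 this is (n + a)(n + a - 1)(n + b′)(n + b′ - 1), up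
-- to a factor 4 the product of the binomial coefficients of n + a and n + b′ over 2.
denominator : ℕ → ℕ → ℕ → ℕ
denominator a b c = (suc c + a) * (c + a) * ((2 + (b + c)) * suc (b + c))

-- The recurrence of `countB` freed from factorials, here for d = 0 and in `countB-step` for
-- positive d. The polynomials are expanded in `poly` to expose them to the ring solver.
countB-base : ∀ a e → e * polyC a 0 e * ((suc (a + 0 + e) + a) * (a + 0 + e + a)) * suc (a + 0 + (a + 0 + e))
              ≡ suc (a + (a + 0) + (a + 0 + e)) * (1 * polyR a 0 e) * (a + 0 + (a + 0 + e))
countB-base a e = poly a e
  where
  poly : ∀ a e → e * ((2 * a + (2 * 0 + e) + 2) * (0 * (0 + e)) + 3 * a * (2 * 0 + e) + (2 * 0 + e) * (2 * 0 + e) + 6 * a + 3 * (2 * 0 + e) + 2)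
                 * ((suc (a + 0 + e) + a) * (a + 0 + e + a)) * suc (a + 0 + (a + 0 + e))
       ≡ suc (a + (a + 0) + (a + 0 + e)) * (1 * (
          a * a * (4 * 0 * e + 2 * 0 + 4 * e * e + 8 * e)
        + a * (6 * 0 * 0 * e + 4 * 0 * 0 + 10 * 0 * e * e + 18 * 0 * e + 4 * 0 + 4 * e * e * e + 12 * e * e + 8 * e)
        + (2 * 0 * 0 * 0 * e + 2 * 0 * 0 * 0 + 5 * 0 * 0 * e * e + 9 * 0 * 0 * e + 4 * 0 * 0 + 4 * 0 * e * e * e
           + 11 * 0 * e * e + 9 * 0 * e + 2 * 0 + e * e * e * e + 4 * e * e * e + 5 * e * e + 2 * e))) * (a + 0 + (a + 0 + e))
  poly = ℕ-Ring.solve-∀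

countB-step : ∀ a d e → e * polyC a (suc d) e * ((suc (a + suc d + e) + a) * (a + suc d + e + a)) * suc (a + suc d + (a + suc d + e))
                + (2 + (a + d)) * (suc d * polyR a d (suc e)) * (2 + (a + suc d + (a + suc d + e)))
              ≡ suc (a + (a + suc d) + (a + suc d + e)) * ((2 + d) * polyR a (suc d) e) * (a + suc d + (a + suc d + e))
countB-step a d e = poly a d e
  where
  poly : ∀ a d e → e * ((2 * a + (2 * suc d + e) + 2) * (suc d * (suc d + e)) + 3 * a * (2 * suc d + e) + (2 * suc d + e) * (2 * suc d + e) + 6 * a + 3 * (2 * suc d + e) + 2)
                    * ((suc (a + suc d + e) + a) * (a + suc d + e + a)) * suc (a + suc d + (a + suc d + e))
                + (2 + (a + d)) * (suc d * (
          a * a * (4 * d * suc e + 2 * d + 4 * suc e * suc e + 8 * suc e)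
        + a * (6 * d * d * suc e + 4 * d * d + 10 * d * suc e * suc e + 18 * d * suc e + 4 * d + 4 * suc e * suc e * suc e + 12 * suc e * suc e + 8 * suc e)
        + (2 * d * d * d * suc e + 2 * d * d * d + 5 * d * d * suc e * suc e + 9 * d * d * suc e + 4 * d * d + 4 * d * suc e * suc e * suc e
           + 11 * d * suc e * suc e + 9 * d * suc e + 2 * d + suc e * suc e * suc e * suc e + 4 * suc e * suc e * suc e + 5 * suc e * suc e + 2 * suc e)
            )) * (2 + (a + suc d + (a + suc d + e)))
              ≡ suc (a + (a + suc d) + (a + suc d + e)) * ((2 + d) * (
          a * a * (4 * suc d * e + 2 * suc d + 4 * e * e + 8 * e)
        + a * (6 * suc d * suc d * e + 4 * suc d * suc d + 10 * suc d * e * e + 18 * suc d * e + 4 * suc d + 4 * e * e * e + 12 * e * e + 8 * e)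
        + (2 * suc d * suc d * suc d * e + 2 * suc d * suc d * suc d + 5 * suc d * suc d * e * e + 9 * suc d * suc d * e + 4 * suc d * suc d + 4 * suc d * e * e * e
           + 11 * suc d * e * e + 9 * suc d * e + 2 * suc d + e * e * e * e + 4 * e * e * e + 5 * e * e + 2 * e)
            )) * (a + suc d + (a + suc d + e))
  poly = ℕ-Ring.solve-∀

countB-closed : ∀ N s a b c d e → b ≡ a + d → c ≡ b + e → N ≡ a + b + c → 1 ≤ total s → total s ≤ e →
  countB N (0 , s) a b c * (a ! * (suc b) ! * (suc c) !) * denominator a b c ≡ (suc N) ! * (suc d * polyR a d e)
countB-closed N s a b zero d e eb ec eN 1≤t t≤e = contradiction (ℕₚ.≤-trans 1≤t t≤e)
  (ℕₚ.<⇒≱ (s≤s (subst (e ≤_) (sym ec) (ℕₚ.m≤n+m e b))))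
countB-closed zero s a b (suc c) d e eb ec eN 1≤t t≤e = contradiction (trans eN (ℕₚ.+-suc (a + b) c)) λ ()
countB-closed (suc N) s a b (suc c) d e eb ec eN 1≤t t≤e =
  -- With S = b + c the denominators are S(S + 2) for `countC`, and, apart from `Q`, (S + 2)(S + 1)
  -- for `countB` here and (S + 1)S for `countB` after one Y. The extra factor S provides a common
  -- multiple and is cancelled at the end.
  ℕₚ.*-cancelʳ-≡ _ _ (b + suc c) {{ℕ.>-nonZero (ℕₚ.<-≤-trans (s≤s z≤n) (ℕₚ.m≤n+m (suc c) b))}} (begin
    countB (suc N) (0 , s) a b (suc c) * F * (Q * ((2 + S) * suc S)) * S
      ≡⟨ cong (λ k → k * F * (Q * ((2 + S) * suc S)) * S) (countB-suc N s a b (suc c)) ⟩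
    (C₀ + B₀) * F * (Q * ((2 + S) * suc S)) * S
      ≡⟨ expand C₀ B₀ F Q S ⟩
    C₀ * F * (S * (2 + S)) * (Q * suc S) + B₀ * F * (Q * (suc S * S)) * (2 + S)
      ≡⟨ cong (λ k → k * (Q * suc S) + B₀ * F * (Q * (suc S * S)) * (2 + S))
           (countC-closed (suc N) 0 s a b (suc c) d e eb ec eN z≤n 1≤t t≤e) ⟩
    e * ((suc N) ! * polyC a d e) * (Q * suc S) + B₀ * F * (Q * (suc S * S)) * (2 + S)
      ≡⟨ finish b d eb ec eN ⟩
    (2 + N) ! * (suc d * polyR a d e) * S ∎)
  where
  open ≡-Reasoning
  F = a ! * (suc b) ! * (2 + c) !
  S = b + suc c
  Q = (2 + c + a) * (suc c + a)
  C₀ = countC (suc N) (0 , s) a b (suc c)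
  B₀ = below b (λ b′ → countB N (0 , arrive second s) a b′ (suc c))
  expand : ∀ C B F Q S → (C + B) * F * (Q * ((2 + S) * suc S)) * S ≡ C * F * (S * (2 + S)) * (Q * suc S) + B * F * (Q * (suc S * S)) * (2 + S)
  expand = ℕ-Ring.solve-∀
  collect₀ : ∀ n e p q t r l m → e * p * q * t ≡ l * r * m → e * (n * p) * (q * t) ≡ l * n * r * m
  collect₀ n e p q t r l m h = trans (lem n e p q t) (trans (cong (n *_) h) (lem′ n l r m))
    where
    lem : ∀ n e p q t → e * (n * p) * (q * t) ≡ n * (e * p * q * t)
    lem = ℕ-Ring.solve-∀
    lem′ : ∀ n l r m → n * (l * r * m) ≡ l * n * r * m
    lem′ = ℕ-Ring.solve-∀
  collect₁ : ∀ n e p q t r l m v u i → e * p * q * t + v * u * i ≡ l * r * m →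
             e * (n * p) * (q * t) + v * (n * u) * i ≡ l * n * r * m
  collect₁ n e p q t r l m v u i h = trans (lem n e p q t v u i) (trans (cong (n *_) h) (lem′ n l r m))
    where
    lem : ∀ n e p q t v u i → e * (n * p) * (q * t) + v * (n * u) * i ≡ n * (e * p * q * t + v * u * i)
    lem = ℕ-Ring.solve-∀
    lem′ : ∀ n l r m → n * (l * r * m) ≡ l * n * r * m
    lem′ = ℕ-Ring.solve-∀
  base : ∀ c b → b ≡ a + 0 → c ≡ b + e → suc N ≡ a + b + c →
    e * polyC a 0 e * ((suc c + a) * (c + a)) * suc (b + c) ≡ suc (suc N) * (1 * polyR a 0 e) * (b + c)
  base .(a + 0 + e) .(a + 0) refl refl eN = trans (countB-base a e)
    (cong (λ k → suc k * (1 * polyR a 0 e) * (a + 0 + (a + 0 + e))) (sym eN))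
  step′ : ∀ c b d → b ≡ a + suc d → c ≡ b + e → suc N ≡ a + b + c →
    e * polyC a (suc d) e * ((suc c + a) * (c + a)) * suc (b + c) + suc b * (suc d * polyR a d (suc e)) * (2 + (b + c))
    ≡ suc (suc N) * ((2 + d) * polyR a (suc d) e) * (b + c)
  step′ .(a + suc d + e) .(a + suc d) d refl refl eN = trans
    (cong (λ k → e * polyC a (suc d) e * ((suc (a + suc d + e) + a) * (a + suc d + e + a)) * suc (a + suc d + (a + suc d + e))
       + suc k * (suc d * polyR a d (suc e)) * (2 + (a + suc d + (a + suc d + e)))) (ℕₚ.+-suc a d)) (trans (countB-step a d e)
    (cong (λ k → suc k * ((2 + d) * polyR a (suc d) e) * (a + suc d + (a + suc d + e))) (sym eN)))
  finish : ∀ b d → b ≡ a + d → suc c ≡ b + e → suc N ≡ a + b + suc c →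
    e * ((suc N) ! * polyC a d e) * (Q * suc (b + suc c))
      + below b (λ b′ → countB N (0 , arrive second s) a b′ (suc c)) * (a ! * (suc b) ! * (2 + c) !) * (Q * (suc (b + suc c) * (b + suc c))) * (2 + (b + suc c))
    ≡ (2 + N) ! * (suc d * polyR a d e) * (b + suc c)
  finish b zero eb ec eN = trans (cong (λ k → e * ((suc N) ! * polyC a 0 e) * (Q * suc (b + suc c))
        + k * (a ! * (suc b) ! * (2 + c) !) * (Q * (suc (b + suc c) * (b + suc c))) * (2 + (b + suc c))) (vanish b eb))
    (trans (ℕₚ.+-identityʳ _) (collect₀ ((suc N) !) e (polyC a 0 e) Q (suc (b + suc c)) (1 * polyR a 0 e) (2 + N) (b + suc c) (base (suc c) b eb ec eN)))
    where
    vanish : ∀ b → b ≡ a + 0 → below b (λ b′ → countB N (0 , arrive second s) a b′ (suc c)) ≡ 0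
    vanish zero    _  = refl
    vanish (suc b) eb = countB-zero N (arrive second s) a b (suc c) (ℕₚ.≤-reflexive (trans eb (ℕₚ.+-identityʳ a)))
  finish zero (suc d) eb ec eN = contradiction (trans eb (ℕₚ.+-suc a d)) λ ()
  finish (suc b) (suc d) eb ec eN = trans
    (cong (λ k → e * ((suc N) ! * polyC a (suc d) e) * (Q * suc (suc b + suc c)) + k * (2 + (suc b + suc c)))
      (trans (pull (countB N (0 , arrive second s) a b (suc c)) (2 + b) (a !) ((suc b) !) ((2 + c) !) (Q * (suc (suc b + suc c) * (suc b + suc c))))
        (cong ((2 + b) *_) (countB-closed N (arrive second s) a b (suc c) d (suc e)
          (ℕₚ.suc-injective (trans eb (ℕₚ.+-suc a d))) (trans ec (sym (ℕₚ.+-suc b e)))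
          (ℕₚ.suc-injective (trans eN (cong (_+ suc c) (ℕₚ.+-suc a b))))
          (subst (1 ≤_) (sym (ℕₚ.+-suc (proj₁ s) (proj₂ s))) (s≤s z≤n))
          (subst (_≤ suc e) (sym (ℕₚ.+-suc (proj₁ s) (proj₂ s))) (s≤s t≤e))))))
    (collect₁ ((suc N) !) e (polyC a (suc d) e) Q (suc (suc b + suc c)) ((2 + d) * polyR a (suc d) e) (2 + N) (suc b + suc c)
       (2 + b) (suc d * polyR a d (suc e)) (2 + (suc b + suc c)) (step′ (suc c) (suc b) d eb ec eN))
    where
    pull : ∀ k m i j l q → k * (i * (m * j) * l) * q ≡ m * (k * (i * j * l) * q)
    pull = ℕ-Ring.solve-∀

firstOut-shapeC : ∀ p r w → is 2 (firstOut (suc p , 0 , suc r) w) ≡ shapeC w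
firstOut-shapeC p r []      = refl
firstOut-shapeC p r (X ∷ w) = firstOut-shapeC (suc p) r w
firstOut-shapeC p r (Y ∷ w) = firstOut-first p 0 (suc r) w
firstOut-shapeC p r (Z ∷ w) = refl

firstOut-shapeB : ∀ r w → is 2 (firstOut (0 , 0 , suc r) w) ≡ shapeB w
firstOut-shapeB r []      = refl
firstOut-shapeB r (X ∷ w) = firstOut-shapeC 0 r w
firstOut-shapeB r (Y ∷ w) = firstOut-shapeB (suc r) w
firstOut-shapeB r (Z ∷ w) = refl

good-count-suc : ∀ N a b c → contentCount (suc N) a b c good ≡ below b (λ b′ → countB N (0 , 0 , 1) a b′ c)
good-count-suc N a b c = trans (contentCount-suc N a b c good)
  (trans (cong₂ _+_ (x-part a) (cong₂ _+_ (y-part b) (z-part c))) (ℕₚ.+-identityʳ _))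
  where
  x-part : ∀ a → below a (λ a′ → contentCount N a′ b c (λ w → good (X ∷ w))) ≡ 0
  x-part zero    = refl
  x-part (suc a) = contentCount-false N a b c (λ w → trans (cong (isIdle (run (1 , empty) w) ∧_) (firstOut-waiting 0 w)) (∧-false _))
  y-part : ∀ b → below b (λ b′ → contentCount N a b′ c (λ w → good (Y ∷ w))) ≡ below b (λ b′ → countB N (0 , 0 , 1) a b′ c)
  y-part zero    = refl
  y-part (suc b) = contentCount-cong N a b c (λ w → cong (isIdle (run (0 , 0 , 1) w) ∧_) (firstOut-shapeB 0 w))
  z-part : ∀ c → below c (λ c′ → contentCount N a b c′ (λ w → good (Z ∷ w))) ≡ 0
  z-part zero    = refl
  z-part (suc c) = contentCount-false N a b c (λ w → ∧-false (isIdle (run idle w)))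

-- The leading Y of a good word is lost for the X, so equal numbers of X and Y cannot clear row 2.
good-count-diagonal : ∀ N a c → contentCount N a a c good ≡ 0
good-count-diagonal zero    a       c = 𝟏-∧-false (has a a c [])
good-count-diagonal (suc N) zero    c = good-count-suc N zero zero c
good-count-diagonal (suc N) (suc a) c = trans (good-count-suc N (suc a) (suc a) c) (countB-zero N (0 , 1) (suc a) a c ℕₚ.≤-refl)

multinomial : ∀ N a b c → N ≡ a + b + c → contentCount N a b c (λ _ → true) * (a ! * b ! * c !) ≡ N !
multinomial zero    zero zero zero _ = refl
multinomial (suc N) a b c eN = begin
  contentCount (suc N) a b c (λ _ → true) * F
    ≡⟨ cong (_* F) (contentCount-suc N a b c (λ _ → true)) ⟩
  (x + (y + z)) * F
    ≡⟨ distrib x y z F ⟩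
  x * F + (y * F + z * F)
    ≡⟨ cong₂ _+_ (x-part a eN) (cong₂ _+_ (y-part b eN) (z-part c eN)) ⟩
  a * N ! + (b * N ! + c * N !)
    ≡⟨ collect a b c (N !) ⟩
  (a + b + c) * N !
    ≡⟨ cong (_* N !) (sym eN) ⟩
  suc N * N ! ∎
  where
  open ≡-Reasoning
  F = a ! * b ! * c !
  x = below a (λ a′ → contentCount N a′ b c (λ _ → true))
  y = below b (λ b′ → contentCount N a b′ c (λ _ → true))
  z = below c (λ c′ → contentCount N a b c′ (λ _ → true))
  distrib : ∀ x y z F → (x + (y + z)) * F ≡ x * F + (y * F + z * F)
  distrib = ℕ-Ring.solve-∀
  collect : ∀ a b c n → a * n + (b * n + c * n) ≡ (a + b + c) * n
  collect = ℕ-Ring.solve-∀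
  x-part : ∀ a → suc N ≡ a + b + c → below a (λ a′ → contentCount N a′ b c (λ _ → true)) * (a ! * b ! * c !) ≡ a * N !
  x-part zero    _  = refl
  x-part (suc a) eN = trans (pull (contentCount N a b c (λ _ → true)) (suc a) (a !) (b !) (c !))
    (cong (suc a *_) (multinomial N a b c (ℕₚ.suc-injective eN)))
    where
    pull : ∀ k m i j l → k * (m * i * j * l) ≡ m * (k * (i * j * l))
    pull = ℕ-Ring.solve-∀
  y-part : ∀ b → suc N ≡ a + b + c → below b (λ b′ → contentCount N a b′ c (λ _ → true)) * (a ! * b ! * c !) ≡ b * N !
  y-part zero    _  = refl
  y-part (suc b) eN = trans (pull (contentCount N a b c (λ _ → true)) (suc b) (a !) (b !) (c !))
    (cong (suc b *_) (multinomial N a b c (ℕₚ.suc-injective (trans eN (cong (_+ c) (ℕₚ.+-suc a b))))))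
    where
    pull : ∀ k m i j l → k * (i * (m * j) * l) ≡ m * (k * (i * j * l))
    pull = ℕ-Ring.solve-∀
  z-part : ∀ c → suc N ≡ a + b + c → below c (λ c′ → contentCount N a b c′ (λ _ → true)) * (a ! * b ! * c !) ≡ c * N !
  z-part zero    _  = refl
  z-part (suc c) eN = trans (pull (contentCount N a b c (λ _ → true)) (suc c) (a !) (b !) (c !))
    (cong (suc c *_) (multinomial N a b c (ℕₚ.suc-injective (trans eN (ℕₚ.+-suc (a + b) c)))))
    where
    pull : ∀ k m i j l → k * (i * j * (m * l)) ≡ m * (k * (i * j * l))
    pull = ℕ-Ring.solve-∀

length-# : ∀ w → length w ≡ #X w + #Y w + #Z w
length-# []      = refl
length-# (X ∷ w) = cong suc (length-# w)
length-# (Y ∷ w) = trans (cong suc (length-# w)) (cong (_+ #Z w) (sym (ℕₚ.+-suc (#X w) (#Y w))))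
length-# (Z ∷ w) = trans (cong suc (length-# w)) (sym (ℕₚ.+-suc (#X w + #Y w) (#Z w)))

has-length : ∀ a b c w → has a b c w ≡ true → length w ≡ a + b + c
has-length a b c w e with #X w ≡ᵇ a in e₁ | #Y w ≡ᵇ b in e₂ | #Z w ≡ᵇ c in e₃
... | true | true | true = trans (length-# w) (cong₂ _+_ (cong₂ _+_ (ℕₚ.≡ᵇ⇒≡ (#X w) a (subst T (sym e₁) tt))
  (ℕₚ.≡ᵇ⇒≡ (#Y w) b (subst T (sym e₂) tt))) (ℕₚ.≡ᵇ⇒≡ (#Z w) c (subst T (sym e₃) tt)))

content-OfLength : ∀ {N} a b c (ψ : List Letter → Bool) → N ≡ a + b + c → OfLength N (λ w → 𝟏 (has a b c w ∧ ψ w))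
content-OfLength a b c ψ eN w ne with has a b c w in e
... | true  = contradiction (trans (has-length a b c w e) (sym eN)) ne
... | false = refl

-- The limiting values

frac-* : ∀ p k → frac p (suc k) *ℚ ℕtoℚ (suc k) ≡ ℕtoℚ p
frac-* p k = ℚₚ.toℚᵘ-injective (ℚᵘₚ.≃-trans (ℚₚ.toℚᵘ-homo-* (frac p (suc k)) (ℕtoℚ (suc k)))
  (ℚᵘₚ.≃-trans (ℚᵘₚ.*-cong (ℚₚ.toℚᵘ-fromℚᵘ (ℚᵘ.mkℚᵘ (ℤ.+ p) k)) (toℚᵘ-ℕtoℚ (suc k)))
    (ℚᵘₚ.≃-trans (ℚᵘ.*≡* (trans (ℤₚ.*-identityʳ (ℤ.+ p ℤ.* ℤ.+ suc k)) (cong (λ l → ℤ.+ p ℤ.* ℤ.+ suc l) (sym (ℕₚ.*-identityʳ k)))))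
      (ℚᵘₚ.≃-sym (toℚᵘ-ℕtoℚ p)))))

product₃ : ∀ i j k → ℕtoℚ (i * j * k) ≡ ℕtoℚ i *ℚ ℕtoℚ j *ℚ ℕtoℚ k
product₃ i j k = trans (ℕtoℚ-* (i * j) k) (cong (_*ℚ ℕtoℚ k) (ℕtoℚ-* i j))

inv : ℕ → ℚ
inv k = frac 1 k

inv-* : ∀ {k} → 1 ≤ k → inv k *ℚ ℕtoℚ k ≡ 1ℚ
inv-* {suc k} _ = frac-* 1 k

*-cancelʳ-ℕ : ∀ {p q} k → 1 ≤ k → p *ℚ ℕtoℚ k ≡ q *ℚ ℕtoℚ k → p ≡ q
*-cancelʳ-ℕ {p} {q} k 1≤k e = trans (sym (undo p)) (trans (cong (_*ℚ inv k) e) (undo q))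
  where
  undo : ∀ p → p *ℚ ℕtoℚ k *ℚ inv k ≡ p
  undo p = trans (ℚₚ.*-assoc p (ℕtoℚ k) (inv k))
    (trans (cong (p *ℚ_) (trans (ℚₚ.*-comm (ℕtoℚ k) (inv k)) (inv-* 1≤k))) (ℚₚ.*-identityʳ p))

frac-unique : ∀ {q p} k → 1 ≤ k → q *ℚ ℕtoℚ k ≡ ℕtoℚ p → q ≡ frac p k
frac-unique {q} {p} (suc k) 1≤k e = *-cancelʳ-ℕ (suc k) 1≤k (trans e (sym (frac-* p k)))

-- The limit of the expected pair counts splits so that partP and partQ cancel in the inclusion-exclusion.
partP : ℕ → ℕ → ℚ
partP n b = ℕtoℚ (b * (suc n ∸ b)) *ℚ inv (n + b ∸ 1)

partQ : ℕ → ℕ → ℚ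
partQ n a = ℕtoℚ a +ℚ ℕtoℚ (2 * a * (2 * n + a ∸ 1)) *ℚ (inv (n + a) *ℚ inv (n + a ∸ 1))

partM : ℕ → ℕ → ℕ → ℚ
partM n b a = ℕtoℚ (2 * n * a) *ℚ inv (n + b) -ℚ ℕtoℚ (2 * a * (n ∸ 1 ∸ b)) *ℚ inv (n + a)

pairLimit : ℕ → ℕ → ℕ → ℚ
pairLimit n b a = (partP n b -ℚ partQ n a) +ℚ partM n b a

module _ (n b a : ℕ) (2≤n : 2 ≤ n) where

  private
    A₁ = n + a
    A₀ = n + a ∸ 1
    B₁ = n + b
    B₀ = n + b ∸ 1
    x₁ = b * (suc n ∸ b)
    x₃ = 2 * a * (2 * n + a ∸ 1)
    x₄ = 2 * a * (n ∸ 1 ∸ b)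
    x₅ = 2 * n * a
    1≤A₀ : 1 ≤ A₀
    1≤A₀ = ℕₚ.∸-monoˡ-≤ 1 (ℕₚ.≤-trans 2≤n (ℕₚ.m≤m+n n a))
    1≤B₀ : 1 ≤ B₀
    1≤B₀ = ℕₚ.∸-monoˡ-≤ 1 (ℕₚ.≤-trans 2≤n (ℕₚ.m≤m+n n b))
    1≤A₁ : 1 ≤ A₁
    1≤A₁ = ℕₚ.≤-trans (ℕₚ.<⇒≤ 2≤n) (ℕₚ.m≤m+n n a)
    1≤B₁ : 1 ≤ B₁
    1≤B₁ = ℕₚ.≤-trans (ℕₚ.<⇒≤ 2≤n) (ℕₚ.m≤m+n n b)

    product₄ : ∀ i j k l → ℕtoℚ (i * j * k * l) ≡ ℕtoℚ i *ℚ ℕtoℚ j *ℚ ℕtoℚ k *ℚ ℕtoℚ l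
    product₄ i j k l = trans (ℕtoℚ-* (i * j * k) l) (cong (_*ℚ ℕtoℚ l) (product₃ i j k))

    product₅ : ∀ i j k l m → ℕtoℚ (i * j * k * l * m) ≡ ℕtoℚ i *ℚ ℕtoℚ j *ℚ ℕtoℚ k *ℚ ℕtoℚ l *ℚ ℕtoℚ m
    product₅ i j k l m = trans (ℕtoℚ-* (i * j * k * l) m) (cong (_*ℚ ℕtoℚ m) (product₄ i j k l))

    cleared : ∀ x₁ x₃ x₄ x₅ α A₁ A₀ B₁ B₀ i₁ i₀ j₁ j₀ → i₁ *ℚ A₁ ≡ 1ℚ → i₀ *ℚ A₀ ≡ 1ℚ → j₁ *ℚ B₁ ≡ 1ℚ → j₀ *ℚ B₀ ≡ 1ℚ →
      ((x₁ *ℚ j₀ -ℚ (α +ℚ x₃ *ℚ (i₁ *ℚ i₀))) +ℚ (x₅ *ℚ j₁ -ℚ x₄ *ℚ i₁)) *ℚ (A₁ *ℚ A₀ *ℚ B₁ *ℚ B₀)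
      ≡ (x₁ *ℚ A₁ *ℚ A₀ *ℚ B₁ +ℚ x₅ *ℚ A₁ *ℚ A₀ *ℚ B₀) -ℚ ((α *ℚ A₁ *ℚ A₀ *ℚ B₁ *ℚ B₀ +ℚ x₃ *ℚ B₁ *ℚ B₀) +ℚ x₄ *ℚ A₀ *ℚ B₁ *ℚ B₀)
    cleared x₁ x₃ x₄ x₅ α A₁ A₀ B₁ B₀ i₁ i₀ j₁ j₀ e₁ e₀ f₁ f₀ = begin
      ((x₁ *ℚ j₀ -ℚ (α +ℚ x₃ *ℚ (i₁ *ℚ i₀))) +ℚ (x₅ *ℚ j₁ -ℚ x₄ *ℚ i₁)) *ℚ (A₁ *ℚ A₀ *ℚ B₁ *ℚ B₀)
        ≡⟨ solve 13 (λ x₁ x₃ x₄ x₅ α A₁ A₀ B₁ B₀ i₁ i₀ j₁ j₀ →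
             ((x₁ :* j₀ :- (α :+ x₃ :* (i₁ :* i₀))) :+ (x₅ :* j₁ :- x₄ :* i₁)) :* (A₁ :* A₀ :* B₁ :* B₀)
             := ((j₀ :* B₀) :* (x₁ :* A₁ :* A₀ :* B₁) :+ (j₁ :* B₁) :* (x₅ :* A₁ :* A₀ :* B₀))
                :- ((α :* A₁ :* A₀ :* B₁ :* B₀ :+ (i₁ :* A₁) :* ((i₀ :* A₀) :* (x₃ :* B₁ :* B₀))) :+ (i₁ :* A₁) :* (x₄ :* A₀ :* B₁ :* B₀)))
             refl x₁ x₃ x₄ x₅ α A₁ A₀ B₁ B₀ i₁ i₀ j₁ j₀ ⟩
      ((j₀ *ℚ B₀) *ℚ y₁ +ℚ (j₁ *ℚ B₁) *ℚ y₅) -ℚ ((y₂ +ℚ (i₁ *ℚ A₁) *ℚ ((i₀ *ℚ A₀) *ℚ y₃)) +ℚ (i₁ *ℚ A₁) *ℚ y₄)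
        ≡⟨ cong₂ _-ℚ_ (cong₂ _+ℚ_ (unit y₁ f₀) (unit y₅ f₁))
             (cong₂ _+ℚ_ (cong (y₂ +ℚ_) (trans (unit ((i₀ *ℚ A₀) *ℚ y₃) e₁) (unit y₃ e₀))) (unit y₄ e₁)) ⟩
      (y₁ +ℚ y₅) -ℚ ((y₂ +ℚ y₃) +ℚ y₄) ∎
      where
      open ≡-Reasoning
      open ℚ-Solver.+-*-Solver using (solve; _:*_; _:+_; _:-_; _:=_)
      y₁ = x₁ *ℚ A₁ *ℚ A₀ *ℚ B₁
      y₂ = α *ℚ A₁ *ℚ A₀ *ℚ B₁ *ℚ B₀
      y₃ = x₃ *ℚ B₁ *ℚ B₀
      y₄ = x₄ *ℚ A₀ *ℚ B₁ *ℚ B₀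
      y₅ = x₅ *ℚ A₁ *ℚ A₀ *ℚ B₀
      unit : ∀ y {p} → p ≡ 1ℚ → p *ℚ y ≡ y
      unit y refl = ℚₚ.*-identityˡ y

  -- The negative terms are moved to the other side of the hypothesis, which thereby becomes an
  -- equation in ℕ for the ring solver.
  pairLimit-cleared : ∀ r → x₁ * A₁ * A₀ * B₁ + x₅ * A₁ * A₀ * B₀ ≡ r + ((a * A₁ * A₀ * B₁ * B₀ + x₃ * B₁ * B₀) + x₄ * A₀ * B₁ * B₀) →
    pairLimit n b a *ℚ ℕtoℚ (A₁ * A₀ * B₁ * B₀) ≡ ℕtoℚ r
  pairLimit-cleared r e = begin
    pairLimit n b a *ℚ ℕtoℚ (A₁ * A₀ * B₁ * B₀)
      ≡⟨ cong (pairLimit n b a *ℚ_) (product₄ A₁ A₀ B₁ B₀) ⟩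
    pairLimit n b a *ℚ (ℕtoℚ A₁ *ℚ ℕtoℚ A₀ *ℚ ℕtoℚ B₁ *ℚ ℕtoℚ B₀)
      ≡⟨ cleared (ℕtoℚ x₁) (ℕtoℚ x₃) (ℕtoℚ x₄) (ℕtoℚ x₅) (ℕtoℚ a) (ℕtoℚ A₁) (ℕtoℚ A₀) (ℕtoℚ B₁) (ℕtoℚ B₀)
           (inv A₁) (inv A₀) (inv B₁) (inv B₀) (inv-* 1≤A₁) (inv-* 1≤A₀) (inv-* 1≤B₁) (inv-* 1≤B₀) ⟩
    (ℕtoℚ x₁ *ℚ ℕtoℚ A₁ *ℚ ℕtoℚ A₀ *ℚ ℕtoℚ B₁ +ℚ ℕtoℚ x₅ *ℚ ℕtoℚ A₁ *ℚ ℕtoℚ A₀ *ℚ ℕtoℚ B₀)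
      -ℚ ((ℕtoℚ a *ℚ ℕtoℚ A₁ *ℚ ℕtoℚ A₀ *ℚ ℕtoℚ B₁ *ℚ ℕtoℚ B₀ +ℚ ℕtoℚ x₃ *ℚ ℕtoℚ B₁ *ℚ ℕtoℚ B₀) +ℚ ℕtoℚ x₄ *ℚ ℕtoℚ A₀ *ℚ ℕtoℚ B₁ *ℚ ℕtoℚ B₀)
      ≡⟨ sym (cong₂ _-ℚ_
           (trans (ℕtoℚ-+ (x₁ * A₁ * A₀ * B₁) (x₅ * A₁ * A₀ * B₀)) (cong₂ _+ℚ_ (product₄ x₁ A₁ A₀ B₁) (product₄ x₅ A₁ A₀ B₀)))
           (trans (ℕtoℚ-+ (a * A₁ * A₀ * B₁ * B₀ + x₃ * B₁ * B₀) (x₄ * A₀ * B₁ * B₀))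
             (cong₂ _+ℚ_ (trans (ℕtoℚ-+ (a * A₁ * A₀ * B₁ * B₀) (x₃ * B₁ * B₀)) (cong₂ _+ℚ_ (product₅ a A₁ A₀ B₁ B₀) (product₃ x₃ B₁ B₀)))
               (product₄ x₄ A₀ B₁ B₀)))) ⟩
    ℕtoℚ (x₁ * A₁ * A₀ * B₁ + x₅ * A₁ * A₀ * B₀) -ℚ ℕtoℚ s
      ≡⟨ cong (_-ℚ ℕtoℚ s) (trans (cong ℕtoℚ e) (ℕtoℚ-+ r s)) ⟩
    (ℕtoℚ r +ℚ ℕtoℚ s) -ℚ ℕtoℚ s
      ≡⟨ solve 2 (λ r s → (r :+ s) :- s := r) refl (ℕtoℚ r) (ℕtoℚ s) ⟩
    ℕtoℚ r ∎
    where
    open ≡-Reasoning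
    open ℚ-Solver.+-*-Solver using (solve; _:+_; _:-_; _:=_)
    s = (a * A₁ * A₀ * B₁ * B₀ + x₃ * B₁ * B₀) + x₄ * A₀ * B₁ * B₀

pairLimit-diagonal : ∀ {n a} → 2 ≤ n → a < n → pairLimit n a a ≡ 0ℚ
pairLimit-diagonal {n} {a} 2≤n a<n = *-cancelʳ-ℕ ((n + a) * (n + a ∸ 1) * (n + a) * (n + a ∸ 1))
    (ℕₚ.*-mono-≤ (ℕₚ.*-mono-≤ (ℕₚ.*-mono-≤ 1≤A₁ 1≤A₀) 1≤A₁) 1≤A₀)
    (trans (pairLimit-cleared n a a 2≤n 0 (identity (n ∸ suc a) (sym (ℕₚ.m+[n∸m]≡n a<n)))) (sym (ℚₚ.*-zeroˡ (ℕtoℚ ((n + a) * (n + a ∸ 1) * (n + a) * (n + a ∸ 1))))))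
  where
  1≤A₁ : 1 ≤ n + a
  1≤A₁ = ℕₚ.≤-trans (ℕₚ.<⇒≤ 2≤n) (ℕₚ.m≤m+n n a)
  1≤A₀ : 1 ≤ n + a ∸ 1
  1≤A₀ = ℕₚ.∸-monoˡ-≤ 1 (ℕₚ.≤-trans 2≤n (ℕₚ.m≤m+n n a))
  identity : ∀ v → n ≡ suc a + v → a * (suc n ∸ a) * (n + a) * (n + a ∸ 1) * (n + a) + 2 * n * a * (n + a) * (n + a ∸ 1) * (n + a ∸ 1)
    ≡ 0 + ((a * (n + a) * (n + a ∸ 1) * (n + a) * (n + a ∸ 1) + 2 * a * (2 * n + a ∸ 1) * (n + a) * (n + a ∸ 1)) + 2 * a * (n ∸ 1 ∸ a) * (n + a ∸ 1) * (n + a) * (n + a ∸ 1))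
  identity v refl rewrite ℕₚ.m+n∸m≡n a v | trans (cong (_∸ a) (sym (trans (ℕₚ.+-suc a (suc v)) (cong suc (ℕₚ.+-suc a v))))) (ℕₚ.m+n∸m≡n a (2 + v)) = poly a v
    where
    poly : ∀ a v → a * (2 + v) * (suc a + v + a) * (a + v + a) * (suc a + v + a) + 2 * (suc a + v) * a * (suc a + v + a) * (a + v + a) * (a + v + a)
      ≡ 0 + ((a * (suc a + v + a) * (a + v + a) * (suc a + v + a) * (a + v + a)
        + 2 * a * (a + v + (suc a + v + 0) + a) * (suc a + v + a) * (a + v + a)) + 2 * a * v * (a + v + a) * (suc a + v + a) * (a + v + a))
    poly = ℕ-Ring.solve-∀

-- The shift of b and c by one matches the counting of good words: site 0 takes one Z, and the
-- leading Y is split off.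
pairLimit-closed : ∀ a d e → let b = a + d ; c = b + suc e in
  pairLimit (suc c) (suc b) a *ℚ ℕtoℚ (denominator a b c) ≡ ℕtoℚ (suc d * polyR a d (suc e))
pairLimit-closed a d e = trans (cong (λ k → pairLimit n b a *ℚ ℕtoℚ k) (reorder a (a + d) (a + d + suc e)))
  (pairLimit-cleared n b a (s≤s (subst (1 ≤_) (sym (ℕₚ.+-suc (a + d) e)) (s≤s z≤n))) (suc d * polyR a d (suc e)) identity)
  where
  b = suc (a + d)
  n = suc (a + d + suc e)
  reorder : ∀ a b c → (suc c + a) * (c + a) * ((2 + (b + c)) * suc (b + c)) ≡ (suc c + a) * (c + a) * (suc c + suc b) * (c + suc b)
  reorder = ℕ-Ring.solve-∀
  identity : b * (suc n ∸ b) * (n + a) * (n + a ∸ 1) * (n + b) + 2 * n * a * (n + a) * (n + a ∸ 1) * (n + b ∸ 1)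
    ≡ suc d * polyR a d (suc e) + ((a * (n + a) * (n + a ∸ 1) * (n + b) * (n + b ∸ 1) + 2 * a * (2 * n + a ∸ 1) * (n + b) * (n + b ∸ 1))
      + 2 * a * (n ∸ 1 ∸ b) * (n + a ∸ 1) * (n + b) * (n + b ∸ 1))
  identity rewrite trans (cong (_∸ (a + d)) (sym (ℕₚ.+-suc (a + d) (suc e)))) (ℕₚ.m+n∸m≡n (a + d) (2 + e))
                 | trans (cong (_∸ suc (a + d)) (ℕₚ.+-suc (a + d) e)) (ℕₚ.m+n∸m≡n (a + d) e) = poly a d e
    where
    poly : ∀ a d e → suc (a + d) * (2 + e) * (suc (a + d + suc e) + a) * (a + d + suc e + a) * (suc (a + d + suc e) + suc (a + d))
        + 2 * suc (a + d + suc e) * a * (suc (a + d + suc e) + a) * (a + d + suc e + a) * (a + d + suc e + suc (a + d))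
      ≡ suc d * (
          a * a * (4 * d * suc e + 2 * d + 4 * suc e * suc e + 8 * suc e)
        + a * (6 * d * d * suc e + 4 * d * d + 10 * d * suc e * suc e + 18 * d * suc e + 4 * d + 4 * suc e * suc e * suc e + 12 * suc e * suc e + 8 * suc e)
        + (2 * d * d * d * suc e + 2 * d * d * d + 5 * d * d * suc e * suc e + 9 * d * d * suc e + 4 * d * d + 4 * d * suc e * suc e * suc e
           + 11 * d * suc e * suc e + 9 * d * suc e + 2 * d + suc e * suc e * suc e * suc e + 4 * suc e * suc e * suc e + 5 * suc e * suc e + 2 * suc e))
        + ((a * (suc (a + d + suc e) + a) * (a + d + suc e + a) * (suc (a + d + suc e) + suc (a + d)) * (a + d + suc e + suc (a + d))
          + 2 * a * (a + d + suc e + (suc (a + d + suc e) + 0) + a) * (suc (a + d + suc e) + suc (a + d)) * (a + d + suc e + suc (a + d)))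
          + 2 * a * e * (a + d + suc e + a) * (suc (a + d + suc e) + suc (a + d)) * (a + d + suc e + suc (a + d)))
    poly = ℕ-Ring.solve-∀

-- Limits over stationary laws

Limit : ℕ → (ℕ → (List ℕ → ℚ) → ℚ) → ℚ → Set
Limit n f v = (ε : ℚ) → 0ℚ <ℚ ε →
  ∃[ L₀ ] ((L : ℕ) → L₀ ≤ L → (π : List ℕ → ℚ) → IsStationary n L π → ∣ f L π -ℚ v ∣ <ℚ ε)

Limit-cong : ∀ {n f g v} → (∀ L π → f L π ≡ g L π) → Limit n f v → Limit n g v
Limit-cong {v = v} e lim ε 0<ε = proj₁ (lim ε 0<ε) , λ L le π stat →
  subst (λ p → ∣ p -ℚ v ∣ <ℚ ε) (e L π) (proj₂ (lim ε 0<ε) L le π stat)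

Limit-0 : ∀ {n f} → (∀ L π → f L π ≡ 0ℚ) → Limit n f 0ℚ
Limit-0 e ε 0<ε = 0 , λ L _ π _ → subst (λ p → ∣ p -ℚ 0ℚ ∣ <ℚ ε) (sym (e L π)) 0<ε

Limit-- : ∀ {n f g u v} → Limit n f u → Limit n g v → Limit n (λ L π → f L π -ℚ g L π) (u -ℚ v)
Limit-- {n} {f} {g} {u} {v} lf lg ε 0<ε = proj₁ F ℕ.⊔ proj₁ G , λ L le π stat →
  subst (λ p → ∣ p ∣ <ℚ ε) (rearrange (f L π) (g L π) u v)
    (ℚₚ.≤-<-trans (ℚₚ.∣p-q∣≤∣p∣+∣q∣ (f L π -ℚ u) (g L π -ℚ v))
      (subst (∣ f L π -ℚ u ∣ +ℚ ∣ g L π -ℚ v ∣ <ℚ_) (halves ε)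
        (ℚₚ.+-mono-< (proj₂ F L (ℕₚ.≤-trans (ℕₚ.m≤m⊔n (proj₁ F) (proj₁ G)) le) π stat)
                     (proj₂ G L (ℕₚ.≤-trans (ℕₚ.m≤n⊔m (proj₁ F) (proj₁ G)) le) π stat))))
  where
  open ℚ-Solver.+-*-Solver using (solve; _:+_; _:-_; _:*_; con; _:=_)
  half-pos : 0ℚ <ℚ ε *ℚ ℚ.½
  half-pos = subst (_<ℚ ε *ℚ ℚ.½) (ℚₚ.*-zeroˡ ℚ.½) (ℚₚ.*-monoˡ-<-pos ℚ.½ 0<ε)
  F = lf (ε *ℚ ℚ.½) half-pos
  G = lg (ε *ℚ ℚ.½) half-pos
  halves : ∀ ε → ε *ℚ ℚ.½ +ℚ ε *ℚ ℚ.½ ≡ ε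
  halves = solve 1 (λ ε → ε :* con ℚ.½ :+ ε :* con ℚ.½ := ε) refl
  rearrange : ∀ f g u v → (f -ℚ u) -ℚ (g -ℚ v) ≡ (f -ℚ g) -ℚ (u -ℚ v)
  rearrange = solve 4 (λ f g u v → (f :- u) :- (g :- v) := (f :- g) :- (u :- v)) refl

≤-numerator : ∀ q → q ≤ℚ ℕtoℚ ℤ.∣ ℚ.↥ q ∣
≤-numerator q@(ℚ.mkℚ (ℤ.+ k) d _) = ℚₚ.toℚᵘ-cancel-≤ (ℚᵘₚ.≤-respʳ-≃ (ℚᵘₚ.≃-sym (toℚᵘ-ℕtoℚ k))
  (ℚᵘ.*≤* (subst (ℤ._≤ ℤ.+ k ℤ.* ℤ.+ suc d) (sym (ℤₚ.*-identityʳ (ℤ.+ k))) (subst (ℤ.+ k ℤ.≤_) (ℤₚ.pos-* k (suc d)) (ℤ.+≤+ (ℕₚ.m≤m*n k (suc d)))))))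
≤-numerator q@(ℚ.mkℚ (ℤ.-[1+ k ]) d _) = ℚₚ.≤-trans (ℚₚ.<⇒≤ (ℚₚ.negative⁻¹ q)) (ℕtoℚ-mono-≤ {0} {suc k} z≤n)

1≤denominator* : ∀ ε → 0ℚ <ℚ ε → 1ℚ ≤ℚ ℕtoℚ (ℚ.↧ₙ ε) *ℚ ε
1≤denominator* ε 0<ε = subst (1ℚ ≤ℚ_)
  (trans (sym (frac-* k d)) (trans (ℚₚ.*-comm (frac k (suc d)) (ℕtoℚ (suc d))) (cong (ℕtoℚ (suc d) *ℚ_) ε≡))) (ℕtoℚ-mono-≤ 1≤k)
  where
  d = ℚ.denominator-1 ε
  k = ℤ.∣ ℚ.↥ ε ∣
  numerator-pos : ∀ ε → 0ℚ <ℚ ε → ℚ.↥ ε ≡ ℤ.+ ℤ.∣ ℚ.↥ ε ∣ × 1 ≤ ℤ.∣ ℚ.↥ ε ∣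
  numerator-pos (ℚ.mkℚ ℤ.+[1+ k ] d _) _   = refl , s≤s z≤n
  numerator-pos (ℚ.mkℚ ℤ.+0 d c) 0<ε       = contradiction 0<ε (ℚₚ.<-irrefl (sym (ℚₚ.↥p≡0⇒p≡0 (ℚ.mkℚ ℤ.+0 d c) refl)))
  numerator-pos ε@(ℚ.mkℚ ℤ.-[1+ k ] d _) 0<ε = contradiction 0<ε (ℚₚ.<-asym (ℚₚ.negative⁻¹ ε))
  1≤k : 1 ≤ k
  1≤k = proj₂ (numerator-pos ε 0<ε)
  ε≡ : frac k (suc d) ≡ ε
  ε≡ = trans (cong (λ i → i ℚ./ suc d) (sym (proj₁ (numerator-pos ε 0<ε)))) (ℚₚ.↥p/↧p≡p ε)

-- The absolute value of its numerator bounds q, and the reciprocal of its denominator bounds ε from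
-- below. The witness multiplies the two, with one added to the first for strictness.
archimedean : ∀ q ε → 0ℚ <ℚ ε → ∃[ m ] (q <ℚ ℕtoℚ m *ℚ ε)
archimedean q ε 0<ε = suc k * ℚ.↧ₙ ε , ℚₚ.≤-<-trans (≤-numerator q) (ℚₚ.<-≤-trans (ℕtoℚ-mono-< (ℕₚ.n<1+n k))
  (subst (ℕtoℚ (suc k) ≤ℚ_) (trans (sym (ℚₚ.*-assoc (ℕtoℚ (suc k)) (ℕtoℚ (ℚ.↧ₙ ε)) ε)) (cong (_*ℚ ε) (sym (ℕtoℚ-* (suc k) (ℚ.↧ₙ ε)))))
    (subst (_≤ℚ ℕtoℚ (suc k) *ℚ (ℕtoℚ (ℚ.↧ₙ ε) *ℚ ε)) (ℚₚ.*-identityʳ (ℕtoℚ (suc k)))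
      (ℚₚ.*-monoˡ-≤-nonNeg (ℕtoℚ (suc k)) {{ℚ.nonNegative (ℕtoℚ-mono-≤ {0} {suc k} z≤n)}} (1≤denominator* ε 0<ε)))))
  where k = ℤ.∣ ℚ.↥ q ∣

-- If E exceeds H, the first estimate suffices. Otherwise the error bound involves E itself, and κ ≤
-- M turns the first estimate into E ≤ 2H.
sandwich : ∀ M κ E H → 0ℚ <ℚ M → 0ℚ ≤ℚ κ → κ ≤ℚ M → 0ℚ ≤ℚ H → M *ℚ E ≤ℚ (M +ℚ κ) *ℚ H → M *ℚ H ≤ℚ (M +ℚ κ) *ℚ E →
           M *ℚ ∣ E -ℚ H ∣ ≤ℚ κ *ℚ (H +ℚ H)
sandwich M κ E H 0<M 0≤κ κ≤M 0≤H above below′ with ℚₚ.∣p∣≡p∨∣p∣≡-p (E -ℚ H)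
... | inj₁ e = subst (λ p → M *ℚ p ≤ℚ κ *ℚ (H +ℚ H)) (sym e) (ℚₚ.≤-trans (difference M κ E H above) κH≤)
  where
  open ℚ-Solver.+-*-Solver using (solve; _:+_; _:-_; _:*_; _:=_)
  κH≤ : κ *ℚ H ≤ℚ κ *ℚ (H +ℚ H)
  κH≤ = ℚₚ.*-monoˡ-≤-nonNeg κ {{ℚ.nonNegative 0≤κ}} (subst (_≤ℚ H +ℚ H) (ℚₚ.+-identityʳ H) (ℚₚ.+-monoʳ-≤ H 0≤H))
  difference : ∀ M κ E H → M *ℚ E ≤ℚ (M +ℚ κ) *ℚ H → M *ℚ (E -ℚ H) ≤ℚ κ *ℚ H
  difference M κ E H le = subst₂ _≤ℚ_ (solve 3 (λ M E H → M :* E :- M :* H := M :* (E :- H)) refl M E H)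
    (solve 3 (λ M κ H → (M :+ κ) :* H :- M :* H := κ :* H) refl M κ H) (ℚₚ.+-monoˡ-≤ (-ℚ (M *ℚ H)) le)
... | inj₂ e = subst (λ p → M *ℚ p ≤ℚ κ *ℚ (H +ℚ H)) (sym (trans e (solve 2 (λ E H → :- (E :- H) := H :- E) refl E H)))
    (ℚₚ.≤-trans difference (ℚₚ.*-monoˡ-≤-nonNeg κ {{ℚ.nonNegative 0≤κ}} E≤2H))
  where
  open ℚ-Solver.+-*-Solver using (solve; _:+_; _:-_; _:*_; :-_; _:=_)
  difference : M *ℚ (H -ℚ E) ≤ℚ κ *ℚ E
  difference = subst₂ _≤ℚ_ (solve 3 (λ M E H → M :* H :- M :* E := M :* (H :- E)) refl M E H)
    (solve 3 (λ M κ E → (M :+ κ) :* E :- M :* E := κ :* E) refl M κ E) (ℚₚ.+-monoˡ-≤ (-ℚ (M *ℚ E)) below′)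
  E≤2H : E ≤ℚ H +ℚ H
  E≤2H = ℚₚ.*-cancelˡ-≤-pos M {{ℚ.positive 0<M}} (ℚₚ.≤-trans above
    (subst ((M +ℚ κ) *ℚ H ≤ℚ_) (solve 2 (λ M H → (M :+ M) :* H := M :* (H :+ H)) refl M H)
      (ℚₚ.*-monoʳ-≤-nonNeg H {{ℚ.nonNegative 0≤H}} (ℚₚ.+-monoʳ-≤ M κ≤M))))

-- The factorials in the count of good words and in the multinomial coefficient agree, so their
-- ratio is `suc d * polyR a d (suc e)` over `denominator`, the rational function that `pairLimit`
-- splits into parts. On the diagonal a = b both sides vanish.
good-ratio : ∀ N n b a → N ≡ a + b + n → a ≤ b → b ≤ n → 2 ≤ suc n →
  ℕtoℚ (suc N * contentCount N a b n good) ≡ pairLimit (suc n) b a *ℚ ℕtoℚ (contentCount (suc N) a b (suc n) (λ _ → true))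
good-ratio N n b a eN a≤b b≤n 2≤n with ℕₚ.m≤n⇒m<n∨m≡n a≤b
... | inj₂ refl = trans (cong ℕtoℚ (trans (cong (suc N *_) (good-count-diagonal N a n)) (ℕₚ.*-zeroʳ (suc N))))
  (sym (trans (cong (_*ℚ ℕtoℚ W) (pairLimit-diagonal 2≤n (s≤s b≤n))) (ℚₚ.*-zeroˡ (ℕtoℚ W))))
  where W = contentCount (suc N) a a (suc n) (λ _ → true)
... | inj₁ a<b = off-diagonal N b (b ∸ suc a) n (n ∸ b) (sym (ℕₚ.m+[n∸m]≡n a<b)) (sym (ℕₚ.m+[n∸m]≡n b≤n)) eN
  where
  off-diagonal : ∀ N b d n e → b ≡ suc (a + d) → n ≡ b + e → N ≡ a + b + n →
    ℕtoℚ (suc N * contentCount N a b n good) ≡ pairLimit (suc n) b a *ℚ ℕtoℚ (contentCount (suc N) a b (suc n) (λ _ → true))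
  off-diagonal zero b d n e refl _ eN = contradiction (trans eN (cong (_+ n) (ℕₚ.+-suc a (a + d)))) λ ()
  off-diagonal (suc N) .(suc (a + d)) d .(suc (a + d) + e) e refl refl eN = *-cancelʳ-ℕ D 1≤D (begin
    ℕtoℚ (suc (suc N) * h) *ℚ ℕtoℚ D    ≡⟨ sym (ℕtoℚ-* (suc (suc N) * h) D) ⟩
    ℕtoℚ (suc (suc N) * h * D)          ≡⟨ cong ℕtoℚ natural ⟩
    ℕtoℚ (W * R)                        ≡⟨ ℕtoℚ-* W R ⟩
    ℕtoℚ W *ℚ ℕtoℚ R                    ≡⟨ cong (ℕtoℚ W *ℚ_) (sym limit) ⟩
    ℕtoℚ W *ℚ (H *ℚ ℕtoℚ D)             ≡⟨ solve 3 (λ w h d → w :* (h :* d) := h :* w :* d) refl (ℕtoℚ W) H (ℕtoℚ D) ⟩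
    H *ℚ ℕtoℚ W *ℚ ℕtoℚ D               ∎)
    where
    open ≡-Reasoning
    open ℚ-Solver.+-*-Solver using (solve; _:*_; _:=_)
    b₀ = a + d
    n₀ = suc b₀ + e
    h = contentCount (suc N) a (suc b₀) n₀ good
    W = contentCount (suc (suc N)) a (suc b₀) (suc n₀) (λ _ → true)
    R = suc d * polyR a d (suc e)
    D = denominator a b₀ n₀
    H = pairLimit (suc n₀) (suc b₀) a
    A = a ! * (suc b₀) ! * (suc n₀) !
    eN′ : N ≡ a + b₀ + n₀
    eN′ = ℕₚ.suc-injective (trans eN (cong (_+ n₀) (ℕₚ.+-suc a b₀)))
    n≡ : n₀ ≡ b₀ + suc e
    n≡ = sym (ℕₚ.+-suc b₀ e)
    limit : H *ℚ ℕtoℚ D ≡ ℕtoℚ R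
    limit = subst (λ n₀ → pairLimit (suc n₀) (suc b₀) a *ℚ ℕtoℚ (denominator a b₀ n₀) ≡ ℕtoℚ R) (sym n≡) (pairLimit-closed a d e)
    1≤D : 1 ≤ D
    1≤D = ℕₚ.*-mono-≤ (ℕₚ.*-mono-≤ {1} {suc n₀ + a} {1} {n₀ + a} (s≤s z≤n) (s≤s z≤n)) (ℕₚ.*-mono-≤ {1} {2 + (b₀ + n₀)} {1} {suc (b₀ + n₀)} (s≤s z≤n) (s≤s z≤n))
    h-closed : h * A * D ≡ (suc N) ! * R
    h-closed = trans (cong (λ k → k * A * D) (good-count-suc N a (suc b₀) n₀))
      (countB-closed N (0 , 1) a b₀ n₀ d (suc e) refl n≡ eN′ (s≤s z≤n) (s≤s z≤n))
    W-closed : W * A ≡ (suc (suc N)) !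
    W-closed = multinomial (suc (suc N)) a (suc b₀) (suc n₀) (trans (cong suc eN) (sym (ℕₚ.+-suc (a + suc b₀) n₀)))
    A≢0 : NonZero A
    A≢0 = ℕ.>-nonZero (ℕₚ.*-mono-≤ (ℕₚ.*-mono-≤ (ℕₚ.1≤n! a) (ℕₚ.1≤n! (suc b₀))) (ℕₚ.1≤n! (suc n₀)))
    natural : suc (suc N) * h * D ≡ W * R
    natural = ℕₚ.*-cancelʳ-≡ _ _ A {{A≢0}} (begin
      suc (suc N) * h * D * A             ≡⟨ shuffle₁ (suc (suc N)) h D A ⟩
      suc (suc N) * (h * A * D)           ≡⟨ cong (suc (suc N) *_) h-closed ⟩
      suc (suc N) * ((suc N) ! * R)       ≡⟨ sym (ℕₚ.*-assoc (suc (suc N)) ((suc N) !) R) ⟩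
      (suc (suc N)) ! * R                 ≡⟨ cong (_* R) (sym W-closed) ⟩
      W * A * R                           ≡⟨ shuffle₂ W A R ⟩
      W * R * A                           ∎)
      where
      shuffle₁ : ∀ m h D A → m * h * D * A ≡ m * (h * A * D)
      shuffle₁ = ℕ-Ring.solve-∀
      shuffle₂ : ∀ W A R → W * A * R ≡ W * R * A
      shuffle₂ = ℕ-Ring.solve-∀

-- Convergence of the expected number of pairs

module _ (n b a : ℕ) (2≤n : 2 ≤ suc n) (a≤b : a ≤ b) (b≤n : b ≤ n) where

  private
    N = a + b + n
    φ ψ : List Letter → ℕ
    φ w = 𝟏 (has a b n w ∧ good w)
    ψ w = 𝟏 (has a b (suc n) w)
    φ-len : OfLength N φ
    φ-len = content-OfLength a b n good refl
    ψ-len : OfLength (suc N) ψ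
    ψ-len w ne with has a b (suc n) w in e
    ... | true  = contradiction (trans (has-length a b (suc n) w e) (ℕₚ.+-suc (a + b) n)) ne
    ... | false = refl
    h = wordsCount N φ
    W = wordsCount (suc N) ψ
    H = pairLimit (suc n) b a
    W≡ : W ≡ contentCount (suc N) a b (suc n) (λ _ → true)
    W≡ = wordsCount-cong (suc N) (λ w → cong 𝟏 (sym (∧-true (has a b (suc n) w))))

    ratio : ℕtoℚ (suc N * h) ≡ H *ℚ ℕtoℚ W
    ratio = trans (good-ratio N n b a refl a≤b b≤n 2≤n) (cong (λ k → H *ℚ ℕtoℚ k) (sym W≡))

    1≤W : 1 ≤ W
    1≤W = ℕₚ.n≢0⇒n>0 λ W≡0 → ℕₚ.<⇒≢ (ℕₚ.1≤n! (suc N)) (trans (sym (cong (_* (a ! * b ! * (suc n) !)) (trans (sym W≡) W≡0)))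
      (multinomial (suc N) a b (suc n) (sym (ℕₚ.+-suc (a + b) n))))

    -- The sign is not visible in the expression for `pairLimit`; it comes from being a quotient of
    -- two counts.
    0≤H : 0ℚ ≤ℚ H
    0≤H = subst (0ℚ ≤ℚ_) (sym (frac-unique W 1≤W (sym ratio))) (frac-nonneg (suc N * h) W)
      where
      frac-nonneg : ∀ p k → 0ℚ ≤ℚ frac p k
      frac-nonneg p zero    = ℚₚ.≤-refl
      frac-nonneg p (suc k) = ℚₚ.nonNegative⁻¹ (frac p (suc k)) {{ℚₚ.normalize-nonNeg p (suc k)}}

    module _ (m l : ℕ) (1≤m : 1 ≤ m) {π : List ℕ → ℚ} (stat : IsStationary (suc n) (2 + l) π)
             (L≡ : Comparison.L′ N φ-len ψ-len m ≡ suc l) where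

      open Comparison N φ-len ψ-len m using (K)
      x z : ℕ
      x = columnsCount (suc l) φ
      z = columnsCount (2 + l) ψ
      E : ℚ
      E = expectedPairs (suc n) (2 + l) π b a

      E-count : ℕtoℚ z *ℚ E ≡ ℕtoℚ ((2 + l) * x)
      E-count = begin
        ℕtoℚ z *ℚ E
          ≡⟨ cong (λ k → ℕtoℚ k *ℚ E) (sym (mlqs-length (2 + l) a b (suc n))) ⟩
        ℕtoℚ (length (mlqs (2 + l) a b (suc n))) *ℚ E
          ≡⟨ expectedPairs-mlqs stat a≤b (ℕₚ.m≤n⇒m≤1+n b≤n) ⟩
        ℕtoℚ (2 + l) *ℚ ∑ (mlqs (2 + l) a b (suc n)) (λ w → 𝟙 (startsPair 3 3 2 w))
          ≡⟨ cong (ℕtoℚ (2 + l) *ℚ_) (mlqs-starts (suc l) a b n) ⟩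
        ℕtoℚ (2 + l) *ℚ ℕtoℚ x
          ≡⟨ sym (ℕtoℚ-* (2 + l) x) ⟩
        ℕtoℚ ((2 + l) * x) ∎
        where open ≡-Reasoning

      upper′ : m * ((2 + l) * x * W) ≤ (m + K) * (suc N * h * z)
      upper′ = subst (λ L → m * (suc L * columnsCount L φ * W) ≤ (m + K) * (suc N * h * columnsCount (suc L) ψ)) L≡
        (Comparison.upper N φ-len ψ-len m)

      lower′ : m * (suc N * h * z) ≤ (m + K) * ((2 + l) * x * W)
      lower′ = subst (λ L → m * (suc N * h * columnsCount (suc L) ψ) ≤ (m + K) * (suc L * columnsCount L φ * W)) L≡
        (Comparison.lower N φ-len ψ-len m)

      1≤z : 1 ≤ z
      1≤z = subst (λ L → 1 ≤ columnsCount (suc L) ψ) L≡ (Comparison.z-positive N φ-len ψ-len m 1≤m 1≤W)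

      zW-pos : ℚ.Positive (ℕtoℚ (z * W))
      zW-pos = ℚ.positive (ℕtoℚ-mono-< {0} {z * W} (ℕₚ.*-mono-≤ 1≤z 1≤W))

      cast-E : ∀ k → ℕtoℚ (k * ((2 + l) * x * W)) ≡ ℕtoℚ k *ℚ E *ℚ ℕtoℚ (z * W)
      cast-E k = begin
        ℕtoℚ (k * ((2 + l) * x * W))               ≡⟨ ℕtoℚ-* k ((2 + l) * x * W) ⟩
        ℕtoℚ k *ℚ ℕtoℚ ((2 + l) * x * W)           ≡⟨ cong (ℕtoℚ k *ℚ_) (ℕtoℚ-* ((2 + l) * x) W) ⟩
        ℕtoℚ k *ℚ (ℕtoℚ ((2 + l) * x) *ℚ ℕtoℚ W)   ≡⟨ cong (λ p → ℕtoℚ k *ℚ (p *ℚ ℕtoℚ W)) (sym E-count) ⟩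
        ℕtoℚ k *ℚ (ℕtoℚ z *ℚ E *ℚ ℕtoℚ W)
          ≡⟨ solve 4 (λ k z e w → k :* (z :* e :* w) := k :* e :* (z :* w)) refl (ℕtoℚ k) (ℕtoℚ z) E (ℕtoℚ W) ⟩
        ℕtoℚ k *ℚ E *ℚ (ℕtoℚ z *ℚ ℕtoℚ W)          ≡⟨ cong (ℕtoℚ k *ℚ E *ℚ_) (sym (ℕtoℚ-* z W)) ⟩
        ℕtoℚ k *ℚ E *ℚ ℕtoℚ (z * W) ∎
        where
        open ≡-Reasoning
        open ℚ-Solver.+-*-Solver using (solve; _:*_; _:=_)

      cast-H : ∀ k → ℕtoℚ (k * (suc N * h * z)) ≡ ℕtoℚ k *ℚ H *ℚ ℕtoℚ (z * W)
      cast-H k = begin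
        ℕtoℚ (k * (suc N * h * z))                 ≡⟨ ℕtoℚ-* k (suc N * h * z) ⟩
        ℕtoℚ k *ℚ ℕtoℚ (suc N * h * z)             ≡⟨ cong (ℕtoℚ k *ℚ_) (ℕtoℚ-* (suc N * h) z) ⟩
        ℕtoℚ k *ℚ (ℕtoℚ (suc N * h) *ℚ ℕtoℚ z)     ≡⟨ cong (λ p → ℕtoℚ k *ℚ (p *ℚ ℕtoℚ z)) ratio ⟩
        ℕtoℚ k *ℚ (H *ℚ ℕtoℚ W *ℚ ℕtoℚ z)
          ≡⟨ solve 4 (λ k h w z → k :* (h :* w :* z) := k :* h :* (z :* w)) refl (ℕtoℚ k) H (ℕtoℚ W) (ℕtoℚ z) ⟩
        ℕtoℚ k *ℚ H *ℚ (ℕtoℚ z *ℚ ℕtoℚ W)          ≡⟨ cong (ℕtoℚ k *ℚ H *ℚ_) (sym (ℕtoℚ-* z W)) ⟩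
        ℕtoℚ k *ℚ H *ℚ ℕtoℚ (z * W) ∎
        where
        open ≡-Reasoning
        open ℚ-Solver.+-*-Solver using (solve; _:*_; _:=_)

      E-above : ℕtoℚ m *ℚ E ≤ℚ (ℕtoℚ m +ℚ ℕtoℚ K) *ℚ H
      E-above = subst (λ p → ℕtoℚ m *ℚ E ≤ℚ p *ℚ H) (ℕtoℚ-+ m K) (ℚₚ.*-cancelʳ-≤-pos (ℕtoℚ (z * W)) {{zW-pos}}
        (subst₂ _≤ℚ_ (cast-E m) (cast-H (m + K)) (ℕtoℚ-mono-≤ upper′)))

      E-below : ℕtoℚ m *ℚ H ≤ℚ (ℕtoℚ m +ℚ ℕtoℚ K) *ℚ E
      E-below = subst (λ p → ℕtoℚ m *ℚ H ≤ℚ p *ℚ E) (ℕtoℚ-+ m K) (ℚₚ.*-cancelʳ-≤-pos (ℕtoℚ (z * W)) {{zW-pos}}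
        (subst₂ _≤ℚ_ (cast-H m) (cast-E (m + K)) (ℕtoℚ-mono-≤ lower′)))

      E-close : K ≤ m → ℕtoℚ m *ℚ ∣ E -ℚ H ∣ ≤ℚ ℕtoℚ K *ℚ (H +ℚ H)
      E-close K≤m = sandwich (ℕtoℚ m) (ℕtoℚ K) E H (ℕtoℚ-mono-< 1≤m) (ℕtoℚ-mono-≤ {0} {K} z≤n) (ℕtoℚ-mono-≤ K≤m) 0≤H E-above E-below

  expectedPairs-limit : Limit (suc n) (λ L π → expectedPairs (suc n) L π b a) (pairLimit (suc n) b a)
  expectedPairs-limit ε 0<ε = L₀ , close
    where
    c = 2 * N + 2
    K = suc N * c
    M = archimedean (ℕtoℚ K *ℚ (H +ℚ H)) ε 0<ε
    -- Ensures m ≥ 1, `K ≤ m` for `sandwich`, and m ε > 2 K H for the final estimate.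
    m₀ = suc (K + proj₁ M)
    L₀ = suc (N + N * c + m₀)
    close : (L : ℕ) → L₀ ≤ L → (π : List ℕ → ℚ) → IsStationary (suc n) L π → ∣ expectedPairs (suc n) L π b a -ℚ H ∣ <ℚ ε
    close zero () π stat
    close (suc zero) (s≤s le) π stat = contradiction (ℕₚ.≤-trans (ℕₚ.m≤n+m m₀ (N + N * c)) le) λ ()
    close (suc (suc l)) (s≤s le) π stat = ℚₚ.*-cancelˡ-<-nonNeg (ℕtoℚ m) {{ℚ.nonNegative (ℕtoℚ-mono-≤ {0} {m} z≤n)}}
      (ℚₚ.≤-<-trans (E-close m l (ℕₚ.≤-trans (s≤s z≤n) m₀≤m) stat L≡ (ℕₚ.≤-trans (ℕₚ.m≤m+n K (proj₁ M)) (ℕₚ.≤-trans (ℕₚ.n≤1+n _) m₀≤m)))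
        (ℚₚ.<-≤-trans (proj₂ M) (ℚₚ.*-monoʳ-≤-nonNeg ε {{ℚ.nonNegative (ℚₚ.<⇒≤ 0<ε)}}
          (ℕtoℚ-mono-≤ (ℕₚ.≤-trans (ℕₚ.m≤n+m (proj₁ M) K) (ℕₚ.≤-trans (ℕₚ.n≤1+n _) m₀≤m))))))
      where
      -- With this `m` the number `L′` of `Comparison` is exactly L - 1, the number of columns other
      -- than site 0.
      m = suc l ∸ (N + N * c)
      m₀≤m : m₀ ≤ m
      m₀≤m = subst (_≤ m) (ℕₚ.m+n∸m≡n (N + N * c) m₀) (ℕₚ.∸-monoˡ-≤ (N + N * c) le)
      L≡ : N + (m + N * c) ≡ suc l
      L≡ = trans (rearrange N m (N * c)) (ℕₚ.m+[n∸m]≡n (ℕₚ.≤-trans (ℕₚ.m≤m+n (N + N * c) m₀) le))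
        where
        rearrange : ∀ N m k → N + (m + k) ≡ N + k + m
        rearrange = ℕ-Ring.solve-∀

-- Binomial coefficients and the two cases of the formula

choose₂ : ∀ m → 2 * (suc m C 2) ≡ suc m * m
choose₂ zero    = refl
choose₂ (suc m) = begin
  2 * (suc (suc m) C 2)              ≡⟨ cong (2 *_) (sym (nCk+nC[k+1]≡[n+1]C[k+1] (suc m) 1)) ⟩
  2 * (suc m C 1 + suc m C 2)        ≡⟨ ℕₚ.*-distribˡ-+ 2 (suc m C 1) (suc m C 2) ⟩
  2 * (suc m C 1) + 2 * (suc m C 2)  ≡⟨ cong₂ (λ p q → 2 * p + q) (nC1≡n (suc m)) (choose₂ m) ⟩
  2 * suc m + suc m * m              ≡⟨ lem m ⟩
  suc (suc m) * suc m ∎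
  where
  open ≡-Reasoning
  lem : ∀ m → 2 * suc m + suc m * m ≡ suc (suc m) * suc m
  lem = ℕ-Ring.solve-∀

frac-choose₂ : ∀ p m → 1 ≤ m → frac p (suc m C 2) ≡ ℕtoℚ 2 *ℚ ℕtoℚ p *ℚ (inv (suc m) *ℚ inv m)
frac-choose₂ p m 1≤m = sym (frac-unique (suc m C 2) 1≤C (begin
  t *ℚ P *ℚ (i *ℚ i′) *ℚ ℕtoℚ (suc m C 2)
    ≡⟨ solve 5 (λ t P i i′ c → t :* P :* (i :* i′) :* c := P :* ((i :* i′) :* (t :* c))) refl t P i i′ (ℕtoℚ (suc m C 2)) ⟩
  P *ℚ ((i *ℚ i′) *ℚ (t *ℚ ℕtoℚ (suc m C 2)))
    ≡⟨ cong (λ c → P *ℚ ((i *ℚ i′) *ℚ c)) (trans (sym (ℕtoℚ-* 2 (suc m C 2))) (trans (cong ℕtoℚ (choose₂ m)) (ℕtoℚ-* (suc m) m))) ⟩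
  P *ℚ ((i *ℚ i′) *ℚ (ℕtoℚ (suc m) *ℚ ℕtoℚ m))
    ≡⟨ solve 5 (λ P i i′ x y → P :* ((i :* i′) :* (x :* y)) := P :* ((i :* x) :* (i′ :* y))) refl P i i′ (ℕtoℚ (suc m)) (ℕtoℚ m) ⟩
  P *ℚ ((i *ℚ ℕtoℚ (suc m)) *ℚ (i′ *ℚ ℕtoℚ m))
    ≡⟨ cong₂ (λ x y → P *ℚ (x *ℚ y)) (inv-* {suc m} (s≤s z≤n)) (inv-* 1≤m) ⟩
  P *ℚ (1ℚ *ℚ 1ℚ)
    ≡⟨ ℚₚ.*-identityʳ P ⟩
  P ∎))
  where
  open ≡-Reasoning
  open ℚ-Solver.+-*-Solver using (solve; _:*_; _:=_)
  t = ℕtoℚ 2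
  P = ℕtoℚ p
  i = inv (suc m)
  i′ = inv m
  1≤C : 1 ≤ suc m C 2
  1≤C = ℕₚ.n≢0⇒n>0 λ C≡0 → ℕₚ.<⇒≢ (ℕₚ.*-mono-≤ {1} {suc m} (s≤s z≤n) 1≤m) (trans (sym (cong (2 *_) C≡0)) (choose₂ m))

cFormula-< : ∀ {n i} j → i < n → cFormula n i j ≡ frac n ((n + j) C 2) -ℚ frac n ((n + i) C 2)
cFormula-< j i<n rewrite ≡ᵇ-false (ℕₚ.<⇒≢ i<n) = refl

cFormula-top : ∀ n j → cFormula n n j
  ≡ (frac (n * (j + 1)) ((n + j) C 2) -ℚ frac (n * (j ∸ 1)) ((n + j ∸ 1) C 2)) -ℚ frac n ((2 * n) C 2)
cFormula-top n j rewrite ≡ᵇ-refl n = refl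

-- Inserts the factor q x = 1 to bring reciprocals over a common product of denominators; their
-- differences are then polynomial identities in the inverses.
cross-inverse : ∀ p q x → q *ℚ x ≡ 1ℚ → p ≡ p *ℚ (q *ℚ x)
cross-inverse p q x e = sym (trans (cong (p *ℚ_) e) (ℚₚ.*-identityʳ p))

module _ (n j : ℕ) (2≤n : 2 ≤ suc n) where

  private
    N = suc n
    t = ℕtoℚ 2
    ν = ℕtoℚ N
    J = ℕtoℚ j
    p  = inv (N + j)
    p′ = inv (N + suc j)
    p-inv : p *ℚ (ν +ℚ J) ≡ 1ℚ
    p-inv = trans (cong (p *ℚ_) (sym (ℕtoℚ-+ N j))) (inv-* {N + j} (s≤s z≤n))
    p′-inv : p′ *ℚ (ν +ℚ (1ℚ +ℚ J)) ≡ 1ℚ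
    p′-inv = trans (cong (p′ *ℚ_) (sym (trans (ℕtoℚ-+ N (suc j)) (cong (ν +ℚ_) (ℕtoℚ-suc j))))) (inv-* {N + suc j} (s≤s z≤n))

  -- The second difference of `partM` is 2N (1/(N+i+1) - 1/(N+i)) + 2 ((j+1)/(N+j+1) - j/(N+j)).
  -- Each bracket collapses over its two consecutive denominators, which form the binomial
  -- coefficients of the formula.
  pairLimit-difference-< : ∀ i → i < n →
    (pairLimit N i j -ℚ pairLimit N i (suc j)) -ℚ (pairLimit N (suc i) j -ℚ pairLimit N (suc i) (suc j)) ≡ cFormula N (suc i) (suc j)
  pairLimit-difference-< i i<n = begin
    (pairLimit N i j -ℚ pairLimit N i (suc j)) -ℚ (pairLimit N (suc i) j -ℚ pairLimit N (suc i) (suc j))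
      ≡⟨ cong₂ _-ℚ_ (cong₂ _-ℚ_ (cong (λ m → (partP N i -ℚ partQ N j) +ℚ m) (M-value i (1ℚ +ℚ V) v≡ j J refl))
                                (cong (λ m → (partP N i -ℚ partQ N (suc j)) +ℚ m) (M-value i (1ℚ +ℚ V) v≡ (suc j) (1ℚ +ℚ J) (ℕtoℚ-suc j))))
                    (cong₂ _-ℚ_ (cong (λ m → (partP N (suc i) -ℚ partQ N j) +ℚ m) (M-value (suc i) V refl j J refl))
                                (cong (λ m → (partP N (suc i) -ℚ partQ N (suc j)) +ℚ m) (M-value (suc i) V refl (suc j) (1ℚ +ℚ J) (ℕtoℚ-suc j)))) ⟩
    (((partP N i -ℚ partQ N j) +ℚ (t *ℚ ν *ℚ J *ℚ q -ℚ t *ℚ J *ℚ (1ℚ +ℚ V) *ℚ p))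
      -ℚ ((partP N i -ℚ partQ N (suc j)) +ℚ (t *ℚ ν *ℚ (1ℚ +ℚ J) *ℚ q -ℚ t *ℚ (1ℚ +ℚ J) *ℚ (1ℚ +ℚ V) *ℚ p′)))
    -ℚ (((partP N (suc i) -ℚ partQ N j) +ℚ (t *ℚ ν *ℚ J *ℚ q′ -ℚ t *ℚ J *ℚ V *ℚ p))
      -ℚ ((partP N (suc i) -ℚ partQ N (suc j)) +ℚ (t *ℚ ν *ℚ (1ℚ +ℚ J) *ℚ q′ -ℚ t *ℚ (1ℚ +ℚ J) *ℚ V *ℚ p′)))
      ≡⟨ collapse (partP N i) (partP N (suc i)) (partQ N j) (partQ N (suc j)) t ν J V q q′ p p′ ⟩
    t *ℚ ν *ℚ (q′ -ℚ q) +ℚ t *ℚ ((1ℚ +ℚ J) *ℚ p′ -ℚ J *ℚ p)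
      ≡⟨ cong₂ (λ x y → t *ℚ ν *ℚ x +ℚ t *ℚ y) (cong₂ _-ℚ_ (cross-inverse q′ q (ν +ℚ I) q-inv) (cross-inverse q q′ (ν +ℚ (1ℚ +ℚ I)) q′-inv))
           (cong₂ (λ x y → (1ℚ +ℚ J) *ℚ x -ℚ J *ℚ y) (cross-inverse p′ p (ν +ℚ J) p-inv) (cross-inverse p p′ (ν +ℚ (1ℚ +ℚ J)) p′-inv)) ⟩
    t *ℚ ν *ℚ (q′ *ℚ (q *ℚ (ν +ℚ I)) -ℚ q *ℚ (q′ *ℚ (ν +ℚ (1ℚ +ℚ I)))) +ℚ t *ℚ ((1ℚ +ℚ J) *ℚ (p′ *ℚ (p *ℚ (ν +ℚ J))) -ℚ J *ℚ (p *ℚ (p′ *ℚ (ν +ℚ (1ℚ +ℚ J)))))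
      ≡⟨ solve 8 (λ t ν I J q q′ p p′ →
           t :* ν :* (q′ :* (q :* (ν :+ I)) :- q :* (q′ :* (ν :+ (con 1ℚ :+ I)))) :+ t :* ((con 1ℚ :+ J) :* (p′ :* (p :* (ν :+ J))) :- J :* (p :* (p′ :* (ν :+ (con 1ℚ :+ J)))))
           := t :* ν :* (p′ :* p) :- t :* ν :* (q′ :* q)) refl t ν I J q q′ p p′ ⟩
    t *ℚ ν *ℚ (p′ *ℚ p) -ℚ t *ℚ ν *ℚ (q′ *ℚ q)
      ≡⟨ sym (cong₂ _-ℚ_ (choose j) (choose i)) ⟩
    frac N ((N + suc j) C 2) -ℚ frac N ((N + suc i) C 2)
      ≡⟨ sym (cFormula-< (suc j) (s≤s i<n)) ⟩
    cFormula N (suc i) (suc j) ∎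
    where
    open ≡-Reasoning
    open ℚ-Solver.+-*-Solver using (solve; _:+_; _:*_; _:-_; con; _:=_)
    I = ℕtoℚ i
    V = ℕtoℚ (n ∸ suc i)
    q  = inv (N + i)
    q′ = inv (N + suc i)
    q-inv : q *ℚ (ν +ℚ I) ≡ 1ℚ
    q-inv = trans (cong (q *ℚ_) (sym (ℕtoℚ-+ N i))) (inv-* {N + i} (s≤s z≤n))
    q′-inv : q′ *ℚ (ν +ℚ (1ℚ +ℚ I)) ≡ 1ℚ
    q′-inv = trans (cong (q′ *ℚ_) (sym (trans (ℕtoℚ-+ N (suc i)) (cong (ν +ℚ_) (ℕtoℚ-suc i))))) (inv-* {N + suc i} (s≤s z≤n))
    v≡ : ℕtoℚ (n ∸ i) ≡ 1ℚ +ℚ V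
    v≡ = trans (cong ℕtoℚ (ℕₚ.+-∸-assoc 1 i<n)) (ℕtoℚ-suc (n ∸ suc i))
    M-value : ∀ b v → ℕtoℚ (n ∸ b) ≡ v → ∀ a α → ℕtoℚ a ≡ α → partM N b a ≡ t *ℚ ν *ℚ α *ℚ inv (N + b) -ℚ t *ℚ α *ℚ v *ℚ inv (N + a)
    M-value b .(ℕtoℚ (n ∸ b)) refl a .(ℕtoℚ a) refl = cong₂ (λ x y → x *ℚ inv (N + b) -ℚ y *ℚ inv (N + a)) (product₃ 2 N a) (product₃ 2 a (n ∸ b))
    choose : ∀ k → frac N ((N + suc k) C 2) ≡ t *ℚ ν *ℚ (inv (N + suc k) *ℚ inv (N + k))
    choose k rewrite ℕₚ.+-suc n k = frac-choose₂ N (N + k) (s≤s z≤n)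
    collapse : ∀ P P′ Q Q′ t ν J V q q′ p p′ →
      (((P -ℚ Q) +ℚ (t *ℚ ν *ℚ J *ℚ q -ℚ t *ℚ J *ℚ (1ℚ +ℚ V) *ℚ p)) -ℚ ((P -ℚ Q′) +ℚ (t *ℚ ν *ℚ (1ℚ +ℚ J) *ℚ q -ℚ t *ℚ (1ℚ +ℚ J) *ℚ (1ℚ +ℚ V) *ℚ p′)))
      -ℚ (((P′ -ℚ Q) +ℚ (t *ℚ ν *ℚ J *ℚ q′ -ℚ t *ℚ J *ℚ V *ℚ p)) -ℚ ((P′ -ℚ Q′) +ℚ (t *ℚ ν *ℚ (1ℚ +ℚ J) *ℚ q′ -ℚ t *ℚ (1ℚ +ℚ J) *ℚ V *ℚ p′)))
      ≡ t *ℚ ν *ℚ (q′ -ℚ q) +ℚ t *ℚ ((1ℚ +ℚ J) *ℚ p′ -ℚ J *ℚ p)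
    collapse = solve 12 (λ P P′ Q Q′ t ν J V q q′ p p′ →
      (((P :- Q) :+ (t :* ν :* J :* q :- t :* J :* (con 1ℚ :+ V) :* p)) :- ((P :- Q′) :+ (t :* ν :* (con 1ℚ :+ J) :* q :- t :* (con 1ℚ :+ J) :* (con 1ℚ :+ V) :* p′)))
      :- (((P′ :- Q) :+ (t :* ν :* J :* q′ :- t :* J :* V :* p)) :- ((P′ :- Q′) :+ (t :* ν :* (con 1ℚ :+ J) :* q′ :- t :* (con 1ℚ :+ J) :* V :* p′)))
      := t :* ν :* (q′ :- q) :+ t :* ((con 1ℚ :+ J) :* p′ :- J :* p)) refl

  -- Two of the four terms are 0, so `partP` cancels but `partQ` does not. Its difference supplies
  -- the numerators with label plus one and label minus one.
  pairLimit-difference-top : (pairLimit N n j -ℚ pairLimit N n (suc j)) -ℚ (0ℚ -ℚ 0ℚ) ≡ cFormula N N (suc j)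
  pairLimit-difference-top = begin
    (pairLimit N n j -ℚ pairLimit N n (suc j)) -ℚ (0ℚ -ℚ 0ℚ)
      ≡⟨ cong (λ x → x -ℚ (0ℚ -ℚ 0ℚ)) (cong₂ _-ℚ_
           (cong₂ (λ y m → (P -ℚ y) +ℚ m) Q-value (M-value j J refl))
           (cong₂ (λ y m → (P -ℚ y) +ℚ m) Q′-value (M-value (suc j) (1ℚ +ℚ J) (ℕtoℚ-suc j)))) ⟩
    (((P -ℚ (J +ℚ t *ℚ J *ℚ (ν +ℚ Y₀) *ℚ (p *ℚ s))) +ℚ t *ℚ ν *ℚ J *ℚ q)
      -ℚ ((P -ℚ ((1ℚ +ℚ J) +ℚ t *ℚ (1ℚ +ℚ J) *ℚ (ν +ℚ (ν +ℚ J)) *ℚ (p′ *ℚ p))) +ℚ t *ℚ ν *ℚ (1ℚ +ℚ J) *ℚ q)) -ℚ (0ℚ -ℚ 0ℚ)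
      ≡⟨ solve 9 (λ P t ν J Y₀ p p′ s q →
           (((P :- (J :+ t :* J :* (ν :+ Y₀) :* (p :* s))) :+ t :* ν :* J :* q)
             :- ((P :- ((con 1ℚ :+ J) :+ t :* (con 1ℚ :+ J) :* (ν :+ (ν :+ J)) :* (p′ :* p))) :+ t :* ν :* (con 1ℚ :+ J) :* q)) :- (con 0ℚ :- con 0ℚ)
           := (con 1ℚ :- (t :* ν) :* q) :+ ((t :* ν :* (con 1ℚ :+ (con 1ℚ :+ J)) :* (p′ :* p) :+ t :* J :* p :* (p′ :* (ν :+ (con 1ℚ :+ J))))
              :- (t :* ν :* J :* (p :* s) :+ t :* J :* p :* (s :* Y₀)))) refl P t ν J Y₀ p p′ s q ⟩
    (1ℚ -ℚ (t *ℚ ν) *ℚ q) +ℚ ((t *ℚ ν *ℚ (1ℚ +ℚ (1ℚ +ℚ J)) *ℚ (p′ *ℚ p) +ℚ t *ℚ J *ℚ p *ℚ (p′ *ℚ (ν +ℚ (1ℚ +ℚ J))))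
              -ℚ (t *ℚ ν *ℚ J *ℚ (p *ℚ s) +ℚ t *ℚ J *ℚ p *ℚ (s *ℚ Y₀)))
      ≡⟨ cong₂ (λ x y → (1ℚ -ℚ (t *ℚ ν) *ℚ q) +ℚ ((t *ℚ ν *ℚ (1ℚ +ℚ (1ℚ +ℚ J)) *ℚ (p′ *ℚ p) +ℚ t *ℚ J *ℚ p *ℚ x)
              -ℚ (t *ℚ ν *ℚ J *ℚ (p *ℚ s) +ℚ t *ℚ J *ℚ p *ℚ y))) p′-inv s-inv ⟩
    (1ℚ -ℚ (t *ℚ ν) *ℚ q) +ℚ ((t *ℚ ν *ℚ (1ℚ +ℚ (1ℚ +ℚ J)) *ℚ (p′ *ℚ p) +ℚ t *ℚ J *ℚ p *ℚ 1ℚ) -ℚ (t *ℚ ν *ℚ J *ℚ (p *ℚ s) +ℚ t *ℚ J *ℚ p *ℚ 1ℚ))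
      -- Here D = 2N - 1 and q D = 1, so 1 - 2N q = q D - (1 + D) q = -q, the last term of the
      -- formula.
      ≡⟨ cong₂ (λ x y → (x -ℚ y *ℚ q) +ℚ ((t *ℚ ν *ℚ (1ℚ +ℚ (1ℚ +ℚ J)) *ℚ (p′ *ℚ p) +ℚ t *ℚ J *ℚ p *ℚ 1ℚ) -ℚ (t *ℚ ν *ℚ J *ℚ (p *ℚ s) +ℚ t *ℚ J *ℚ p *ℚ 1ℚ)))
           (sym q-inv) tν≡ ⟩
    (q *ℚ D -ℚ (1ℚ +ℚ D) *ℚ q) +ℚ ((t *ℚ ν *ℚ (1ℚ +ℚ (1ℚ +ℚ J)) *ℚ (p′ *ℚ p) +ℚ t *ℚ J *ℚ p *ℚ 1ℚ) -ℚ (t *ℚ ν *ℚ J *ℚ (p *ℚ s) +ℚ t *ℚ J *ℚ p *ℚ 1ℚ))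
      ≡⟨ solve 8 (λ t ν J p p′ s q D →
           (q :* D :- (con 1ℚ :+ D) :* q) :+ ((t :* ν :* (con 1ℚ :+ (con 1ℚ :+ J)) :* (p′ :* p) :+ t :* J :* p :* con 1ℚ) :- (t :* ν :* J :* (p :* s) :+ t :* J :* p :* con 1ℚ))
           := (t :* (ν :* (con 1ℚ :+ (con 1ℚ :+ J))) :* (p′ :* p) :- t :* (ν :* J) :* (p :* s)) :- q) refl t ν J p p′ s q D ⟩
    (t *ℚ (ν *ℚ (1ℚ +ℚ (1ℚ +ℚ J))) *ℚ (p′ *ℚ p) -ℚ t *ℚ (ν *ℚ J) *ℚ (p *ℚ s)) -ℚ q
      ≡⟨ sym (cong₂ _-ℚ_ (cong₂ _-ℚ_ first-term second-term) third-term) ⟩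
    (frac (N * (suc j + 1)) ((N + suc j) C 2) -ℚ frac (N * (suc j ∸ 1)) ((N + suc j ∸ 1) C 2)) -ℚ frac N ((2 * N) C 2)
      ≡⟨ sym (cFormula-top N (suc j)) ⟩
    cFormula N N (suc j) ∎
    where
    open ≡-Reasoning
    open ℚ-Solver.+-*-Solver using (solve; _:+_; _:*_; _:-_; con; _:=_)
    P = partP N n
    Y₀ = ℕtoℚ (n + j)
    D = ℕtoℚ (N + n)
    s = inv (n + j)
    q = inv (N + n)
    1≤n+j : 1 ≤ n + j
    1≤n+j = ℕₚ.≤-trans (ℕₚ.≤-pred 2≤n) (ℕₚ.m≤m+n n j)
    s-inv : s *ℚ Y₀ ≡ 1ℚ
    s-inv = inv-* 1≤n+j
    q-inv : q *ℚ D ≡ 1ℚ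
    q-inv = inv-* {N + n} (s≤s z≤n)
    double : 2 * N ≡ suc (N + n)
    double = lem n
      where
      lem : ∀ n → 2 * suc n ≡ suc (suc n + n)
      lem = ℕ-Ring.solve-∀
    tν≡ : t *ℚ ν ≡ 1ℚ +ℚ D
    tν≡ = trans (sym (ℕtoℚ-* 2 N)) (trans (cong ℕtoℚ double) (ℕtoℚ-suc (N + n)))
    M-value : ∀ a α → ℕtoℚ a ≡ α → partM N n a ≡ t *ℚ ν *ℚ α *ℚ q
    M-value a .(ℕtoℚ a) refl = trans (cong₂ (λ x y → x *ℚ q -ℚ ℕtoℚ y *ℚ inv (N + a)) (product₃ 2 N a)
        (trans (cong (2 * a *_) (ℕₚ.n∸n≡0 n)) (ℕₚ.*-zeroʳ (2 * a))))
      (solve 2 (λ x i → x :- con 0ℚ :* i := x) refl (t *ℚ ν *ℚ ℕtoℚ a *ℚ q) (inv (N + a)))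
    Q-value : partQ N j ≡ J +ℚ t *ℚ J *ℚ (ν +ℚ Y₀) *ℚ (p *ℚ s)
    Q-value = cong (λ x → J +ℚ x *ℚ (p *ℚ s)) (trans (product₃ 2 j (2 * N + j ∸ 1))
      (cong (t *ℚ J *ℚ_) (trans (cong ℕtoℚ (lem n j)) (ℕtoℚ-+ N (n + j)))))
      where
      lem : ∀ n j → n + (suc n + 0) + j ≡ suc n + (n + j)
      lem = ℕ-Ring.solve-∀
    Q′-value : partQ N (suc j) ≡ (1ℚ +ℚ J) +ℚ t *ℚ (1ℚ +ℚ J) *ℚ (ν +ℚ (ν +ℚ J)) *ℚ (p′ *ℚ p)
    Q′-value = cong₂ _+ℚ_ (ℕtoℚ-suc j) (cong₂ _*ℚ_
      (trans (product₃ 2 (suc j) (2 * N + suc j ∸ 1)) (cong₂ (λ x y → t *ℚ x *ℚ y) (ℕtoℚ-suc j)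
        (trans (cong ℕtoℚ (lem n j)) (trans (ℕtoℚ-+ N (N + j)) (cong (ν +ℚ_) (ℕtoℚ-+ N j))))))
      (cong (λ k → p′ *ℚ inv k) (ℕₚ.+-suc n j)))
      where
      lem : ∀ n j → n + (suc n + 0) + suc j ≡ suc n + (suc n + j)
      lem = ℕ-Ring.solve-∀
    first-term : frac (N * (suc j + 1)) ((N + suc j) C 2) ≡ t *ℚ (ν *ℚ (1ℚ +ℚ (1ℚ +ℚ J))) *ℚ (p′ *ℚ p)
    first-term rewrite ℕₚ.+-suc n j = trans (frac-choose₂ (N * (suc j + 1)) (N + j) (s≤s z≤n))
      (cong (λ x → t *ℚ x *ℚ (inv (suc (N + j)) *ℚ p)) (trans (ℕtoℚ-* N (suc j + 1)) (cong (ν *ℚ_)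
        (trans (cong ℕtoℚ (ℕₚ.+-comm (suc j) 1)) (trans (ℕtoℚ-suc (suc j)) (cong (1ℚ +ℚ_) (ℕtoℚ-suc j)))))))
    second-term : frac (N * (suc j ∸ 1)) ((N + suc j ∸ 1) C 2) ≡ t *ℚ (ν *ℚ J) *ℚ (p *ℚ s)
    second-term rewrite ℕₚ.+-suc n j = trans (frac-choose₂ (N * j) (n + j) 1≤n+j) (cong (λ x → t *ℚ x *ℚ (p *ℚ s)) (ℕtoℚ-* N j))
    third-term : frac N ((2 * N) C 2) ≡ q
    third-term = begin
      frac N ((2 * N) C 2)                      ≡⟨ cong (λ k → frac N (k C 2)) double ⟩
      frac N (suc (N + n) C 2)                  ≡⟨ frac-choose₂ N (N + n) (s≤s z≤n) ⟩
      t *ℚ ν *ℚ (inv (suc (N + n)) *ℚ q)        ≡⟨ cong (_*ℚ (inv (suc (N + n)) *ℚ q)) (trans tν≡ (sym (ℕtoℚ-suc (N + n)))) ⟩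
      ℕtoℚ (suc (N + n)) *ℚ (inv (suc (N + n)) *ℚ q)
        ≡⟨ solve 3 (λ x i q → x :* (i :* q) := (i :* x) :* q) refl (ℕtoℚ (suc (N + n))) (inv (suc (N + n))) q ⟩
      (inv (suc (N + n)) *ℚ ℕtoℚ (suc (N + n))) *ℚ q ≡⟨ cong (_*ℚ q) (inv-* {suc (N + n)} (s≤s z≤n)) ⟩
      1ℚ *ℚ q                                   ≡⟨ ℚₚ.*-identityˡ q ⟩
      q ∎

adjProb-limit : ∀ {n i j u₁ u₂ u₃ u₄} → suc j ≤ i → suc i ≤ n →
  Limit n (λ L π → expectedPairs n L π i j) u₁ → Limit n (λ L π → expectedPairs n L π i (suc j)) u₂ →
  Limit n (λ L π → expectedPairs n L π (suc i) j) u₃ → Limit n (λ L π → expectedPairs n L π (suc i) (suc j)) u₄ →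
  IsTwoPointCorrelation n (suc i) (suc j) ((u₁ -ℚ u₂) -ℚ (u₃ -ℚ u₄))
adjProb-limit {n} {i} {j} {u₁} {u₂} {u₃} {u₄} j<i i<n l₁ l₂ l₃ l₄ =
  Limit-cong {f = λ L π → (E i j L π -ℚ E i (suc j) L π) -ℚ (E (suc i) j L π -ℚ E (suc i) (suc j) L π)}
    {g = λ L π → adjProb n L π (suc i) (suc j)} {v = (u₁ -ℚ u₂) -ℚ (u₃ -ℚ u₄)}
    (λ L π → sym (adjProb-expectedPairs {L = L} π j<i i<n))
    (Limit-- {f = λ L π → E i j L π -ℚ E i (suc j) L π} {g = λ L π → E (suc i) j L π -ℚ E (suc i) (suc j) L π} {u₁ -ℚ u₂} {u₃ -ℚ u₄}
      (Limit-- {f = E i j} {g = E i (suc j)} {u₁} {u₂} l₁ l₂)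
      (Limit-- {f = E (suc i) j} {g = E (suc i) (suc j)} {u₃} {u₄} l₃ l₄))
  where
  E : ℕ → ℕ → ℕ → (List ℕ → ℚ) → ℚ
  E b a L π = expectedPairs n L π b a

theorem1p1 : (n i j : ℕ) → 2 ≤ n → 1 ≤ j → j < i → i ≤ n →
    IsTwoPointCorrelation n i j (cFormula n i j)
theorem1p1 (suc n) (suc i) (suc j) 2≤n _ (s≤s j<i) (s≤s i≤n) with ℕₚ.m≤n⇒m<n∨m≡n i≤n
... | inj₁ i<n = subst (IsTwoPointCorrelation (suc n) (suc i) (suc j)) (pairLimit-difference-< n j 2≤n i i<n)
  (adjProb-limit {u₁ = pairLimit (suc n) i j} {pairLimit (suc n) i (suc j)} {pairLimit (suc n) (suc i) j} {pairLimit (suc n) (suc i) (suc j)} j<i (s≤s i≤n)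
    (expectedPairs-limit n i j 2≤n (ℕₚ.<⇒≤ j<i) i≤n) (expectedPairs-limit n i (suc j) 2≤n j<i i≤n)
    (expectedPairs-limit n (suc i) j 2≤n (ℕₚ.m≤n⇒m≤1+n (ℕₚ.<⇒≤ j<i)) i<n)
    (expectedPairs-limit n (suc i) (suc j) 2≤n (ℕₚ.m≤n⇒m≤1+n j<i) i<n))
-- For i = n the upper threshold equals the number of particles, where the expected number of pairs
-- is 0 for every L.
... | inj₂ refl = subst (IsTwoPointCorrelation (suc n) (suc n) (suc j)) (pairLimit-difference-top n j 2≤n)
  (adjProb-limit {u₁ = pairLimit (suc n) n j} {pairLimit (suc n) n (suc j)} {0ℚ} {0ℚ} j<i (s≤s i≤n)
    (expectedPairs-limit n n j 2≤n (ℕₚ.<⇒≤ j<i) i≤n) (expectedPairs-limit n n (suc j) 2≤n j<i i≤n)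
    (Limit-0 {f = λ L π → expectedPairs (suc n) L π (suc n) j} (λ L π → expectedPairs-top {L = L} π (ℕₚ.m≤n⇒m≤1+n (ℕₚ.<⇒≤ j<i))))
    (Limit-0 {f = λ L π → expectedPairs (suc n) L π (suc n) (suc j)} (λ L π → expectedPairs-top {L = L} π (ℕₚ.m≤n⇒m≤1+n j<i))))
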